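{- Let $n\ge1$, $\mathbf{x}=(x_1,\ldots,x_n)$, $\overline{\mathbf{x}}=(\overline{x}_1,\ldots,\overline{x}_n)$ with $\overline{x}_i=x_i^{ -1}$, let $\lambda$ be any partition of length $\ell(\lambda)\le n$, and let $\mathbf{a}=(a_1,a_2,\ldots)$ be any sequence of parameters, extended by $a_m=0$ for $m\le 0$. Then $$s_\lambda(\mathbf{x}|\mathbf{a})=\sum_{T\in\mathcal{T}_\lambda}\ \prod_{(i,j)\in F^\lambda}\mathrm{wgt}(T_{ij}),\qquad \mathrm{wgt}(T_{ij})=x_k+a_{k+j-i}\ \text{ if } T_{ij}=k;$$ $$sp_\lambda(\mathbf{x},\overline{\mathbf{x}}|\mathbf{a})=\sum_{T\in\mathcal{T}^{sp}_\lambda}\ \prod_{(i,j)\in F^\lambda}\mathrm{wgt}(T_{ij}),\qquad \mathrm{wgt}(T_{ij})=\begin{cases}x_k+a_{2k-1-n+j-i}&\text{if }T_{ij}=k,\\ \overline{x}_k+a_{2k-n+j-i}&\text{if }T_{ij}=\overline{k};\end{cases}$$ $$so_\lambda(\mathbf{x},\overline{\mathbf{x}},1|\mathbf{a})=\sum_{T\in\mathcal{T}^{so}_\lambda}\ \prod_{(i,j)\in F^\lambda}\mathrm{wgt}(T_{ij}),\qquad \mathrm{wgt}(T_{ij})=\begin{cases}x_k+a_{2k-n+j-i}&\text{if }T_{ij}=k,\\ \overline{x}_k+a_{2k+1-n+j-i}&\text{if }T_{ij}=\overline{k},\\ 1-a_{n+1+j-i}&\text{if }T_{ij}=0.\end{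cases}$$
   Context: The $x_i$ are indeterminates (with formal square roots $x_i^{1/2}$, and $\overline{x}_i^{1/2}=(x_i^{1/2})^{ -1}$). A partition $\lambda=(\lambda_1\ge\cdots\ge\lambda_n\ge0)$ is padded with zeros to $n$ parts. Factorial powers: for $z=x_i$ or $z=\overline{x}_i$, $(z\,|\,\mathbf{a})^m=(z+a_1)(z+a_2)\cdots(z+a_m)$ for $m>0$ and $(z\,|\,\mathbf{a})^0=1$. Factorial characters (all determinants $n\times n$, row index $i$, column index $j$): $$s_\lambda(\mathbf{x}|\mathbf{a})=\frac{\det\big((x_i|\mathbf{a})^{\lambda_j+n-j}\big)}{\det\big((x_i|\mathbf{a})^{n-j}\big)},$$ $$sp_\lambda(\mathbf{x},\overline{\mathbf{x}}|\mathbf{a})=\frac{\det\big(x_i(x_i|\mathbf{a})^{\lambda_j+n-j}-\overline{x}_i(\overline{x}_i|\mathbf{a})^{\lambda_j+n-j}\big)}{\det\big(x_i(x_i|\mathbf{a})^{n-j}-\overline{x}_i(\overline{x}_i|\mathbf{a})^{n-j}\big)},$$ $$so_\lambda(\mathbf{x},\overline{\mathbf{x}},1|\mathbf{a})=\frac{\det\big(x_i^{1/2}(x_i|\mathbf{a})^{\lambda_j+n-j}-\overline{x}_i^{1/2}(\overline{x}_i|\mathbf{a})^{\lambda_j+n-j}\big)}{\det\big(x_i^{1/2}(x_i|\mathbf{a})^{n-j}-\overline{x}_i^{1/2}(\overline{x}_i|\mathbf{a})^{n-j}\big)}.$$ Tableaux: the Young diagram of $\lambda$ is $F^\lambda=\{(i,j):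 1\le i\le\ell(\lambda),\ 1\le j\le\lambda_i\}$, where $(i,j)$ is the box in row $i$ (counted from the top) and column $j$ (counted from the left). A tableau $T$ of shape $\lambda$ assigns to each box $(i,j)\in F^\lambda$ an entry $T_{ij}$ from a totally ordered alphabet. Consider the conditions: (T1) entries weakly increase across rows from left to right; (T2) entries weakly increase down columns from top to bottom; (T3) no two identical non-zero entries appear in the same column; (T4) for each $k=1,\dots,n$, neither $k$ nor $\overline{k}$ appears lower than the $k$th row; (T5) in any row $0$ appears at most once. $\mathcal{T}_\lambda$ is the set of tableaux of shape $\lambda$ with entries in $\{1<2<\cdots<n\}$ satisfying (T1)–(T3). $\mathcal{T}^{sp}_\lambda$ is the set of tableaux of shape $\lambda$ with entries in $\{1<\overline{1}<2<\overline{2}<\cdots<n<\overline{n}\}$ satisfying (T1)–(T4). $\mathcal{T}^{so}_\lambda$ is the set of tableaux of shape $\lambda$ with entries in $\{1<\overline{1}<2<\overline{2}<\cdots<n<\overline{n}<0\}$ satisfying (T1)–(T5). -}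

module Defs where

open import Level using (Level; _⊔_) renaming (suc to lsuc)
open import Algebra.Bundles using (CommutativeRing)
import Algebra.Properties.Monoid.Sum as MonoidSum
import Algebra.Properties.Semiring.Exp as Exp
open import Data.Fin.Base as Fin using (Fin; zero; suc; toℕ; punchIn)
open import Data.Fin.Properties using (all?; ∀-cons)
import Data.Fin.Properties as Finₚ
open import Data.Integer.Base as ℤ using (ℤ; +_; -[1+_])
open import Data.List.Base as List
  using (List; []; _∷_; [_]; _++_; allFin; concatMap; map; foldr; filter;
         cartesianProductWith)
open import Data.List.Relation.Unary.All using (All)
open import Data.List.Relation.Unary.Unique.Propositional using (Unique)
open import Data.Nat.Base as ℕ using (ℕ; zero; suc)
import Data.Nat.Properties as ℕₚ
open import Data.Product.Base using (_×_; _,_; proj₁; proj₂)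
open import Data.Sum.Base using (_⊎_)
open import Data.Vec.Base using (Vec; lookup)
open import Relation.Binary.Definitions using (DecidableEquality)
open import Relation.Binary.PropositionalEquality.Core using (_≡_; _≢_; refl; cong)
open import Relation.Nullary.Decidable using (Dec; yes; no; map′; _×-dec_; _⊎-dec_; _→-dec_; ¬?)
open import Relation.Unary using (Decidable)

-- Inversion is total so that quotients can be written without carrying a
-- proof; nothing is assumed about 0# ⁻¹.
record Field c ℓ : Set (lsuc (c ⊔ ℓ)) where
  field
    commutativeRing : CommutativeRing c ℓ

  open CommutativeRing commutativeRing public

  infix 8 _⁻¹
  infixl 7 _/_

  field
    _⁻¹      : Carrier → Carrier
    ⁻¹-cong  : ∀ {x y} → x ≈ y → x ⁻¹ ≈ y ⁻¹
    1≉0      : 1# ≉ 0#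
    inverseʳ : ∀ x → x ≉ 0# → x * x ⁻¹ ≈ 1#

  _/_ : Carrier → Carrier → Carrier
  x / y = x * y ⁻¹

  open MonoidSum +-monoid public using () renaming (sum to ∑)
  open MonoidSum *-monoid public using () renaming (sum to ∏)
  open Exp semiring public using (_^_)

module _ {c ℓ c′ ℓ′} (k : CommutativeRing c′ ℓ′) (K : Field c ℓ) where
  private module k = CommutativeRing k
  open Field K

  -- A polynomial is a list of terms, each a coefficient in k together with
  -- an exponent vector, the exponent vectors being pairwise distinct.
  -- The xᵢ are indeterminates over k (acting through ι) when only the zero
  -- polynomial vanishes on them.
  AlgebraicallyIndependent : (k.Carrier → Carrier) →
                             ∀ {n} → (Fin n → Carrier) → Set (ℓ ⊔ c′ ⊔ ℓ′)
  AlgebraicallyIndependent ι {n} x =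
    (p : List (k.Carrier × Vec ℕ n)) → Unique (map proj₂ p) →
    foldr _+_ 0# (map (λ (q , e) → ι q * ∏ (λ i → x i ^ lookup e i)) p) ≈ 0# →
    All (λ (q , _) → q k.≈ k.0#) p

-- A partition padded with zeros to n parts; Fin n indexes λ₁, …, λₙ from 0.
IsPartition : ∀ {n} → (Fin n → ℕ) → Set
IsPartition μ = ∀ i j → i Fin.≤ j → μ j ℕ.≤ μ i

-- num k and bar k are the letters k+1 and its barred companion.
data Letter (n : ℕ) : Set where
  num bar : Fin n → Letter n
  𝟎       : Letter n

data SpLetter (n : ℕ) : Set where
  num bar : Fin n → SpLetter n

⌊_⌋ : ∀ {n} → SpLetter n → Letter n
⌊ num k ⌋ = num k
⌊ bar k ⌋ = bar k

-- Position in 1 < 1̄ < 2 < 2̄ < ⋯ < n < n̄ < 0.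
rank : ∀ {n} → Letter n → ℕ
rank     (num k) = 2 ℕ.* toℕ k
rank     (bar k) = suc (2 ℕ.* toℕ k)
rank {n} 𝟎       = 2 ℕ.* n

infix 4 _≼_
_≼_ : ∀ {n} → Letter n → Letter n → Set
l ≼ m = rank l ℕ.≤ rank m

infix 4 _≟_
_≟_ : ∀ {n} → DecidableEquality (Letter n)
num k ≟ num l = map′ (cong num) (λ { refl → refl }) (k Finₚ.≟ l)
num _ ≟ bar _ = no λ ()
num _ ≟ 𝟎     = no λ ()
bar _ ≟ num _ = no λ ()
bar k ≟ bar l = map′ (cong bar) (λ { refl → refl }) (k Finₚ.≟ l)
bar _ ≟ 𝟎     = no λ ()
𝟎     ≟ num _ = no λ ()
𝟎     ≟ bar _ = no λ ()
𝟎     ≟ 𝟎     = yes refl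

spLetters : ∀ n → List (SpLetter n)
spLetters n = concatMap (λ k → num k ∷ bar k ∷ []) (allFin n)

soLetters : ∀ n → List (Letter n)
soLetters n = map ⌊_⌋ (spLetters n) ++ [ 𝟎 ]

-- The box in row i+1 and column j+1 is addressed by i : Fin n, j : Fin (μ i);
-- rows beyond the length of μ have no boxes.
Filling : ∀ {n} → (Fin n → ℕ) → Set → Set
Filling μ A = ∀ i → Fin (μ i) → A

mapEntries : ∀ {n} {μ : Fin n → ℕ} {A B : Set} →
             (A → B) → Filling μ A → Filling μ B
mapEntries f T i j = f (T i j)

module _ {n} {μ : Fin n → ℕ} (T : Filling μ (Letter n)) where

  T1 : Set
  T1 = ∀ i (j j′ : Fin (μ i)) → j Fin.≤ j′ → T i j ≼ T i j′

  T2 : Set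
  T2 = ∀ i i′ (j : Fin (μ i)) (j′ : Fin (μ i′)) → toℕ j ≡ toℕ j′ →
       i Fin.≤ i′ → T i j ≼ T i′ j′

  T3 : Set
  T3 = ∀ i i′ (j : Fin (μ i)) (j′ : Fin (μ i′)) → toℕ j ≡ toℕ j′ →
       i ≢ i′ → T i j ≡ T i′ j′ → T i j ≡ 𝟎

  T4 : Set
  T4 = ∀ k i (j : Fin (μ i)) → T i j ≡ num k ⊎ T i j ≡ bar k → i Fin.≤ k

  T5 : Set
  T5 = ∀ i (j j′ : Fin (μ i)) → T i j ≡ 𝟎 → T i j′ ≡ 𝟎 → j ≡ j′

  T1? : Dec T1
  T1? = all? λ i → all? λ j → all? λ j′ →
    (j Finₚ.≤? j′) →-dec (rank (T i j) ℕₚ.≤? rank (T i j′))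

  T2? : Dec T2
  T2? = all? λ i → all? λ i′ → all? λ j → all? λ j′ →
    (toℕ j ℕₚ.≟ toℕ j′) →-dec
    ((i Finₚ.≤? i′) →-dec (rank (T i j) ℕₚ.≤? rank (T i′ j′)))

  T3? : Dec T3
  T3? = all? λ i → all? λ i′ → all? λ j → all? λ j′ →
    (toℕ j ℕₚ.≟ toℕ j′) →-dec
    (¬? (i Finₚ.≟ i′) →-dec ((T i j ≟ T i′ j′) →-dec (T i j ≟ 𝟎)))

  T4? : Dec T4
  T4? = all? λ k → all? λ i → all? λ j →
    ((T i j ≟ num k) ⊎-dec (T i j ≟ bar k)) →-dec (i Finₚ.≤? k)

  T5? : Dec T5
  T5? = all? λ i → all? λ j → all? λ j′ →
    (T i j ≟ 𝟎) →-dec ((T i j′ ≟ 𝟎) →-dec (j Finₚ.≟ j′))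

-- All dependent functions with f i drawn from the i-th list; each occurs
-- exactly once up to pointwise equality if the lists have no repetitions.
functions : ∀ {n} {A : Fin n → Set} → (∀ i → List (A i)) → List (∀ i → A i)
functions {zero}  L = [ (λ ()) ]
functions {suc n} L =
  cartesianProductWith ∀-cons (L zero) (functions (λ i → L (suc i)))

fillings : ∀ {n} (μ : Fin n → ℕ) {A : Set} → List A → List (Filling μ A)
fillings μ letters = functions (λ i → functions (λ _ → letters))

module _ {n} (μ : Fin n → ℕ) where

  IsTableau : Filling μ (Fin n) → Set
  IsTableau T = T1 T′ × T2 T′ × T3 T′
    where T′ = mapEntries num T

  IsSpTableau : Filling μ (SpLetter n) → Set
  IsSpTableau T = T1 T′ × T2 T′ × T3 T′ × T4 T′
    where T′ = mapEntries ⌊_⌋ T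

  IsSoTableau : Filling μ (Letter n) → Set
  IsSoTableau T = T1 T × T2 T × T3 T × T4 T × T5 T

  isTableau? : Decidable IsTableau
  isTableau? T = T1? T′ ×-dec T2? T′ ×-dec T3? T′
    where T′ = mapEntries num T

  isSpTableau? : Decidable IsSpTableau
  isSpTableau? T = T1? T′ ×-dec T2? T′ ×-dec T3? T′ ×-dec T4? T′
    where T′ = mapEntries ⌊_⌋ T

  isSoTableau? : Decidable IsSoTableau
  isSoTableau? T = T1? T ×-dec T2? T ×-dec T3? T ×-dec T4? T ×-dec T5? T

  𝒯 : List (Filling μ (Fin n))
  𝒯 = filter isTableau? (fillings μ (allFin n))

  𝒯ˢᵖ : List (Filling μ (SpLetter n))
  𝒯ˢᵖ = filter isSpTableau? (fillings μ (spLetters n))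

  𝒯ˢᵒ : List (Filling μ (Letter n))
  𝒯ˢᵒ = filter isSoTableau? (fillings μ (soLetters n))

module FactorialCharacters {c ℓ} (K : Field c ℓ) where
  open Field K hiding (zero)

  -- Laplace expansion along the first row.
  det : ∀ {n} → (Fin n → Fin n → Carrier) → Carrier
  det {zero}  M = 1#
  det {suc n} M = ∑ λ j →
    (- 1#) ^ toℕ j * M zero j * det (λ r s → M (suc r) (punchIn j s))

  -- The sequence a₁, a₂, … extended by a_m = 0 for m ≤ 0; the value a 0 is
  -- never used.
  extend : (ℕ → Carrier) → ℤ → Carrier
  extend a (+ zero)  = 0#
  extend a (+ suc m) = a (suc m)
  extend a -[1+ _ ]  = 0#

  fpow : Carrier → (ℕ → Carrier) → ℕ → Carrier
  fpow z a zero    = 1#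
  fpow z a (suc m) = fpow z a m * (z + a (suc m))

  -- n − j, with j the column number counted from 1
  δ : ∀ {n} → Fin n → ℕ
  δ {n} j = n ℕ.∸ suc (toℕ j)

  -- j − i for the box in row i and column j
  content : ∀ {m n} → Fin m → Fin n → ℤ
  content i j = + toℕ j ℤ.- + toℕ i

  -- letters are numbered from 1 in the index formulas below
  value : ∀ {n} → Fin n → ℤ
  value k = + suc (toℕ k)

  -- x½ i plays the role of the square root of x i.
  module _ {n} (x x½ : Fin n → Carrier) (a : ℕ → Carrier) where

    x̄ x̄½ : Fin n → Carrier
    x̄  i = x i ⁻¹
    x̄½ i = x½ i ⁻¹

    s sp so : (Fin n → ℕ) → Carrier

    s μ = det (λ i j → fpow (x i) a (μ j ℕ.+ δ j))
        / det (λ i j → fpow (x i) a (δ j))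

    sp μ = det (λ i j → x i * fpow (x i) a (μ j ℕ.+ δ j)
                      - x̄ i * fpow (x̄ i) a (μ j ℕ.+ δ j))
         / det (λ i j → x i * fpow (x i) a (δ j)
                      - x̄ i * fpow (x̄ i) a (δ j))

    so μ = det (λ i j → x½ i * fpow (x i) a (μ j ℕ.+ δ j)
                      - x̄½ i * fpow (x̄ i) a (μ j ℕ.+ δ j))
         / det (λ i j → x½ i * fpow (x i) a (δ j)
                      - x̄½ i * fpow (x̄ i) a (δ j))

    a[_] : ℤ → Carrier
    a[_] = extend a

    -- The second argument is the content j − i of the box.
    wgt : Fin n → ℤ → Carrier
    wgt k d = x k + a[ value k ℤ.+ d ]

    wgtˢᵖ : SpLetter n → ℤ → Carrier
    wgtˢᵖ (num k) d = x k + a[ + 2 ℤ.* value k ℤ.- + 1 ℤ.- + n ℤ.+ d ]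
    wgtˢᵖ (bar k) d = x̄ k + a[ + 2 ℤ.* value k ℤ.- + n ℤ.+ d ]

    wgtˢᵒ : Letter n → ℤ → Carrier
    wgtˢᵒ (num k) d = x k + a[ + 2 ℤ.* value k ℤ.- + n ℤ.+ d ]
    wgtˢᵒ (bar k) d = x̄ k + a[ + 2 ℤ.* value k ℤ.+ + 1 ℤ.- + n ℤ.+ d ]
    wgtˢᵒ 𝟎       d = 1# - a[ + n ℤ.+ + 1 ℤ.+ d ]

  tableauSum : ∀ {n} (μ : Fin n → ℕ) {A : Set} →
               List (Filling μ A) → (A → ℤ → Carrier) → Carrier
  tableauSum μ 𝒮 w =
    foldr _+_ 0# (map (λ T → ∏ λ i → ∏ λ j → w (T i j) (content i j)) 𝒮)

-- All three formulas follow from branching rules for the numerators, which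
-- have the form det (f (μ j + n - j) (x i)).  A recurrence
--   f (t + 1) x = w x * h t x + (z + a_{t+1}) * f t x
-- and column operations rewrite column j through the columns h m with
-- μ (j + 1) ≤ m ≤ μ j (up to the staircase shift), so that multilinearity
-- gives a sum over horizontal strips, in which the removed boxes carry the
-- weights of the letter for z.
-- For s this is used with w x = x - x_n, which kills the last row and removes
-- the letter n.  For sp the letter n̄ is removed by
--   F t = (x|c)^t - (x̄|c)^t  ↦  Φ t = (x - x̄_n) (x|c)^t - (x̄ - x̄_n) (x̄|c)^t
-- with w = 1, and then n with w = x + x̄ - x_n - x̄_n, where
-- x w = (x - x_n) (x - x̄_n).  For so, multiplication of row i by
-- x_i^{1/2} + x̄_i^{1/2} gives F (t + 1) + (1 - a_{t+1}) F t, a sum over vertical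
-- strips that removes the letter 0.  The denominators are the case of the
-- empty partition, so no determinant needs to be evaluated separately.

module Submission where

open import Defs
open import Algebra.Bundles using (CommutativeRing)
open import Algebra.Morphism.Structures using (IsRingHomomorphism)
open import Data.Fin.Base using (Fin)
open import Data.Nat.Base using (ℕ; _≤_)
open import Data.Product.Base using (_×_)
open import Data.Product.Base using (_,_)

-- The two sides meet in `gtSum`, a weighted sum over chains of shapes with one shape for each
-- initial segment of the alphabet: column operations turn a numerator into a product of differences
-- times `gtSum`, and cutting a tableau at every letter turns the tableau sum into `gtSum`. The
-- obstacle in the symplectic case is that the removal of k leaves powers `(x|c)^t` with an extra
-- factor `x`. A shift of the parameters absorbs it: if c′ is c with a zero put in front, then
-- `x (x|c)^t = (x|c′)^(t+1)`. Every pair of letters removed thus costs one more leading zero. This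
-- is the origin of the rule that parameters with index at most 0 vanish, and of the 2k in the
-- weights: one k comes from the staircase shift of the columns, the other from the leading zeros.
-- The removal of k̄ keeps the number of rows and that of k lowers it by one, which is condition
-- (T4). Shapes and fillings are functions on ℕ, so that losing a row changes no type; lists of them
-- are compared up to pointwise equality on the boxes.

-- Enumeration of tableaux whose entries are ranks of letters.

module RankTableaux where

  open import Data.List.Base using (List; []; _∷_; [_]; map; concatMap; cartesianProductWith; filter)
  open import Data.List.Membership.Propositional using (_∈_; find; lose)
  open import Data.List.Membership.Propositional.Properties using (∈-cartesianProductWith⁺; ∈-cartesianProductWith⁻; ∈-concatMap⁺; ∈-concatMap⁻; ∈-map⁺; ∈-map⁻; ∈-filter⁺; ∈-filter⁻)
  open import Data.List.Relation.Unary.All as All using (All; []; _∷_)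
  open import Data.List.Relation.Unary.AllPairs using ([]; _∷_)
  open import Data.List.Relation.Unary.Any using (here; there)
  import Data.List.Relation.Unary.Any.Properties as Anyₚ
  import Data.List.Relation.Unary.Unique.Setoid as Uniq
  import Data.List.Relation.Unary.Unique.Setoid.Properties as Uniqₚ
  open import Data.Nat.Base
  open import Data.Nat.Properties
  open import Data.Product.Base using (∃; _×_; _,_; proj₁)
  open import Data.Sum.Base using (_⊎_; inj₁; inj₂)
  open import Function.Base using (_∘_; case_of_)
  open import Level using (0ℓ)
  open import Relation.Binary.Bundles using (Setoid)
  open import Relation.Binary.PropositionalEquality
    using (_≡_; _≢_; _≗_; refl; sym; trans; cong; subst; setoid; _→-setoid_)
  open import Relation.Nullary using (¬_; yes; no; contradiction)
  open import Relation.Unary using (Decidable)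

  Shape : Set
  Shape = ℕ → ℕ

  Fill : Set
  Fill = ℕ → ℕ → ℕ

  cons : ∀ {A : Set} → A → (ℕ → A) → ℕ → A
  cons v f zero    = v
  cons v f (suc i) = f i

  Anti : Shape → Set
  Anti μ = ∀ i → μ (suc i) ≤ μ i

  Rows : ℕ → Shape → Set
  Rows k μ = ∀ i → k ≤ i → μ i ≡ 0

  anti-≤ : ∀ {μ} → Anti μ → ∀ {i j} → i ≤ j → μ j ≤ μ i
  anti-≤ {μ} a {i} i≤j with ≤⇒≤′ i≤j
  ... | p = go p
    where
    go : ∀ {j} → i ≤′ j → μ j ≤ μ i
    go ≤′-refl     = ≤-refl
    go (≤′-step p) = ≤-trans (a _) (go p)

  pred≤⇒≤suc : ∀ {m n} → pred m ≤ n → m ≤ suc n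
  pred≤⇒≤suc {zero}  _ = z≤n
  pred≤⇒≤suc {suc m} p = s≤s p

  rows-< : ∀ {k μ i j} → Rows k μ → j < μ i → i < k
  rows-< {k} {μ} {i} r j<μi with i <? k
  ... | yes i<k = i<k
  ... | no  i≮k = contradiction (subst (_ <_) (r i (≮⇒≥ i≮k)) j<μi) λ ()

  range : ℕ → ℕ → List ℕ
  range lo zero    = [ lo ]
  range lo (suc d) = lo ∷ range (suc lo) d

  ∈-range⁻ : ∀ {v} lo d → v ∈ range lo d → lo ≤ v × v ≤ lo + d
  ∈-range⁻ lo zero    (here refl) = ≤-refl , m≤m+n lo 0
  ∈-range⁻ lo (suc d) (here refl) = ≤-refl , m≤m+n lo (suc d)
  ∈-range⁻ {v} lo (suc d) (there p) =
    let l , u = ∈-range⁻ (suc lo) d p in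
    ≤-trans (n≤1+n lo) l , subst (v ≤_) (sym (+-suc lo d)) u

  ∈-range⁺ : ∀ {v} lo d → lo ≤ v → v ≤ lo + d → v ∈ range lo d
  ∈-range⁺ {v} lo zero l u = here (≤-antisym (subst (v ≤_) (+-identityʳ lo) u) l)
  ∈-range⁺ {v} lo (suc d) l u with m≤n⇒m<n∨m≡n l
  ... | inj₁ lo<v = there (∈-range⁺ (suc lo) d lo<v (subst (v ≤_) (+-suc lo d) u))
  ... | inj₂ refl = here refl

  range-unique : ∀ lo d → Uniq.Unique (setoid ℕ) (range lo d)
  range-unique lo zero    = [] ∷ []
  range-unique lo (suc d) =
    All.tabulate (λ v∈ → <⇒≢ (proj₁ (∈-range⁻ (suc lo) d v∈))) ∷ range-unique (suc lo) d

  boxes : ℕ → Shape → Shape → List Shape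
  boxes zero    lo μ = [ (λ _ → 0) ]
  boxes (suc k) lo μ =
    cartesianProductWith cons (range (lo 0) (μ 0 ∸ lo 0)) (boxes k (lo ∘ suc) (μ ∘ suc))

  record InBox (k : ℕ) (lo μ ν : Shape) : Set where
    constructor inBox
    field
      lower : ∀ {i} → i < k → lo i ≤ ν i
      upper : ∀ {i} → i < k → ν i ≤ μ i
      empty : Rows k ν

  open InBox

  -- `range` always contains its lower end, even if `lo i` exceeds `μ i`; the hypothesis rules out
  -- such spurious shapes.
  boxes-sound : ∀ k {lo μ ν} → (∀ {i} → i < k → lo i ≤ μ i) →
                ν ∈ boxes k lo μ → InBox k lo μ ν
  boxes-sound zero    lo≤μ (here refl) = inBox (λ ()) (λ ()) λ _ _ → refl
  boxes-sound (suc k) {lo} {μ} lo≤μ ν∈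
    with ∈-cartesianProductWith⁻ cons (range (lo 0) (μ 0 ∸ lo 0)) _ ν∈
  ... | v , ν′ , v∈ , ν′∈ , refl =
    let l , u = ∈-range⁻ (lo 0) (μ 0 ∸ lo 0) v∈
        b     = boxes-sound k (λ i<k → lo≤μ (s≤s i<k)) ν′∈
    in inBox
      (λ { {zero} _ → l ; {suc i} (s≤s p) → lower b p })
      (λ { {zero} _ → subst (v ≤_) (m+[n∸m]≡n (lo≤μ z<s)) u ; {suc i} (s≤s p) → upper b p })
      (λ { (suc i) (s≤s p) → empty b i p })

  boxes-complete : ∀ k {lo μ ν} → InBox k lo μ ν → ∃ λ ν′ → ν′ ∈ boxes k lo μ × ν′ ≗ ν
  boxes-complete zero    b = (λ _ → 0) , here refl , λ i → sym (empty b i z≤n)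
  boxes-complete (suc k) {lo} {μ} {ν} b =
    let ν′ , ν′∈ , eq = boxes-complete k {lo ∘ suc} {μ ∘ suc} {ν ∘ suc}
          (inBox (λ p → lower b (s≤s p)) (λ p → upper b (s≤s p)) (λ i p → empty b (suc i) (s≤s p)))
    in cons (ν 0) ν′ ,
       ∈-cartesianProductWith⁺ cons
         (∈-range⁺ (lo 0) _ (lower b z<s)
           (subst (ν 0 ≤_) (sym (m+[n∸m]≡n (≤-trans (lower b z<s) (upper b z<s)))) (upper b z<s)))
         ν′∈ ,
       λ { zero → refl ; (suc i) → eq i }

  boxes-unique : ∀ k lo μ → Uniq.Unique (ℕ →-setoid ℕ) (boxes k lo μ)
  boxes-unique zero    lo μ = [] ∷ []
  boxes-unique (suc k) lo μ =
    Uniqₚ.cartesianProductWith⁺ (setoid ℕ) (ℕ →-setoid ℕ) (ℕ →-setoid ℕ) cons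
      (λ eq → eq 0 , λ i → eq (suc i))
      (range-unique (lo 0) (μ 0 ∸ lo 0)) (boxes-unique k (lo ∘ suc) (μ ∘ suc))

  -- A `Fill` has values outside the diagram as well; they carry no meaning, so only the boxes of
  -- `μ` count.
  fillSetoid : Shape → Setoid 0ℓ 0ℓ
  fillSetoid μ = record
    { Carrier       = Fill
    ; _≈_           = λ U U′ → ∀ i j → j < μ i → U i j ≡ U′ i j
    ; isEquivalence = record
      { refl  = λ _ _ _ → refl
      ; sym   = λ e i j p → sym (e i j p)
      ; trans = λ e e′ i j p → trans (e i j p) (e′ i j p)
      }
    }

  infix 4 _≐[_]_
  _≐[_]_ : Fill → Shape → Fill → Set
  U ≐[ μ ] U′ = Setoid._≈_ (fillSetoid μ) U U′

  -- Adding and removing the largest letter.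

  ext : Shape → ℕ → Fill → Fill
  ext ν t U i j with j <? ν i
  ... | yes _ = U i j
  ... | no  _ = t

  module _ {ν : Shape} {t : ℕ} {U : Fill} {i j : ℕ} where

    ext-old : j < ν i → ext ν t U i j ≡ U i j
    ext-old p with j <? ν i
    ... | yes _ = refl
    ... | no  q = contradiction p q

    ext-new : ν i ≤ j → ext ν t U i j ≡ t
    ext-new p with j <? ν i
    ... | yes q = contradiction q (≤⇒≯ p)
    ... | no  _ = refl

  layers : List Shape → ℕ → (Shape → List Fill) → List Fill
  layers N t R = concatMap (λ ν → map (ext ν t) (R ν)) N

  -- If row `i` of `ν′` were the longer one, its box in column `ν i` would hold `t` in the first
  -- filling and another letter in the second.
  ext-≤ : ∀ {μ ν ν′ t U U′} → (∀ i → ν i ≤ μ i) → (∀ i → ν′ i ≤ μ i) →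
          (∀ i j → j < ν′ i → U′ i j ≢ t) →
          ext ν t U ≐[ μ ] ext ν′ t U′ → ∀ i → ν′ i ≤ ν i
  ext-≤ {ν = ν} {ν′} {t} {U} {U′} ν≤μ ν′≤μ U′≢t eq i with ν′ i ≤? ν i
  ... | yes p = p
  ... | no  p = contradiction
    (trans (sym (ext-old {ν′} {t} {U′} q)) (trans (sym (eq i (ν i) (<-≤-trans q (ν′≤μ i)))) (ext-new {ν} {t} {U} ≤-refl)))
    (U′≢t i (ν i) q)
    where q = ≰⇒> p

  ext-injective : ∀ {μ ν t U U′} → (∀ i → ν i ≤ μ i) →
                  ext ν t U ≐[ μ ] ext ν t U′ → U ≐[ ν ] U′
  ext-injective {μ} {ν} {t} {U} {U′} ν≤μ eq i j p =
    trans (sym (ext-old {ν} {t} {U} p)) (trans (eq i j (<-≤-trans p (ν≤μ i))) (ext-old {ν} {t} {U′} p))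

  -- The inner shape can be recovered from a filling as the set of boxes with an entry other than
  -- `t`. Hence fillings from different layers differ, and inside one layer `ext` is injective.
  layers-unique : ∀ {μ t R} N →
    (∀ {ν} → ν ∈ N → ∀ i → ν i ≤ μ i) →
    (∀ {ν U} → ν ∈ N → U ∈ R ν → ∀ i j → j < ν i → U i j ≢ t) →
    (∀ {ν} → ν ∈ N → Uniq.Unique (fillSetoid ν) (R ν)) →
    Uniq.Unique (ℕ →-setoid ℕ) N → Uniq.Unique (fillSetoid μ) (layers N t R)
  layers-unique         []      N≤μ R≢t R! N!         = []
  layers-unique {μ} {t} {R} (ν ∷ N) N≤μ R≢t R! (ν∉N ∷ N!) = Uniqₚ.++⁺ (fillSetoid μ)
    (Uniqₚ.map⁺ (fillSetoid ν) (fillSetoid μ) (ext-injective (N≤μ (here refl))) (R! (here refl)))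
    (layers-unique N (N≤μ ∘ there) (R≢t ∘ there) (R! ∘ there) N!)
    λ { (U∈ , U∈′) →
      let V , V∈ , V≈     = find (Anyₚ.map⁻ U∈)
          ν′ , ν′∈ , q    = find (Anyₚ.concatMap⁻ (λ ν → map (ext ν t) (R ν)) U∈′)
          V′ , V′∈ , V′≈  = find (Anyₚ.map⁻ q)
          eq : ext ν t V ≐[ μ ] ext ν′ t V′
          eq i j p = trans (sym (V≈ i j p)) (V′≈ i j p)
          ν≤  = N≤μ (here refl)
          ν′≤ = N≤μ (there ν′∈)
      in All.lookup ν∉N ν′∈ λ i → ≤-antisym
           (ext-≤ ν′≤ ν≤ (R≢t (here refl) V∈) (λ i j p → sym (eq i j p)) i)
           (ext-≤ ν≤ ν′≤ (R≢t (there ν′∈) V′∈) eq i) }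

  ∈-layers⁻ : ∀ {t R U} N → U ∈ layers N t R →
              ∃ λ ν → ∃ λ V → ν ∈ N × V ∈ R ν × U ≡ ext ν t V
  ∈-layers⁻ {t} {R} N U∈ =
    let ν , ν∈ , q = find (∈-concatMap⁻ (λ ν → map (ext ν t) (R ν)) U∈)
        V , V∈ , e = ∈-map⁻ (ext ν t) q
    in ν , V , ν∈ , V∈ , e

  ∈-layers⁺ : ∀ {t R ν V N} → ν ∈ N → V ∈ R ν → ext ν t V ∈ layers N t R
  ∈-layers⁺ {t} {R} {ν} ν∈ V∈ =
    ∈-concatMap⁺ (λ ν → map (ext ν t) (R ν)) (lose ν∈ (∈-map⁺ (ext ν t) V∈))

  -- For a weakly increasing row f of length m, the number of entries below t.
  below : (ℕ → ℕ) → ℕ → ℕ → ℕ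
  below f t zero    = 0
  below f t (suc m) with f m <? t
  ... | yes _ = suc m
  ... | no  _ = below f t m

  below-≤ : ∀ f t m → below f t m ≤ m
  below-≤ f t zero    = z≤n
  below-≤ f t (suc m) with f m <? t
  ... | yes _ = ≤-refl
  ... | no  _ = m≤n⇒m≤1+n (below-≤ f t m)

  below-new : ∀ f t m {j} → below f t m ≤ j → j < m → t ≤ f j
  below-new f t (suc m) p q with f m <? t
  ... | yes _ = contradiction q (≤⇒≯ p)
  ... | no ¬r with m≤n⇒m<n∨m≡n (s≤s⁻¹ q)
  ...   | inj₁ j<m  = below-new f t m p j<m
  ...   | inj₂ refl = ≮⇒≥ ¬r

  below-old : ∀ f t m {j} → (∀ {j j′} → j ≤ j′ → j′ < m → f j ≤ f j′) → j < below f t m → f j < t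
  below-old f t (suc m) mono p with f m <? t
  ... | yes r = ≤-<-trans (mono (s≤s⁻¹ p) ≤-refl) r
  ... | no  _ = below-old f t m (λ u v → mono u (m<n⇒m<1+n v)) p

  -- The bounds are the interlacing condition that makes `μ / ν` a horizontal strip. They also force
  -- `ν` to be a partition.
  strips : ℕ → Shape → List Shape
  strips k μ = boxes k (μ ∘ suc) μ

  strip-≤ : ∀ {k μ ν} → InBox k (μ ∘ suc) μ ν → ∀ i → ν i ≤ μ i
  strip-≤ {k} {μ} b i with i <? k
  ... | yes p = upper b p
  ... | no  p = subst (_≤ μ i) (sym (empty b i (≮⇒≥ p))) z≤n

  strip-anti : ∀ {k μ ν} → InBox k (μ ∘ suc) μ ν → Anti ν
  strip-anti {k} {μ} {ν} b i with i <? k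
  ... | yes p = ≤-trans (strip-≤ b (suc i)) (lower b p)
  ... | no  p = subst (_≤ ν i) (sym (empty b (suc i) (m≤n⇒m≤1+n (≮⇒≥ p)))) z≤n

  module _ (k : ℕ) {μ : Shape} (anti : Anti μ) where

    ∈-strips⁻ : ∀ {ν} → ν ∈ strips k μ → InBox k (μ ∘ suc) μ ν
    ∈-strips⁻ = boxes-sound k (λ {i} _ → anti i)

  Descending : ℕ → Shape → Set
  Descending k ν = ∀ {i} → i < k → ν (suc i) ≤ ν i

  descending? : ∀ k → Decidable (Descending k)
  descending? k ν = allUpTo? (λ i → ν (suc i) ≤? ν i) k

  -- Removing at most one box from each row can leave a row shorter than the one below it, so here
  -- the partition condition has to be imposed by a filter.
  verticalStrips : ℕ → Shape → List Shape
  verticalStrips k μ = filter (descending? k) (boxes k (pred ∘ μ) μ)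

  module _ {k : ℕ} {μ ν : Shape} (b : InBox k (pred ∘ μ) μ ν) where

    vertical-≤ : ∀ i → ν i ≤ μ i
    vertical-≤ i with i <? k
    ... | yes p = upper b p
    ... | no  p = subst (_≤ μ i) (sym (empty b i (≮⇒≥ p))) z≤n

    vertical-anti : Descending k ν → Anti ν
    vertical-anti d i with i <? k
    ... | yes p = d p
    ... | no  p = subst (_≤ ν i) (sym (empty b (suc i) (m≤n⇒m≤1+n (≮⇒≥ p)))) z≤n

  ∈-vertical⁻ : ∀ k {μ ν} → ν ∈ verticalStrips k μ → InBox k (pred ∘ μ) μ ν × Anti ν
  ∈-vertical⁻ k {μ} ν∈ =
    let ν∈′ , d = ∈-filter⁻ (descending? k) {xs = boxes k (pred ∘ μ) μ} ν∈
        b       = boxes-sound k (λ _ → pred[n]≤n) ν∈′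
    in b , vertical-anti b d

  -- Recursion in steps of two, in agreement with `⌈_/2⌉` and with `interleave`.
  double : ℕ → ℕ
  double zero    = zero
  double (suc n) = suc (suc (double n))

  ⌈double/2⌉ : ∀ k → ⌈ double k /2⌉ ≡ k
  ⌈double/2⌉ zero    = refl
  ⌈double/2⌉ (suc k) = cong suc (⌈double/2⌉ k)

  ⌈1+double/2⌉ : ∀ k → ⌈ suc (double k) /2⌉ ≡ suc k
  ⌈1+double/2⌉ zero    = refl
  ⌈1+double/2⌉ (suc k) = cong suc (⌈1+double/2⌉ k)

  -- Entries are represented by their ranks; the letters of rank below t form
  -- tableaux with at most rows t rows.
  module Tableaux (rows : ℕ → ℕ) (rows-0 : rows 0 ≡ 0)
                  (rows-mono : ∀ t → rows t ≤ rows (suc t))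
                  (rows-step : ∀ t → rows (suc t) ≤ suc (rows t)) where

    rows-≤ : ∀ {s t} → s ≤ t → rows s ≤ rows t
    rows-≤ {s} s≤t = go (≤⇒≤′ s≤t)
      where
      go : ∀ {t} → s ≤′ t → rows s ≤ rows t
      go ≤′-refl     = ≤-refl
      go (≤′-step p) = ≤-trans (go p) (rows-mono _)

    tableaux : ℕ → Shape → List Fill
    tableaux zero    μ = [ (λ _ _ → 0) ]
    tableaux (suc t) μ = layers (strips (rows t) μ) t (tableaux t)

    -- The field `flag` is condition (T4) in terms of ranks: a letter of rank `r` stays in the rows
    -- available to the letters of rank at most `r`.
    record Tab (t : ℕ) (μ : Shape) (U : Fill) : Set where
      constructor tab
      field
        bound  : ∀ {i j} → j < μ i → U i j < t
        weak   : ∀ {i j j′} → j ≤ j′ → j′ < μ i → U i j ≤ U i j′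
        strict : ∀ {i i′ j} → i < i′ → j < μ i′ → U i j < U i′ j
        flag   : ∀ {i j} → j < μ i → i < rows (suc (U i j))

    open Tab public

    ext-tab : ∀ {t μ ν U} → Anti μ → Rows (rows (suc t)) μ → InBox (rows t) (μ ∘ suc) μ ν →
              Tab t ν U → Tab (suc t) μ (ext ν t U)
    ext-tab {t} {μ} {ν} {U} anti rowsμ b T = tab bnd wk st fl
      where
      bnd : ∀ {i j} → j < μ i → ext ν t U i j < suc t
      bnd {i} {j} _ with j <? ν i
      ... | yes q = m<n⇒m<1+n (bound T q)
      ... | no  _ = n<1+n t
      wk : ∀ {i j j′} → j ≤ j′ → j′ < μ i → ext ν t U i j ≤ ext ν t U i j′
      wk {i} {j} {j′} p q with j <? ν i | j′ <? ν i
      ... | yes r | yes r′ = weak T p r′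
      ... | yes r | no  _  = <⇒≤ (bound T r)
      ... | no  r | yes r′ = contradiction (≤-<-trans p r′) r
      ... | no  _ | no  _  = ≤-refl
      st : ∀ {i i′ j} → i < i′ → j < μ i′ → ext ν t U i j < ext ν t U i′ j
      st {i} {i′} {j} p q with j <? ν i | j <? ν i′
      ... | yes r | yes r′ = strict T p r′
      ... | yes r | no  _  = bound T r
      -- Interlacing excludes this case: `i < i′ < rows (suc t)` gives `i < rows t`, and then
      -- `j < μ i′ ≤ μ (suc i) ≤ ν i`.
      ... | no  r | _      = contradiction
        (<-≤-trans q (≤-trans (anti-≤ anti p)
          (lower b (<-≤-trans p (s≤s⁻¹ (≤-trans (rows-< rowsμ q) (rows-step t)))))))
        r
      fl : ∀ {i j} → j < μ i → i < rows (suc (ext ν t U i j))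
      fl {i} {j} p with j <? ν i
      ... | yes r = flag T r
      ... | no  _ = rows-< rowsμ p

    tableaux-sound : ∀ t {μ U} → Anti μ → Rows (rows t) μ → U ∈ tableaux t μ → Tab t μ U
    tableaux-sound zero    anti rowsμ (here refl) =
      tab (λ p → contradiction (rows-< rowsμ p) (no-rows ∘ subst (_ <_) rows-0)) (λ _ _ → z≤n)
          (λ _ p → contradiction (rows-< rowsμ p) (no-rows ∘ subst (_ <_) rows-0))
          (λ p → contradiction (rows-< rowsμ p) (no-rows ∘ subst (_ <_) rows-0))
      where
      no-rows : ∀ {i} → ¬ i < 0
      no-rows ()
    tableaux-sound (suc t) {μ} anti rowsμ U∈ with ∈-layers⁻ (strips (rows t) μ) U∈
    ... | ν , V , ν∈ , V∈ , refl =
      let b = ∈-strips⁻ (rows t) anti ν∈ in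
      ext-tab anti rowsμ b (tableaux-sound t (strip-anti b) (empty b) V∈)

    tableaux-unique : ∀ t {μ} → Anti μ → Rows (rows t) μ → Uniq.Unique (fillSetoid μ) (tableaux t μ)
    tableaux-unique zero    anti rowsμ = [] ∷ []
    tableaux-unique (suc t) {μ} anti rowsμ = layers-unique (strips (rows t) μ)
      (λ ν∈ → strip-≤ (∈-strips⁻ (rows t) anti ν∈))
      (λ ν∈ V∈ i j p → let b = ∈-strips⁻ (rows t) anti ν∈ in
        <⇒≢ (bound (tableaux-sound t (strip-anti b) (empty b) V∈) p))
      (λ ν∈ → let b = ∈-strips⁻ (rows t) anti ν∈ in tableaux-unique t (strip-anti b) (empty b))
      (boxes-unique (rows t) (μ ∘ suc) μ)

    tab-resp : ∀ {t μ ν U} → μ ≗ ν → Tab t μ U → Tab t ν U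
    tab-resp eq T = tab (λ p → bound T (subst (_ <_) (sym (eq _)) p))
      (λ p q → weak T p (subst (_ <_) (sym (eq _)) q))
      (λ p q → strict T p (subst (_ <_) (sym (eq _)) q))
      (λ p → flag T (subst (_ <_) (sym (eq _)) p))

    -- The inner shape consists of the boxes with an entry below `t`. As no column holds `t` twice,
    -- it interlaces with `μ`; `flag` bounds its number of rows. It is in the list only up to
    -- pointwise equality, hence the passage from `ν` to `ν′`.
    tableaux-complete : ∀ t {μ U} → Anti μ → Tab t μ U →
                        ∃ λ V → V ∈ tableaux t μ × U ≐[ μ ] V
    tableaux-complete zero anti T =
      _ , here refl , λ i j p → contradiction (bound T p) λ ()
    tableaux-complete (suc t) {μ} {U} anti T =
      let ν′ , ν′∈ , eq = boxes-complete (rows t) inB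
          V , V∈ , U≈V  = tableaux-complete t (strip-anti (∈-strips⁻ (rows t) anti ν′∈))
                            (tab-resp (λ i → sym (eq i)) below-tab)
      in ext ν′ t V , ∈-layers⁺ ν′∈ V∈ , λ i j p → agree ν′ V eq U≈V i j p
      where
      ν : Shape
      ν i = below (U i) t (μ i)
      ν≤μ : ∀ i → ν i ≤ μ i
      ν≤μ i = below-≤ (U i) t (μ i)
      old : ∀ {i j} → j < ν i → U i j < t
      old {i} p = below-old (U i) t (μ i) (weak T) p
      inB : InBox (rows t) (μ ∘ suc) μ ν
      inB = inBox
        (λ {i} _ → ≮⇒≥ λ p → <⇒≱ (<-≤-trans (strict T (n<1+n i) p) (s≤s⁻¹ (bound T p)))
                                (below-new (U i) t (μ i) ≤-refl (<-≤-trans p (anti i))))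
        (λ {i} _ → ν≤μ i)
        (λ i k≤i → n≮0⇒n≡0 λ p →
          <⇒≱ (<-≤-trans (flag T (<-≤-trans p (ν≤μ i))) (rows-≤ (old p))) k≤i)
        where
        n≮0⇒n≡0 : ∀ {n} → ¬ 0 < n → n ≡ 0
        n≮0⇒n≡0 {zero}  _ = refl
        n≮0⇒n≡0 {suc _} p = contradiction z<s p
      below-tab : Tab t ν U
      below-tab = tab old (λ p q → weak T p (<-≤-trans q (ν≤μ _)))
        (λ p q → strict T p (<-≤-trans q (ν≤μ _))) (λ p → flag T (<-≤-trans p (ν≤μ _)))
      agree : ∀ ν′ V → ν′ ≗ ν → U ≐[ ν′ ] V → U ≐[ μ ] ext ν′ t V
      agree ν′ V eq U≈V i j p with j <? ν′ i
      ... | yes q = U≈V i j q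
      ... | no  q = ≤-antisym (s≤s⁻¹ (bound T p))
        (below-new (U i) t (μ i) (subst (_≤ j) (eq i) (≮⇒≥ q)) p)

    -- Tableaux with the additional letter 0, whose rank is `t`.

    soTableaux : ℕ → Shape → List Fill
    soTableaux t μ = layers (verticalStrips (rows t) μ) t (tableaux t)

    record SoTab (t : ℕ) (μ : Shape) (U : Fill) : Set where
      constructor soTab
      field
        bound  : ∀ {i j} → j < μ i → U i j ≤ t
        weak   : ∀ {i j j′} → j ≤ j′ → j′ < μ i → U i j ≤ U i j′
        strict : ∀ {i i′ j} → i < i′ → j < μ i′ → U i j < U i′ j ⊎ (U i j ≡ t × U i′ j ≡ t)
        single : ∀ {i j j′} → j < μ i → j′ < μ i → U i j ≡ t → U i j′ ≡ t → j ≡ j′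
        flag   : ∀ {i j} → j < μ i → U i j < t → i < rows (suc (U i j))

    module So = SoTab

    ext-soTab : ∀ {t μ ν U} → Rows (rows t) μ → InBox (rows t) (pred ∘ μ) μ ν → Anti ν →
                Tab t ν U → SoTab t μ (ext ν t U)
    ext-soTab {t} {μ} {ν} {U} rowsμ b anti T = soTab bnd wk st sg fl
      where
      bnd : ∀ {i j} → j < μ i → ext ν t U i j ≤ t
      bnd {i} {j} _ with j <? ν i
      ... | yes q = <⇒≤ (bound T q)
      ... | no  _ = ≤-refl
      wk : ∀ {i j j′} → j ≤ j′ → j′ < μ i → ext ν t U i j ≤ ext ν t U i j′
      wk {i} {j} {j′} p q with j <? ν i | j′ <? ν i
      ... | yes r | yes r′ = weak T p r′
      ... | yes r | no  _  = <⇒≤ (bound T r)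
      ... | no  r | yes r′ = contradiction (≤-<-trans p r′) r
      ... | no  _ | no  _  = ≤-refl
      st : ∀ {i i′ j} → i < i′ → j < μ i′ →
           ext ν t U i j < ext ν t U i′ j ⊎ (ext ν t U i j ≡ t × ext ν t U i′ j ≡ t)
      st {i} {i′} {j} p q with j <? ν i | j <? ν i′
      ... | yes r | yes r′ = inj₁ (strict T p r′)
      ... | yes r | no  _  = inj₁ (bound T r)
      ... | no  r | yes r′ = contradiction (<-≤-trans r′ (anti-≤ anti (<⇒≤ p))) r
      ... | no  _ | no  _  = inj₂ (refl , refl)
      -- The bound `pred (μ i) ≤ ν i` leaves only the last box of a row to the letter 0.
      last-box : ∀ {i j} → j < μ i → ν i ≤ j → suc j ≡ μ i
      last-box {i} {j} p q with m≤n⇒m<n∨m≡n p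
      ... | inj₂ e = e
      ... | inj₁ r = contradiction (<-≤-trans r (pred≤⇒≤suc (≤-trans (lower b (rows-< rowsμ p)) q))) (<-irrefl refl)
      sg : ∀ {i j j′} → j < μ i → j′ < μ i → ext ν t U i j ≡ t → ext ν t U i j′ ≡ t → j ≡ j′
      sg {i} {j} {j′} p p′ e e′ with j <? ν i | j′ <? ν i
      ... | yes r | _      = contradiction e (<⇒≢ (bound T r))
      ... | no  _ | yes r′ = contradiction e′ (<⇒≢ (bound T r′))
      ... | no  r | no  r′ = suc-injective (trans (last-box p (≮⇒≥ r)) (sym (last-box p′ (≮⇒≥ r′))))
      fl : ∀ {i j} → j < μ i → ext ν t U i j < t → i < rows (suc (ext ν t U i j))
      fl {i} {j} p q with j <? ν i
      ... | yes r = flag T r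
      ... | no  _ = contradiction q (<-irrefl refl)

    soTableaux-sound : ∀ t {μ U} → Rows (rows t) μ → U ∈ soTableaux t μ → SoTab t μ U
    soTableaux-sound t {μ} rowsμ U∈ with ∈-layers⁻ (verticalStrips (rows t) μ) U∈
    ... | ν , V , ν∈ , V∈ , refl =
      let b , anti = ∈-vertical⁻ (rows t) ν∈ in
      ext-soTab rowsμ b anti (tableaux-sound t anti (empty b) V∈)

    soTableaux-unique : ∀ t μ → Uniq.Unique (fillSetoid μ) (soTableaux t μ)
    soTableaux-unique t μ = layers-unique (verticalStrips (rows t) μ)
      (λ ν∈ → vertical-≤ (proj₁ (∈-vertical⁻ (rows t) ν∈)))
      (λ ν∈ V∈ i j p → let b , anti = ∈-vertical⁻ (rows t) ν∈ in
        <⇒≢ (bound (tableaux-sound t anti (empty b) V∈) p))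
      (λ ν∈ → let b , anti = ∈-vertical⁻ (rows t) ν∈ in tableaux-unique t anti (empty b))
      (Uniqₚ.filter⁺ (ℕ →-setoid ℕ) (descending? (rows t)) (boxes-unique (rows t) (pred ∘ μ) μ))

    soTableaux-complete : ∀ t {μ U} → Anti μ → Rows (rows t) μ → SoTab t μ U →
                          ∃ λ V → V ∈ soTableaux t μ × U ≐[ μ ] V
    soTableaux-complete t {μ} {U} anti rowsμ T =
      let ν′ , ν′∈ , eq = boxes-complete (rows t) inB
          antiν′ = λ i → subst (_≤ ν′ i) (sym (eq (suc i))) (subst (_ ≤_) (sym (eq i)) (antiν i))
          V , V∈ , U≈V  = tableaux-complete t antiν′ (tab-resp (λ i → sym (eq i)) below-tab)
      in ext ν′ t V ,
         ∈-layers⁺ (∈-filter⁺ (descending? (rows t)) ν′∈ (λ {i} _ → antiν′ i)) V∈ ,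
         λ i j p → agree ν′ V eq U≈V i j p
      where
      ν : Shape
      ν i = below (U i) t (μ i)
      ν≤μ : ∀ i → ν i ≤ μ i
      ν≤μ i = below-≤ (U i) t (μ i)
      old : ∀ {i j} → j < ν i → U i j < t
      old {i} p = below-old (U i) t (μ i) (So.weak T) p
      new : ∀ {i j} → ν i ≤ j → j < μ i → U i j ≡ t
      new {i} p q = ≤-antisym (So.bound T q) (below-new (U i) t (μ i) p q)
      inB : InBox (rows t) (pred ∘ μ) μ ν
      inB = inBox
        -- If two boxes of row `i` were missing from `ν`, those in columns `ν i` and `suc (ν i)`
        -- would both hold `t`.
        (λ {i} _ → pred-≤ λ p → <-irrefl (So.single T (<-trans (n<1+n _) p) p
          (new {i} ≤-refl (<-trans (n<1+n _) p)) (new {i} (n≤1+n _) p)) (n<1+n (ν i)))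
        (λ {i} _ → ν≤μ i)
        (λ i k≤i → n≤0⇒n≡0 (subst (ν i ≤_) (rowsμ i k≤i) (ν≤μ i)))
        where
        pred-≤ : ∀ {m n} → ¬ suc m < n → pred n ≤ m
        pred-≤ {n = zero}  _ = z≤n
        pred-≤ {n = suc n} p = s≤s⁻¹ (≮⇒≥ p)
      antiν : Anti ν
      -- Otherwise the box in row `i` and column `ν i` would hold `t` above a smaller entry.
      antiν i = ≮⇒≥ λ p →
        let q = <-≤-trans p (≤-trans (ν≤μ (suc i)) (anti i)) in
        case So.strict T (n<1+n i) (<-≤-trans p (ν≤μ (suc i))) of λ
          { (inj₁ r)       → <-asym (subst (_< U (suc i) (ν i)) (new ≤-refl q) r) (old p)
          ; (inj₂ (_ , e)) → <⇒≢ (old p) e }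
      below-tab : Tab t ν U
      below-tab = tab old (λ p q → So.weak T p (<-≤-trans q (ν≤μ _)))
        (λ p q → case So.strict T p (<-≤-trans q (ν≤μ _)) of λ
          { (inj₁ r) → r ; (inj₂ (_ , e)) → contradiction e (<⇒≢ (old q)) })
        (λ p → So.flag T (<-≤-trans p (ν≤μ _)) (old p))
      agree : ∀ ν′ V → ν′ ≗ ν → U ≐[ ν′ ] V → U ≐[ μ ] ext ν′ t V
      agree ν′ V eq U≈V i j p with j <? ν′ i
      ... | yes q = U≈V i j q
      ... | no  q = new (subst (_≤ j) (eq i) (≮⇒≥ q)) p

-- Branching rules by column operations, over a commutative ring.

module Branching {c ℓ} (R : CommutativeRing c ℓ) where

  open import Algebra.Properties.CommutativeSemigroup using (interchange)
  open import Data.List.Base using (List; []; _∷_; [_]; _++_; map; concatMap; cartesianProductWith; foldr; filter)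
  open import Data.List.Membership.Propositional using (_∈_)
  open import Data.List.Relation.Unary.Any using (here; there)
  open import Data.Nat.Base as ℕ using (ℕ; zero; suc; z≤n; s≤s; _∸_; pred)
  import Data.Nat.Properties as ℕₚ
  open import Data.Product.Base using (∃; _×_; _,_; proj₁)
  open import Data.Sum.Base using ([_,_]′)
  open import Data.Unit.Polymorphic.Base using (⊤; tt)
  open import Data.Vec.Base as Vec using (Vec; []; _∷_; _∷ʳ_)
  open import Data.Vec.Relation.Unary.All as All using (All; []; _∷_)
  open import Function.Base using (_∘_)
  open import Level using (_⊔_)
  open import Relation.Binary.PropositionalEquality as ≡ using (_≡_)
  open import Relation.Nullary using (Dec; ¬_; yes; no; contradiction)
  open RankTableaux

  open CommutativeRing R renaming (Carrier to C) hiding (zero)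
  open import Algebra.Properties.Ring ring
    using (-0#≈0#; -‿distribˡ-*; -‿distribʳ-*; -‿+-comm)
  open import Relation.Binary.Reasoning.Setoid setoid
  open import Algebra.Solver.Ring.NaturalCoefficients.Default commutativeSemiring
    using (solve; _:+_; _:*_; _:=_; con)

  +-swap : ∀ a b c d → (a + b) + (c + d) ≈ (a + c) + (b + d)
  +-swap = interchange +-commutativeSemigroup

  x-0≈x : ∀ x → x - 0# ≈ x
  x-0≈x x = trans (+-congˡ -0#≈0#) (+-identityʳ x)

  -- Sums over lists

  module _ {A : Set} where

    ∑ˡ : (A → C) → List A → C
    ∑ˡ F xs = foldr _+_ 0# (map F xs)

    ∑ˡ-cong : ∀ {F G} xs → (∀ {x} → x ∈ xs → F x ≈ G x) → ∑ˡ F xs ≈ ∑ˡ G xs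
    ∑ˡ-cong []       eq = refl
    ∑ˡ-cong (x ∷ xs) eq = +-cong (eq (here ≡.refl)) (∑ˡ-cong xs (eq ∘ there))

    ∑ˡ-++ : ∀ F xs ys → ∑ˡ F (xs ++ ys) ≈ ∑ˡ F xs + ∑ˡ F ys
    ∑ˡ-++ F []       ys = sym (+-identityˡ _)
    ∑ˡ-++ F (x ∷ xs) ys = trans (+-congˡ (∑ˡ-++ F xs ys)) (sym (+-assoc _ _ _))

    ∑ˡ-*ˡ : ∀ r F xs → ∑ˡ (λ x → r * F x) xs ≈ r * ∑ˡ F xs
    ∑ˡ-*ˡ r F []       = sym (zeroʳ r)
    ∑ˡ-*ˡ r F (x ∷ xs) = trans (+-congˡ (∑ˡ-*ˡ r F xs)) (sym (distribˡ r _ _))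

    ∑ˡ-filter : ∀ {p} {P : A → Set p} (P? : ∀ x → Dec (P x)) F xs →
                (∀ {x} → x ∈ xs → ¬ P x → F x ≈ 0#) → ∑ˡ F (filter P? xs) ≈ ∑ˡ F xs
    ∑ˡ-filter P? F []       z = refl
    ∑ˡ-filter P? F (x ∷ xs) z with P? x
    ... | yes _  = +-congˡ (∑ˡ-filter P? F xs (z ∘ there))
    ... | no ¬px = trans (∑ˡ-filter P? F xs (z ∘ there))
                     (trans (sym (+-identityˡ _)) (+-congʳ (sym (z (here ≡.refl) ¬px))))

  ∑ˡ-map : ∀ {A B : Set} (F : B → C) (f : A → B) xs → ∑ˡ F (map f xs) ≡ ∑ˡ (F ∘ f) xs
  ∑ˡ-map F f []       = ≡.refl
  ∑ˡ-map F f (x ∷ xs) = ≡.cong (F (f x) +_) (∑ˡ-map F f xs)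

  ∑ˡ-concatMap : ∀ {A B : Set} (F : B → C) (f : A → List B) xs →
                 ∑ˡ F (concatMap f xs) ≈ ∑ˡ (λ x → ∑ˡ F (f x)) xs
  ∑ˡ-concatMap F f []       = refl
  ∑ˡ-concatMap F f (x ∷ xs) = trans (∑ˡ-++ F (f x) _) (+-congˡ (∑ˡ-concatMap F f xs))

  ∑ˡ-product : ∀ {A B D : Set} (F : D → C) (f : A → B → D) xs ys →
               ∑ˡ F (cartesianProductWith f xs ys) ≈ ∑ˡ (λ x → ∑ˡ (λ y → F (f x y)) ys) xs
  ∑ˡ-product F f []       ys = refl
  ∑ˡ-product F f (x ∷ xs) ys =
    trans (∑ˡ-++ F (map (f x) ys) _) (+-cong (reflexive (∑ˡ-map F (f x) ys)) (∑ˡ-product F f xs ys))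

  -- Determinants as functions of the columns, rows being indexed by ℕ

  Col : Set c
  Col = ℕ → C

  infix 4 _≋_
  _≋_ : Col → Col → Set ℓ
  u ≋ v = ∀ i → u i ≈ v i

  -- Multilinear and alternating; equal adjacent columns are the only case needed.
  MA : ∀ k → (Vec Col k → C) → Set (c ⊔ ℓ)
  Adjacent : ∀ k → (Vec Col (suc k) → C) → Set (c ⊔ ℓ)

  MA zero    Ψ = ⊤
  MA (suc k) Ψ =
    (∀ {u v w r} D → (∀ i → w i ≈ u i + r * v i) → Ψ (w ∷ D) ≈ Ψ (u ∷ D) + r * Ψ (v ∷ D)) ×
    Adjacent k Ψ ×
    (∀ v → MA k (λ D → Ψ (v ∷ D)))

  Adjacent zero    Ψ = ⊤
  Adjacent (suc k) Ψ = ∀ v D → Ψ (v ∷ v ∷ D) ≈ 0#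

  -- The linearity clause takes the combined column up to pointwise `≈`, so its instance `r = 0#`
  -- already contains congruence.
  MA-cong₁ : ∀ {k} Ψ → MA (suc k) Ψ → ∀ {u v} D → u ≋ v → Ψ (u ∷ D) ≈ Ψ (v ∷ D)
  MA-cong₁ Ψ (lin , _) {u} {v} D u≋v =
    trans (lin {u = v} {v = v} {r = 0#} D (λ i → trans (u≋v i) (sym (trans (+-congˡ (zeroˡ _)) (+-identityʳ _)))))
      (trans (+-congˡ (zeroˡ _)) (+-identityʳ _))

  MA-adjacent : ∀ {k} Ψ → MA (suc (suc k)) Ψ → ∀ {u v} D → u ≋ v → Ψ (u ∷ v ∷ D) ≈ 0#
  MA-adjacent Ψ ma@(_ , adj , _) {v = v} D u≋v = trans (MA-cong₁ Ψ ma (v ∷ D) u≋v) (adj v D)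

  -‿linear : ∀ p q r p′ q′ → (p + r * q) - (p′ + r * q′) ≈ (p - p′) + r * (q - q′)
  -‿linear p q r p′ q′ = begin
    (p + r * q) - (p′ + r * q′)          ≈⟨ +-congˡ (sym (-‿+-comm p′ (r * q′))) ⟩
    (p + r * q) + (- p′ + - (r * q′))    ≈⟨ +-swap _ _ _ _ ⟩
    (p - p′) + (r * q - r * q′)          ≈⟨ +-congˡ (+-congˡ (-‿distribʳ-* r q′)) ⟩
    (p - p′) + (r * q + r * - q′)        ≈⟨ +-congˡ (sym (distribˡ r q (- q′))) ⟩
    (p - p′) + r * (q - q′)              ∎

  *-linear : ∀ a p q r → a * (p + r * q) ≈ a * p + r * (a * q)
  *-linear = solve 4 (λ a p q r → a :* (p :+ r :* q) := a :* p :+ r :* (a :* q)) refl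

  -- For a fixed first column, `laplace` is a function of the remaining columns of exactly this
  -- form.
  MA-combine : ∀ {k} Ψ Φ a → MA k Ψ → MA k Φ → MA k (λ D → a * Ψ D - Φ D)
  MA-combine {zero}  Ψ Φ a _ _ = tt
  MA-combine {suc k} Ψ Φ a (lin , adj , ma) (lin′ , adj′ , ma′) =
    (λ {u} {v} {w} {r} D eq → begin
      a * Ψ (w ∷ D) - Φ (w ∷ D)
        ≈⟨ +-cong (*-congˡ (lin D eq)) (-‿cong (lin′ D eq)) ⟩
      a * (Ψ (u ∷ D) + r * Ψ (v ∷ D)) - (Φ (u ∷ D) + r * Φ (v ∷ D))
        ≈⟨ +-congʳ (*-linear a _ _ r) ⟩
      (a * Ψ (u ∷ D) + r * (a * Ψ (v ∷ D))) - (Φ (u ∷ D) + r * Φ (v ∷ D))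
        ≈⟨ -‿linear _ _ r _ _ ⟩
      _ ∎) ,
    adjacent k Ψ Φ adj adj′ ,
    (λ v → MA-combine (λ D → Ψ (v ∷ D)) (λ D → Φ (v ∷ D)) a (ma v) (ma′ v))
    where
    adjacent : ∀ k (Ψ Φ : Vec Col (suc k) → C) → Adjacent k Ψ → Adjacent k Φ →
               Adjacent k (λ D → a * Ψ D - Φ D)
    adjacent zero    Ψ Φ _   _    = tt
    adjacent (suc k) Ψ Φ adj adj′ v D = begin
      _             ≈⟨ +-cong (*-congˡ (adj v D)) (-‿cong (adj′ v D)) ⟩
      a * 0# - 0#   ≈⟨ x-0≈x _ ⟩
      a * 0#        ≈⟨ zeroʳ a ⟩
      0#            ∎

  -- Expansion along row 0 with Ψ in place of the minors: this recursion never
  -- mentions positions, so alternation is inherited from Ψ by induction.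
  laplace : ∀ {k} → (Vec Col k → C) → Vec Col (suc k) → C
  laplace {zero}  Ψ (v ∷ D) = v 0 * Ψ D
  laplace {suc k} Ψ (v ∷ D) = v 0 * Ψ D - laplace (λ E → Ψ (v ∷ E)) D

  -- The minors only involve columns of `D`, so agreement on columns with property `P` suffices.
  -- This carries a vanishing row through the expansion.
  laplace-cong-All : ∀ {p} {P : Col → Set p} {k} {Ψ Φ : Vec Col k → C} →
                     (∀ {D} → All P D → Ψ D ≈ Φ D) →
                     ∀ {D} → All P D → laplace Ψ D ≈ laplace Φ D
  laplace-cong-All {k = zero}  eq (_ ∷ p)  = *-congˡ (eq p)
  laplace-cong-All {k = suc k} eq (pv ∷ p) =
    +-cong (*-congˡ (eq p)) (-‿cong (laplace-cong-All (λ q → eq (pv ∷ q)) p))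

  laplace-cong : ∀ {k} {Ψ Φ : Vec Col k → C} → (∀ D → Ψ D ≈ Φ D) → ∀ D → laplace Ψ D ≈ laplace Φ D
  laplace-cong eq D =
    laplace-cong-All {P = λ _ → ⊤ {ℓ = c}} (λ {D} _ → eq D) (All.universal (λ _ → tt) D)

  laplace-linear : ∀ {k} (Ψ Φ : Vec Col k → C) r D →
                   laplace (λ E → Ψ E + r * Φ E) D ≈ laplace Ψ D + r * laplace Φ D
  laplace-linear {zero}  Ψ Φ r (v ∷ D) = *-linear (v 0) _ _ r
  laplace-linear {suc k} Ψ Φ r (v ∷ D) =
    trans (+-cong (*-linear (v 0) _ _ r) (-‿cong (laplace-linear (λ E → Ψ (v ∷ E)) (λ E → Φ (v ∷ E)) r D)))
          (-‿linear _ _ r _ _)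

  laplace-0 : ∀ {k} D → laplace {k} (λ _ → 0#) D ≈ 0#
  laplace-0 {zero}  (v ∷ D) = zeroʳ _
  laplace-0 {suc k} (v ∷ D) = trans (+-cong (zeroʳ _) (-‿cong (laplace-0 D))) (x-0≈x 0#)

  laplace-*ˡ : ∀ {k} r (Ψ : Vec Col k → C) D → laplace (λ E → r * Ψ E) D ≈ r * laplace Ψ D
  laplace-*ˡ r Ψ D = begin
    laplace (λ E → r * Ψ E) D                     ≈⟨ laplace-cong (λ E → sym (+-identityˡ _)) D ⟩
    laplace (λ E → 0# + r * Ψ E) D                ≈⟨ laplace-linear (λ _ → 0#) Ψ r D ⟩
    laplace (λ _ → 0#) D + r * laplace Ψ D        ≈⟨ +-congʳ (laplace-0 D) ⟩
    0# + r * laplace Ψ D                          ≈⟨ +-identityˡ _ ⟩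
    r * laplace Ψ D                               ∎

  MA-laplace : ∀ {k} (Ψ : Vec Col k → C) → MA k Ψ → MA (suc k) (laplace Ψ)
  MA-laplace {zero}  Ψ _ =
    (λ {u} {v} {w} {r} D eq → begin
      w 0 * Ψ D                       ≈⟨ *-congʳ (eq 0) ⟩
      (u 0 + r * v 0) * Ψ D           ≈⟨ solve 4 (λ a r b p → (a :+ r :* b) :* p := a :* p :+ r :* (b :* p)) refl (u 0) r (v 0) (Ψ D) ⟩
      u 0 * Ψ D + r * (v 0 * Ψ D)     ∎) ,
    tt , (λ _ → tt)
  MA-laplace {suc k} Ψ ma@(lin , adj , ma′) =
    (λ {u} {v} {w} {r} D eq → begin
      w 0 * Ψ D - laplace (λ E → Ψ (w ∷ E)) D
        ≈⟨ +-cong (*-congʳ (eq 0)) (-‿cong (laplace-cong (λ E → lin E eq) D)) ⟩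
      (u 0 + r * v 0) * Ψ D - laplace (λ E → Ψ (u ∷ E) + r * Ψ (v ∷ E)) D
        ≈⟨ +-cong (solve 4 (λ a r b p → (a :+ r :* b) :* p := a :* p :+ r :* (b :* p)) refl (u 0) r (v 0) (Ψ D))
                  (-‿cong (laplace-linear (λ E → Ψ (u ∷ E)) (λ E → Ψ (v ∷ E)) r D)) ⟩
      _ ≈⟨ -‿linear _ _ r _ _ ⟩
      _ ∎) ,
    adjacent k Ψ ma ,
    (λ v → MA-combine Ψ (laplace (λ E → Ψ (v ∷ E))) (v 0) ma (MA-laplace (λ E → Ψ (v ∷ E)) (ma′ v)))
    where
    cancel : ∀ p q → q ≈ 0# → p - (p - q) ≈ 0#
    cancel p q q≈0 = begin
      p - (p - q)     ≈⟨ +-congˡ (-‿cong (trans (+-congˡ (-‿cong q≈0)) (x-0≈x p))) ⟩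
      p - p           ≈⟨ -‿inverseʳ p ⟩
      0#              ∎
    -- The terms of the two equal columns have the same minor and opposite signs; every later minor
    -- contains both columns and vanishes.
    adjacent : ∀ k (Ψ : Vec Col (suc k) → C) → MA (suc k) Ψ → ∀ v D → laplace Ψ (v ∷ v ∷ D) ≈ 0#
    adjacent zero    Ψ _             v D = -‿inverseʳ _
    adjacent (suc k) Ψ (_ , adj , _) v D = cancel _ _
      (trans (laplace-cong (λ E → adj v E) D) (laplace-0 D))

  tailCol : Col → Col
  tailCol v i = v (suc i)

  MA-map-tail : ∀ {k} (Ψ : Vec Col k → C) → MA k Ψ → MA k (λ D → Ψ (Vec.map tailCol D))
  MA-map-tail {zero}  Ψ _ = tt
  MA-map-tail {suc k} Ψ (lin , adj , ma) =
    (λ D eq → lin (Vec.map tailCol D) (eq ∘ suc)) ,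
    adjacent k Ψ adj ,
    (λ v → MA-map-tail (λ D → Ψ (tailCol v ∷ D)) (ma (tailCol v)))
    where
    adjacent : ∀ k (Ψ : Vec Col (suc k) → C) → Adjacent k Ψ → Adjacent k (λ D → Ψ (Vec.map tailCol D))
    adjacent zero    Ψ _   = tt
    adjacent (suc k) Ψ adj v D = adj (tailCol v) (Vec.map tailCol D)

  detᶜ : ∀ {k} → Vec Col k → C
  detᶜ {zero}  D = 1#
  detᶜ {suc k} D = laplace (λ E → detᶜ (Vec.map tailCol E)) D

  detᶜ-MA : ∀ k → MA k detᶜ
  detᶜ-MA zero    = tt
  detᶜ-MA (suc k) = MA-laplace (λ E → detᶜ (Vec.map tailCol E)) (MA-map-tail detᶜ (detᶜ-MA k))

  ∏ᴺ : ℕ → (ℕ → C) → C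
  ∏ᴺ zero    f = 1#
  ∏ᴺ (suc k) f = f 0 * ∏ᴺ k (f ∘ suc)

  scale : (ℕ → C) → Col → Col
  scale w v i = w i * v i

  laplace-scale : ∀ {k} w {Ψ Φ : Vec Col k → C} r → (∀ D → Ψ (Vec.map (scale w) D) ≈ r * Φ D) →
                  ∀ D → laplace Ψ (Vec.map (scale w) D) ≈ w 0 * r * laplace Φ D
  laplace-scale {zero}  w {Ψ} {Φ} r eq (v ∷ D) = trans (*-congˡ (eq D))
    (solve 4 (λ w v r p → w :* v :* (r :* p) := w :* r :* (v :* p)) refl (w 0) (v 0) r (Φ D))
  laplace-scale {suc k} w {Ψ} {Φ} r eq (v ∷ D) = begin
    w 0 * v 0 * Ψ (Vec.map (scale w) D) - laplace (λ E → Ψ (scale w v ∷ E)) (Vec.map (scale w) D)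
      ≈⟨ +-cong (*-congˡ (eq D)) (-‿cong (laplace-scale w r (λ E → eq (v ∷ E)) D)) ⟩
    w 0 * v 0 * (r * Φ D) - w 0 * r * laplace (λ E → Φ (v ∷ E)) D
      ≈⟨ +-cong (solve 4 (λ w v r p → w :* v :* (r :* p) := w :* r :* (v :* p)) refl (w 0) (v 0) r (Φ D))
                (-‿distribʳ-* _ _) ⟩
    w 0 * r * (v 0 * Φ D) + w 0 * r * - laplace (λ E → Φ (v ∷ E)) D
      ≈⟨ distribˡ _ _ _ ⟨
    w 0 * r * (v 0 * Φ D - laplace (λ E → Φ (v ∷ E)) D) ∎

  map-tail-scale : ∀ {k} w (D : Vec Col k) →
    Vec.map tailCol (Vec.map (scale w) D) ≡ Vec.map (scale (w ∘ suc)) (Vec.map tailCol D)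
  map-tail-scale w []      = ≡.refl
  map-tail-scale w (v ∷ D) = ≡.cong (_ ∷_) (map-tail-scale w D)

  detᶜ-scale : ∀ {k} w (D : Vec Col k) → detᶜ (Vec.map (scale w) D) ≈ ∏ᴺ k w * detᶜ D
  detᶜ-scale {zero}  w D = sym (*-identityˡ _)
  detᶜ-scale {suc k} w D = laplace-scale w (∏ᴺ k (w ∘ suc))
    (λ E → trans (reflexive (≡.cong detᶜ (map-tail-scale w E))) (detᶜ-scale (w ∘ suc) (Vec.map tailCol E))) D

  Vanish : ℕ → Col → Set ℓ
  Vanish k v = v k ≈ 0#

  tail-vanish : ∀ {m k} {D : Vec Col m} → All (Vanish (suc k)) D → All (Vanish k) (Vec.map tailCol D)
  tail-vanish []       = []
  tail-vanish (z ∷ zs) = z ∷ tail-vanish zs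

  -- Expansion along row `0` keeps the last row in every minor, down to size one.
  detᶜ-vanish : ∀ {k} {D : Vec Col (suc k)} → All (Vanish k) D → detᶜ D ≈ 0#
  detᶜ-vanish {zero}  {v ∷ []} (z ∷ []) = trans (*-congʳ z) (zeroˡ _)
  detᶜ-vanish {suc k} {D} zs =
    trans (laplace-cong-All {Φ = λ _ → 0#} (λ zs′ → detᶜ-vanish (tail-vanish zs′)) zs) (laplace-0 D)

  -- The term of the appended column's own entry has the minor `Ψ D`, which is zero. In all other
  -- terms `v` remains the last column of the minor.
  laplace-∷ʳ : ∀ {p} {P : Col → Set p} {k} {Ψ : Vec Col (suc k) → C} {v} →
               (∀ {D} → All P D → Ψ D ≈ 0#) → ∀ {D : Vec Col (suc k)} → All P D →
               laplace Ψ (D ∷ʳ v) ≈ laplace (λ E → Ψ (E ∷ʳ v)) D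
  laplace-∷ʳ {k = zero}  {Ψ} {v} z {u ∷ []} (pu ∷ []) = begin
    u 0 * Ψ (v ∷ []) - v 0 * Ψ (u ∷ [])  ≈⟨ +-congˡ (-‿cong (trans (*-congˡ (z (pu ∷ []))) (zeroʳ _))) ⟩
    u 0 * Ψ (v ∷ []) - 0#                ≈⟨ x-0≈x _ ⟩
    u 0 * Ψ (v ∷ [])                     ∎
  laplace-∷ʳ {k = suc k} z {u ∷ D} (pu ∷ ps) =
    +-congˡ (-‿cong (laplace-∷ʳ (λ qs → z (pu ∷ qs)) ps))

  map-∷ʳ : ∀ {k} (D : Vec Col k) v → Vec.map tailCol (D ∷ʳ v) ≡ Vec.map tailCol D ∷ʳ tailCol v
  map-∷ʳ []      v = ≡.refl
  map-∷ʳ (u ∷ D) v = ≡.cong (_ ∷_) (map-∷ʳ D v)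

  -- Expansion along the last row when only its last entry survives, derived from expansions along
  -- row `0`. The sign is positive because the entry lies on the diagonal.
  detᶜ-∷ʳ : ∀ {k} {D : Vec Col k} v → All (Vanish k) D → detᶜ (D ∷ʳ v) ≈ v k * detᶜ D
  detᶜ-∷ʳ {zero}  {[]} v []  = refl
  detᶜ-∷ʳ {suc k} {D}  v zs = begin
    detᶜ (D ∷ʳ v)
      ≈⟨ laplace-∷ʳ (λ zs′ → detᶜ-vanish (tail-vanish zs′)) zs ⟩
    laplace (λ E → detᶜ (Vec.map tailCol (E ∷ʳ v))) D
      ≈⟨ laplace-cong-All (λ {E} zs′ → trans (reflexive (≡.cong detᶜ (map-∷ʳ E v)))
                                     (detᶜ-∷ʳ (tailCol v) (tail-vanish zs′))) zs ⟩
    laplace (λ E → v (suc k) * detᶜ (Vec.map tailCol E)) D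
      ≈⟨ laplace-*ˡ (v (suc k)) (λ E → detᶜ (Vec.map tailCol E)) D ⟩
    v (suc k) * detᶜ D ∎

  -- Branching

  -- A zero column is `u - u`.
  MA-zero : ∀ {k} Ψ → MA (suc k) Ψ → ∀ {u} D → (∀ i → u i ≈ 0#) → Ψ (u ∷ D) ≈ 0#
  MA-zero Ψ (lin , _) {u} D u≈0 =
    trans (lin {u = u} {v = u} {r = - 1#} D (λ i → trans (u≈0 i) (sym (x+-x (u i))))) (x+-x _)
    where
    x+-x : ∀ x → x + - 1# * x ≈ 0#
    x+-x x = trans (+-congˡ (trans (sym (-‿distribˡ-* 1# x)) (-‿cong (*-identityˡ x)))) (-‿inverseʳ x)

  MA-∑ : ∀ {k} Ψ → MA (suc k) Ψ → ∀ (r : ℕ → C) (g : ℕ → Col) D vs →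
         Ψ ((λ i → ∑ˡ (λ v → r v * g v i) vs) ∷ D) ≈ ∑ˡ (λ v → r v * Ψ (g v ∷ D)) vs
  MA-∑ Ψ ma r g D []       = MA-zero Ψ ma D (λ _ → refl)
  MA-∑ Ψ ma@(lin , _) r g D (v ∷ vs) =
    trans (lin {u = λ i → ∑ˡ (λ v → r v * g v i) vs} {v = g v} {r = r v} D (λ i → +-comm _ _))
      (trans (+-comm _ _) (+-congˡ (MA-∑ Ψ ma r g D vs)))

  segment : (ℕ → C) → ℕ → ℕ → C
  segment q v zero    = 1#
  segment q v (suc d) = q v * segment q (suc v) d

  segment-cong : ∀ {q q′} v d → (∀ j → v ℕ.≤ j → j ℕ.< v ℕ.+ d → q j ≈ q′ j) → segment q v d ≈ segment q′ v d
  segment-cong v zero    eq = refl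
  segment-cong v (suc d) eq =
    *-cong (eq v ℕₚ.≤-refl (ℕₚ.m<m+n v (s≤s z≤n)))
           (segment-cong (suc v) d (λ j p p′ → eq j (ℕₚ.<⇒≤ p) (≡.subst (j ℕ.<_) (≡.sym (ℕₚ.+-suc v d)) p′)))

  segment-+ : ∀ q v d d′ → segment q v (d ℕ.+ d′) ≈ segment q v d * segment q (v ℕ.+ d) d′
  segment-+ q v zero    d′ =
    trans (reflexive (≡.cong (λ v → segment q v d′) (≡.sym (ℕₚ.+-identityʳ v)))) (sym (*-identityˡ _))
  segment-+ q v (suc d) d′ = trans
    (*-congˡ (trans (segment-+ q (suc v) d d′)
      (*-congˡ (reflexive (≡.cong (λ v → segment q v d′) (≡.sym (ℕₚ.+-suc v d)))))))
    (sym (*-assoc _ _ _))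

  -- The number of columns still to come is the staircase shift n - j of the numerators.
  columns : ∀ k → (ℕ → Col) → Shape → Vec Col k
  columns zero    f μ = []
  columns (suc k) f μ = f (μ 0 ℕ.+ k) ∷ columns k f (μ ∘ suc)

  -- What iterating the recurrence makes of `f (hi + e + 1)`, up to its remainder. Removing the box
  -- in column `s`, counted from 0, leads from `f (s + e + 2)` to `f (s + e + 1)`; this is why that
  -- box has weight `p (s + e + 2)`.
  branchColumn : ℕ → (ℕ → C) → (ℕ → Col) → ℕ → ℕ → Col
  branchColumn e p h lo hi i =
    ∑ˡ (λ v → segment (λ s → p (s ℕ.+ (2 ℕ.+ e))) v (hi ∸ v) * h (v ℕ.+ e) i) (range lo (hi ∸ lo))

  branchColumns : ∀ k → (ℕ → C) → (ℕ → Col) → Shape → Shape → Vec Col k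
  branchColumns zero    p h lo μ = []
  branchColumns (suc k) p h lo μ =
    branchColumn k p h (lo 0) (μ 0) ∷ branchColumns k p h (lo ∘ suc) (μ ∘ suc)

  skewWeight : ℕ → (ℕ → C) → Shape → Shape → C
  skewWeight zero    p μ ν = 1#
  skewWeight (suc k) p μ ν =
    segment (λ s → p (s ℕ.+ (2 ℕ.+ k))) (ν 0) (μ 0 ∸ ν 0) * skewWeight k p (μ ∘ suc) (ν ∘ suc)

  expand : ∀ k Ψ → MA k Ψ → ∀ p h lo μ →
           Ψ (branchColumns k p h lo μ) ≈
           ∑ˡ (λ ν → skewWeight k p μ ν * Ψ (columns k h ν)) (boxes k lo μ)
  expand zero    Ψ ma p h lo μ = sym (trans (+-identityʳ _) (*-identityˡ _))
  expand (suc k) Ψ ma@(_ , _ , ma′) p h lo μ = begin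
    Ψ (branchColumn k p h (lo 0) (μ 0) ∷ T)
      ≈⟨ MA-∑ Ψ ma r (λ v → h (v ℕ.+ k)) T vs ⟩
    ∑ˡ (λ v → r v * Ψ (h (v ℕ.+ k) ∷ T)) vs
      ≈⟨ ∑ˡ-cong vs (λ {v} _ → begin
           r v * Ψ (h (v ℕ.+ k) ∷ T)
             ≈⟨ *-congˡ (expand k (λ D → Ψ (h (v ℕ.+ k) ∷ D)) (ma′ _) p h (lo ∘ suc) (μ ∘ suc)) ⟩
           r v * ∑ˡ (λ ν → skewWeight k p (μ ∘ suc) ν * Ψ (h (v ℕ.+ k) ∷ columns k h ν)) νs
             ≈⟨ ∑ˡ-*ˡ (r v) _ νs ⟨
           ∑ˡ (λ ν → r v * (skewWeight k p (μ ∘ suc) ν * Ψ (h (v ℕ.+ k) ∷ columns k h ν))) νs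
             ≈⟨ ∑ˡ-cong νs (λ _ → sym (*-assoc _ _ _)) ⟩
           ∑ˡ (λ ν → skewWeight (suc k) p μ (cons v ν) * Ψ (columns (suc k) h (cons v ν))) νs ∎) ⟩
    ∑ˡ (λ v → ∑ˡ (λ ν → skewWeight (suc k) p μ (cons v ν) * Ψ (columns (suc k) h (cons v ν))) νs) vs
      ≈⟨ ∑ˡ-product _ cons vs νs ⟨
    _ ∎
    where
    r : ℕ → C
    r v = segment (λ s → p (s ℕ.+ (2 ℕ.+ k))) v (μ 0 ∸ v)
    T  = branchColumns k p h (lo ∘ suc) (μ ∘ suc)
    vs = range (lo 0) (μ 0 ∸ lo 0)
    νs = boxes k (lo ∘ suc) (μ ∘ suc)

  -- The recurrence turns each column into a combination of h-columns plus a
  -- multiple of the next column, which a column operation removes.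
  module Recurrence (p : ℕ → C) (f h : ℕ → Col)
                    (rec : ∀ t i → f (suc t) i ≈ h t i + p (suc t) * f t i) where

    -- The induction raises `lo`, so that `range` unfolds at its head; the step applies `rec` once
    -- more to the remainder `f (suc lo + e)`.
    telescope′ : ∀ e lo d i →
      f (suc (lo ℕ.+ d ℕ.+ e)) i ≈
      ∑ˡ (λ v → segment (λ s → p (s ℕ.+ (2 ℕ.+ e))) v (lo ℕ.+ d ∸ v) * h (v ℕ.+ e) i) (range lo d) +
      segment (λ s → p (s ℕ.+ (2 ℕ.+ e))) lo d * p (suc (lo ℕ.+ e)) * f (lo ℕ.+ e) i
    telescope′ e lo zero i rewrite ℕₚ.+-identityʳ lo | ℕₚ.n∸n≡0 lo =
      trans (rec (lo ℕ.+ e) i)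
        (+-cong (sym (trans (+-identityʳ _) (*-identityˡ _))) (*-congʳ (sym (*-identityˡ _))))
    telescope′ e lo (suc d) i
      rewrite ℕₚ.+-suc lo d
            | ≡.trans (≡.cong (_∸ lo) (≡.sym (ℕₚ.+-suc lo d))) (ℕₚ.m+n∸m≡n lo (suc d)) = begin
      f (suc (suc lo ℕ.+ d ℕ.+ e)) i
        ≈⟨ telescope′ e (suc lo) d i ⟩
      Σ + s * p (suc (suc lo ℕ.+ e)) * f (suc lo ℕ.+ e) i
        ≈⟨ +-congˡ (*-cong (*-congˡ (reflexive (≡.cong p (≡.sym (+-2+ lo e))))) (rec (lo ℕ.+ e) i)) ⟩
      Σ + s * q * (h (lo ℕ.+ e) i + p (suc (lo ℕ.+ e)) * f (lo ℕ.+ e) i)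
        ≈⟨ solve 6 (λ σ s q a b c → σ :+ s :* q :* (a :+ b :* c) := (q :* s :* a :+ σ) :+ q :* s :* b :* c)
             refl Σ s q (h (lo ℕ.+ e) i) (p (suc (lo ℕ.+ e))) (f (lo ℕ.+ e) i) ⟩
      (q * s * h (lo ℕ.+ e) i + Σ) + q * s * p (suc (lo ℕ.+ e)) * f (lo ℕ.+ e) i ∎
      where
      +-2+ : ∀ m n → m ℕ.+ (2 ℕ.+ n) ≡ suc (suc (m ℕ.+ n))
      +-2+ m n = ≡.trans (ℕₚ.+-suc m (suc n)) (≡.cong suc (ℕₚ.+-suc m n))
      q = p (lo ℕ.+ (2 ℕ.+ e))
      s = segment (λ s → p (s ℕ.+ (2 ℕ.+ e))) (suc lo) d
      Σ = ∑ˡ (λ v → segment (λ s → p (s ℕ.+ (2 ℕ.+ e))) v (suc lo ℕ.+ d ∸ v) * h (v ℕ.+ e) i) (range (suc lo) d)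

    telescope : ∀ e {lo hi} → lo ℕ.≤ hi → ∀ i →
      f (suc (hi ℕ.+ e)) i ≈ branchColumn e p h lo hi i +
        segment (λ s → p (s ℕ.+ (2 ℕ.+ e))) lo (hi ∸ lo) * p (suc (lo ℕ.+ e)) * f (lo ℕ.+ e) i
    telescope e {lo} {hi} lo≤hi i =
      ≡.subst (λ m → f (suc (m ℕ.+ e)) i ≈
        ∑ˡ (λ v → segment (λ s → p (s ℕ.+ (2 ℕ.+ e))) v (m ∸ v) * h (v ℕ.+ e) i) (range lo (hi ∸ lo)) +
        segment (λ s → p (s ℕ.+ (2 ℕ.+ e))) lo (hi ∸ lo) * p (suc (lo ℕ.+ e)) * f (lo ℕ.+ e) i)
        (ℕₚ.m+[n∸m]≡n lo≤hi) (telescope′ e lo (hi ∸ lo) i)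

    -- With `lo` the length of the next row, the remainder of `telescope` is a multiple of the next
    -- column. The last column has no successor and stays as it is.
    reduce : ∀ k Ψ → MA (suc k) Ψ → ∀ {μ} → Anti μ →
             Ψ (columns (suc k) f μ) ≈ Ψ (branchColumns k p h (μ ∘ suc) μ ∷ʳ f (μ k))
    reduce zero    Ψ ma {μ} anti =
      reflexive (≡.cong (λ m → Ψ (f m ∷ [])) (ℕₚ.+-identityʳ (μ 0)))
    reduce (suc k) Ψ ma@(lin , _ , ma′) {μ} anti = begin
      Ψ (f (μ 0 ℕ.+ suc k) ∷ columns (suc k) f (μ ∘ suc))
        ≈⟨ lin {r = r} (columns (suc k) f (μ ∘ suc)) (λ i →
             trans (reflexive (≡.cong (λ m → f m i) (ℕₚ.+-suc (μ 0) k))) (telescope k (anti 0) i)) ⟩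
      Ψ (b ∷ columns (suc k) f (μ ∘ suc)) + r * Ψ (f (μ 1 ℕ.+ k) ∷ columns (suc k) f (μ ∘ suc))
        ≈⟨ +-congˡ (trans (*-congˡ (MA-adjacent Ψ ma (columns k f (μ ∘ suc ∘ suc)) (λ _ → refl))) (zeroʳ _)) ⟩
      Ψ (b ∷ columns (suc k) f (μ ∘ suc)) + 0#
        ≈⟨ +-identityʳ _ ⟩
      Ψ (b ∷ columns (suc k) f (μ ∘ suc))
        ≈⟨ reduce k (λ D → Ψ (b ∷ D)) (ma′ b) (anti ∘ suc) ⟩
      _ ∎
      where
      b = branchColumn k p h (μ 1) (μ 0)
      r = segment (λ s → p (s ℕ.+ (2 ℕ.+ k))) (μ 1) (μ 0 ∸ μ 1) * p (suc (μ 1 ℕ.+ k))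

    -- Here the last column is rewritten too: its remainder is a multiple of `f (μ k)`, that is of
    -- `f 0`, which vanishes. So no row is lost.
    reduce₀ : (∀ i → f 0 i ≈ 0#) → ∀ k Ψ → MA k Ψ → ∀ {μ} → Anti μ → μ k ≡ 0 →
              Ψ (columns k (f ∘ suc) μ) ≈ Ψ (branchColumns k p h (μ ∘ suc) μ)
    reduce₀ f0 zero          Ψ ma anti μk≡0 = refl
    reduce₀ f0 (suc zero)    Ψ ma {μ} anti μk≡0 = MA-cong₁ Ψ ma [] (λ i → begin
      f (suc (μ 0 ℕ.+ 0)) i                                ≈⟨ telescope 0 (anti 0) i ⟩
      branchColumn 0 p h (μ 1) (μ 0) i + _ * f (μ 1 ℕ.+ 0) i
        ≈⟨ +-congˡ (*-congˡ (trans (reflexive (≡.cong (λ m → f (m ℕ.+ 0) i) μk≡0)) (f0 i))) ⟩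
      branchColumn 0 p h (μ 1) (μ 0) i + _ * 0#            ≈⟨ +-congˡ (zeroʳ _) ⟩
      branchColumn 0 p h (μ 1) (μ 0) i + 0#                ≈⟨ +-identityʳ _ ⟩
      branchColumn 0 p h (μ 1) (μ 0) i                     ∎)
    reduce₀ f0 (suc (suc k)) Ψ ma@(lin , _ , ma′) {μ} anti μk≡0 = begin
      Ψ (f (suc (μ 0 ℕ.+ suc k)) ∷ columns (suc k) (f ∘ suc) (μ ∘ suc))
        ≈⟨ lin {r = r} (columns (suc k) (f ∘ suc) (μ ∘ suc)) (telescope (suc k) (anti 0)) ⟩
      Ψ (b ∷ columns (suc k) (f ∘ suc) (μ ∘ suc)) +
        r * Ψ (f (μ 1 ℕ.+ suc k) ∷ columns (suc k) (f ∘ suc) (μ ∘ suc))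
        ≈⟨ +-congˡ (trans (*-congˡ (MA-adjacent Ψ ma (columns k (f ∘ suc) (μ ∘ suc ∘ suc))
             (λ i → reflexive (≡.cong (λ m → f m i) (ℕₚ.+-suc (μ 1) k))))) (zeroʳ _)) ⟩
      Ψ (b ∷ columns (suc k) (f ∘ suc) (μ ∘ suc)) + 0#
        ≈⟨ +-identityʳ _ ⟩
      Ψ (b ∷ columns (suc k) (f ∘ suc) (μ ∘ suc))
        ≈⟨ reduce₀ f0 (suc k) (λ D → Ψ (b ∷ D)) (ma′ b) (anti ∘ suc) μk≡0 ⟩
      _ ∎
      where
      b = branchColumn (suc k) p h (μ 1) (μ 0)
      r = segment (λ s → p (s ℕ.+ (2 ℕ.+ suc k))) (μ 1) (μ 0 ∸ μ 1) * p (suc (μ 1 ℕ.+ suc k))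

    branch₀ : (∀ i → f 0 i ≈ 0#) → ∀ k {μ} → Anti μ → μ k ≡ 0 →
              detᶜ (columns k (f ∘ suc) μ) ≈
              ∑ˡ (λ ν → skewWeight k p μ ν * detᶜ (columns k h ν)) (boxes k (μ ∘ suc) μ)
    branch₀ f0 k {μ} anti μk≡0 =
      trans (reduce₀ f0 k detᶜ (detᶜ-MA k) anti μk≡0) (expand k detᶜ (detᶜ-MA k) p h (μ ∘ suc) μ)

  ∑ˡ-0 : ∀ {A : Set} (F : A → C) xs → (∀ x → F x ≈ 0#) → ∑ˡ F xs ≈ 0#
  ∑ˡ-0 F []       z = refl
  ∑ˡ-0 F (x ∷ xs) z = trans (+-cong (z x) (∑ˡ-0 F xs z)) (+-identityˡ 0#)

  branchColumns-vanish : ∀ {m} k {p h} → (∀ t → h t m ≈ 0#) → ∀ lo μ → All (Vanish m) (branchColumns k p h lo μ)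
  branchColumns-vanish zero    z lo μ = []
  branchColumns-vanish (suc k) z lo μ =
    ∑ˡ-0 _ (range (lo 0) (μ 0 ∸ lo 0)) (λ v → trans (*-congˡ (z _)) (zeroʳ _)) ∷
    branchColumns-vanish k z (lo ∘ suc) (μ ∘ suc)

  columns-scale : ∀ k w h ν → columns k (scale w ∘ h) ν ≡ Vec.map (scale w) (columns k h ν)
  columns-scale zero    w h ν = ≡.refl
  columns-scale (suc k) w h ν = ≡.cong (_ ∷_) (columns-scale k w h (ν ∘ suc))

  -- The first factor is the weight of row `k`, which is removed completely. Its offset 1 is the
  -- `2 + e` of the rows above, continued to `e = -1`.
  stripWeight : ℕ → (ℕ → C) → Shape → Shape → C
  stripWeight k p μ ν = segment (λ s → p (s ℕ.+ 1)) 0 (μ k) * skewWeight k p μ ν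

  skewWeight-cong : ∀ k {p q} μ ν → (∀ s → p s ≈ q s) → skewWeight k p μ ν ≈ skewWeight k q μ ν
  skewWeight-cong zero    μ ν eq = refl
  skewWeight-cong (suc k) μ ν eq = *-cong (segment-cong (ν 0) (μ 0 ∸ ν 0) (λ j _ _ → eq (j ℕ.+ (2 ℕ.+ k))))
    (skewWeight-cong k (μ ∘ suc) (ν ∘ suc) eq)

  stripWeight-cong : ∀ k {p q} μ ν → (∀ s → p s ≈ q s) → stripWeight k p μ ν ≈ stripWeight k q μ ν
  stripWeight-cong k μ ν eq =
    *-cong (segment-cong 0 (μ k) (λ j _ _ → eq (j ℕ.+ 1))) (skewWeight-cong k μ ν eq)

  module _ (p : ℕ → C) (f h : ℕ → Col) (w : ℕ → C)
           (rec : ∀ t i → f (suc t) i ≈ w i * h t i + p (suc t) * f t i) where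

    private module Rec = Recurrence p f (scale w ∘ h) rec

    -- In a row where `w` vanishes the recurrence has a single term, and its solution is a product.
    last-entry : ∀ {k} → w k ≈ 0# → ∀ m → f m k ≈ f 0 k * segment (λ s → p (s ℕ.+ 1)) 0 m
    last-entry {k} wk≈0 zero    = sym (*-identityʳ _)
    last-entry {k} wk≈0 (suc m) = begin
      f (suc m) k                              ≈⟨ rec m k ⟩
      w k * h m k + p (suc m) * f m k
        ≈⟨ +-cong (trans (*-congʳ wk≈0) (zeroˡ _)) (*-cong (reflexive (≡.cong p (ℕₚ.+-comm 1 m))) (last-entry wk≈0 m)) ⟩
      0# + p (m ℕ.+ 1) * (f 0 k * s m)         ≈⟨ solve 3 (λ a b c → con 0 :+ a :* (b :* c) := b :* (c :* (a :* con 1))) refl (p (m ℕ.+ 1)) (f 0 k) (s m) ⟩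
      f 0 k * (s m * segment (λ s → p (s ℕ.+ 1)) m 1)
        ≈⟨ *-congˡ (segment-+ _ 0 m 1) ⟨
      f 0 k * s (m ℕ.+ 1)                      ≈⟨ *-congˡ (reflexive (≡.cong s (ℕₚ.+-comm m 1))) ⟩
      f 0 k * s (suc m)                        ∎
      where
      s : ℕ → C
      s = segment (λ s → p (s ℕ.+ 1)) 0

    -- As w vanishes in row k, after the column operations that row is zero except
    -- in its last entry.
    branch : ∀ k {μ} → Anti μ → w k ≈ 0# →
             detᶜ (columns (suc k) f μ) ≈
             f 0 k * ∏ᴺ k w * ∑ˡ (λ ν → stripWeight k p μ ν * detᶜ (columns k h ν)) (boxes k (μ ∘ suc) μ)
    branch k {μ} anti wk≈0 = begin
      detᶜ (columns (suc k) f μ)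
        ≈⟨ Rec.reduce k detᶜ (detᶜ-MA (suc k)) anti ⟩
      detᶜ (branchColumns k p (scale w ∘ h) (μ ∘ suc) μ ∷ʳ f (μ k))
        ≈⟨ detᶜ-∷ʳ (f (μ k)) (branchColumns-vanish k (λ t → trans (*-congʳ wk≈0) (zeroˡ _)) (μ ∘ suc) μ) ⟩
      f (μ k) k * detᶜ (branchColumns k p (scale w ∘ h) (μ ∘ suc) μ)
        ≈⟨ *-cong (last-entry wk≈0 (μ k)) (expand k detᶜ (detᶜ-MA k) p (scale w ∘ h) (μ ∘ suc) μ) ⟩
      f 0 k * s * ∑ˡ (λ ν → skewWeight k p μ ν * detᶜ (columns k (scale w ∘ h) ν)) νs
        ≈⟨ *-congˡ (∑ˡ-cong νs (λ {ν} _ → *-congˡ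
             (trans (reflexive (≡.cong detᶜ (columns-scale k w h ν))) (detᶜ-scale w (columns k h ν))))) ⟩
      f 0 k * s * ∑ˡ (λ ν → skewWeight k p μ ν * (∏ᴺ k w * detᶜ (columns k h ν))) νs
        ≈⟨ *-assoc _ _ _ ⟩
      f 0 k * (s * ∑ˡ (λ ν → skewWeight k p μ ν * (∏ᴺ k w * detᶜ (columns k h ν))) νs)
        ≈⟨ *-congˡ (∑ˡ-*ˡ s _ νs) ⟨
      f 0 k * ∑ˡ (λ ν → s * (skewWeight k p μ ν * (∏ᴺ k w * detᶜ (columns k h ν)))) νs
        ≈⟨ *-congˡ (∑ˡ-cong νs (λ {ν} _ →
             solve 4 (λ s a b c → s :* (a :* (b :* c)) := b :* (s :* a :* c)) refl
               s (skewWeight k p μ ν) (∏ᴺ k w) (detᶜ (columns k h ν)))) ⟩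
      f 0 k * ∑ˡ (λ ν → ∏ᴺ k w * (stripWeight k p μ ν * detᶜ (columns k h ν))) νs
        ≈⟨ *-congˡ (∑ˡ-*ˡ (∏ᴺ k w) _ νs) ⟩
      f 0 k * (∏ᴺ k w * ∑ˡ (λ ν → stripWeight k p μ ν * detᶜ (columns k h ν)) νs)
        ≈⟨ *-assoc _ _ _ ⟨
      _ ∎
      where
      s  = segment (λ s → p (s ℕ.+ 1)) 0 (μ k)
      νs = boxes k (μ ∘ suc) μ

  verticalColumns : (F : ℕ → Col) (q : ℕ → C) (G : ℕ → Col) →
    (∀ i → F 0 i ≈ 0#) → (∀ t i → G t i ≈ F (suc t) i + q (suc t) * F t i) →
    ∀ k Ψ → MA k Ψ → ∀ {μ} → Anti μ →
    Ψ (columns k G μ) ≈ Ψ (branchColumns k q (F ∘ suc) (pred ∘ μ) μ)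
  verticalColumns F q G F0 eq zero    Ψ ma anti = refl
  verticalColumns F q G F0 eq (suc k) Ψ ma@(lin , _ , ma′) {μ} anti =
    trans (verticalColumns F q G F0 eq k (λ D → Ψ (G (μ 0 ℕ.+ k) ∷ D)) (ma′ _) (anti ∘ suc))
          (head (μ 0) ≡.refl)
    where
    T : ∀ k → Vec Col k
    T k = branchColumns k q (F ∘ suc) (pred ∘ μ ∘ suc) (μ ∘ suc)
    head : ∀ m → μ 0 ≡ m →
           Ψ (G (m ℕ.+ k) ∷ T k) ≈ Ψ (branchColumn k q (F ∘ suc) (pred m) m ∷ T k)
    head (suc m) _ = MA-cong₁ Ψ ma (T k) λ i → begin
      G (suc m ℕ.+ k) i
        ≈⟨ eq (suc m ℕ.+ k) i ⟩
      F (suc (suc m ℕ.+ k)) i + q (suc (suc m ℕ.+ k)) * F (suc m ℕ.+ k) i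
        ≈⟨ +-cong (sym (*-identityˡ _)) (*-congʳ (trans
             (reflexive (≡.cong q (≡.sym (≡.trans (ℕₚ.+-suc m (suc k)) (≡.cong suc (ℕₚ.+-suc m k))))))
             (sym (*-identityʳ _)))) ⟩
      1# * F (suc (suc m ℕ.+ k)) i + q (m ℕ.+ (2 ℕ.+ k)) * 1# * F (suc m ℕ.+ k) i
        ≈⟨ +-comm _ _ ⟩
      q (m ℕ.+ (2 ℕ.+ k)) * 1# * F (suc m ℕ.+ k) i + 1# * F (suc (suc m ℕ.+ k)) i
        ≈⟨ +-congˡ (+-identityʳ _) ⟨
      q (m ℕ.+ (2 ℕ.+ k)) * 1# * F (suc m ℕ.+ k) i + (1# * F (suc (suc m ℕ.+ k)) i + 0#)
        ≈⟨ +-cong (*-congʳ (reflexive (≡.cong s (≡.sym (d≡1 m)))))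
                  (+-congʳ (*-congʳ (reflexive (≡.cong s′ (≡.sym (ℕₚ.n∸n≡0 m)))))) ⟩
      s (suc m ∸ m) * F (suc m ℕ.+ k) i + (s′ (m ∸ m) * F (suc (suc m ℕ.+ k)) i + 0#)
        ≈⟨ reflexive (≡.cong (λ vs → ∑ˡ (λ v → segment (λ s → q (s ℕ.+ (2 ℕ.+ k))) v (suc m ∸ v) * F (suc (v ℕ.+ k)) i) vs)
             (≡.cong (range m) (≡.sym (d≡1 m)))) ⟩
      branchColumn k q (F ∘ suc) m (suc m) i ∎
      where
      d≡1 : ∀ m → suc m ∸ m ≡ 1
      d≡1 m = ℕₚ.m+n∸n≡m 1 m
      s = segment (λ s → q (s ℕ.+ (2 ℕ.+ k))) m
      s′ = segment (λ s → q (s ℕ.+ (2 ℕ.+ k))) (suc m)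
    -- All further rows are empty as well, so the unwanted term repeats the next column; for the
    -- last column it is a multiple of `F 0`.
    head zero μ0≡0 = first k ma
      where
      b : ∀ k → Col
      b k = branchColumn k q (F ∘ suc) 0 0
      F≈b : ∀ k i → F (suc k) i ≈ b k i
      F≈b k i = sym (trans (+-identityʳ _) (*-identityˡ _))
      first : ∀ k {Ψ} → MA (suc k) Ψ → Ψ (G k ∷ T k) ≈ Ψ (b k ∷ T k)
      first zero    {Ψ} ma = MA-cong₁ Ψ ma [] λ i →
        trans (eq 0 i) (trans (+-cong (F≈b 0 i) (trans (*-congˡ (F0 i)) (zeroʳ _))) (+-identityʳ _))
      first (suc k) {Ψ} ma@(lin , _) = begin
        Ψ (G (suc k) ∷ T (suc k))
          ≈⟨ lin {r = q (suc (suc k))} (T (suc k)) (λ i → trans (eq (suc k) i) (+-congʳ (F≈b (suc k) i))) ⟩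
        Ψ (b (suc k) ∷ T (suc k)) + q (suc (suc k)) * Ψ (F (suc k) ∷ T (suc k))
          ≈⟨ +-congˡ (trans (*-congˡ (MA-adjacent Ψ ma _ λ i →
               trans (F≈b k i) (reflexive (≡.cong (λ m → branchColumn k q (F ∘ suc) (pred m) m i) (≡.sym μ1≡0)))))
               (zeroʳ _)) ⟩
        Ψ (b (suc k) ∷ T (suc k)) + 0#
          ≈⟨ +-identityʳ _ ⟩
        Ψ (b (suc k) ∷ T (suc k)) ∎
        where
        μ1≡0 : μ 1 ≡ 0
        μ1≡0 = ℕₚ.n≤0⇒n≡0 (≡.subst (μ 1 ℕ.≤_) μ0≡0 (anti 0))

  -- A row of ν shorter by one than the row below it gives two equal columns.
  columns-ascent : ∀ k Ψ → MA k Ψ → ∀ (F : ℕ → Col) {ν} → Rows k ν → (∀ i → ν (suc i) ℕ.≤ suc (ν i)) →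
                   ¬ Descending k ν → Ψ (columns k (F ∘ suc) ν) ≈ 0#
  columns-ascent zero          Ψ ma F rowsν step asc = contradiction (λ ()) asc
  columns-ascent (suc zero)    Ψ ma F {ν} rowsν step asc =
    contradiction (λ { {zero} _ → ≡.subst (ℕ._≤ ν 0) (≡.sym (rowsν 1 ℕₚ.≤-refl)) z≤n ; {suc _} (s≤s ()) }) asc
  columns-ascent (suc (suc k)) Ψ ma@(_ , _ , ma′) F {ν} rowsν step asc =
    [ (λ p → columns-ascent (suc k) (λ D → Ψ (F (suc (ν 0 ℕ.+ suc k)) ∷ D)) (ma′ _) F
        (λ i q → rowsν (suc i) (s≤s q)) (step ∘ suc)
        (λ d → asc λ { {zero} _ → p ; {suc i} (s≤s q) → d q }))
    , (λ p → MA-adjacent Ψ ma (columns k (F ∘ suc) (ν ∘ suc ∘ suc)) λ i →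
        reflexive (≡.cong (λ m → F (suc m) i)
          (≡.trans (ℕₚ.+-suc (ν 0) k) (≡.cong (ℕ._+ k) (ℕₚ.≤-antisym p (step 0))))))
    ]′ (ℕₚ.≤-<-connex (ν 1) (ν 0))

  module _ (F : ℕ → Col) (q : ℕ → C) (G : ℕ → Col) (u : ℕ → C)
           (F0 : ∀ i → F 0 i ≈ 0#)
           (eq : ∀ t i → u i * G t i ≈ F (suc t) i + q (suc t) * F t i) where

    verticalBranch : ∀ k {μ} → Anti μ →
      ∏ᴺ k u * detᶜ (columns k G μ) ≈
      ∑ˡ (λ ν → skewWeight k q μ ν * detᶜ (columns k (F ∘ suc) ν)) (boxes k (pred ∘ μ) μ)
    verticalBranch k {μ} anti = begin
      ∏ᴺ k u * detᶜ (columns k G μ)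
        ≈⟨ detᶜ-scale u (columns k G μ) ⟨
      detᶜ (Vec.map (scale u) (columns k G μ))
        ≈⟨ reflexive (≡.cong detᶜ (columns-scale k u G μ)) ⟨
      detᶜ (columns k (scale u ∘ G) μ)
        ≈⟨ verticalColumns F q (scale u ∘ G) F0 eq k detᶜ (detᶜ-MA k) anti ⟩
      detᶜ (branchColumns k q (F ∘ suc) (pred ∘ μ) μ)
        ≈⟨ expand k detᶜ (detᶜ-MA k) q (F ∘ suc) (pred ∘ μ) μ ⟩
      _ ∎

    -- Each shape dropped by the filter has an ascent, hence two equal columns in its determinant.
    verticalBranch-strips : ∀ k {μ} → Anti μ →
      ∏ᴺ k u * detᶜ (columns k G μ) ≈
      ∑ˡ (λ ν → skewWeight k q μ ν * detᶜ (columns k (F ∘ suc) ν)) (verticalStrips k μ)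
    verticalBranch-strips k {μ} anti = trans (verticalBranch k anti)
      (sym (∑ˡ-filter (descending? k) _ (boxes k (pred ∘ μ) μ) λ ν∈ asc →
        let b = boxes-sound k (λ _ → ℕₚ.pred[n]≤n) ν∈ in
        trans (*-congˡ (columns-ascent k detᶜ (detᶜ-MA k) F (InBox.empty b) (ascent b) asc)) (zeroʳ _)))
      where
      ascent : ∀ {ν} → InBox k (pred ∘ μ) μ ν → ∀ i → ν (suc i) ℕ.≤ suc (ν i)
      ascent {ν} b i with i ℕₚ.<? k
      ... | yes p = ℕₚ.≤-trans (vertical-≤ b (suc i)) (ℕₚ.≤-trans (anti i)
                      (pred≤⇒≤suc (InBox.lower b p)))
      ... | no p  = ≡.subst (ℕ._≤ suc (ν i)) (≡.sym (InBox.empty b (suc i) (ℕₚ.m≤n⇒m≤1+n (ℕₚ.≮⇒≥ p)))) z≤n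

  -- Generating functions of the tableaux

  -- A sum over Gelfand-Tsetlin patterns: `t` successive horizontal strips are removed, each with
  -- the weight of its letter.
  gtSum : (ℕ → ℕ) → (ℕ → ℕ → C) → ℕ → Shape → C
  gtSum rows p zero    μ = 1#
  gtSum rows p (suc t) μ =
    ∑ˡ (λ ν → stripWeight (rows t) (p t) μ ν * gtSum rows p t ν) (strips (rows t) μ)

  ∏ᴺ-cong : ∀ n {f g} → (∀ {i} → i ℕ.< n → f i ≈ g i) → ∏ᴺ n f ≈ ∏ᴺ n g
  ∏ᴺ-cong zero    eq = refl
  ∏ᴺ-cong (suc n) eq = *-cong (eq (s≤s z≤n)) (∏ᴺ-cong n (λ p → eq (s≤s p)))

  ∏ᴺ-* : ∀ n f g → ∏ᴺ n (λ i → f i * g i) ≈ ∏ᴺ n f * ∏ᴺ n g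
  ∏ᴺ-* zero    f g = sym (*-identityˡ _)
  ∏ᴺ-* (suc n) f g = trans (*-congˡ (∏ᴺ-* n (f ∘ suc) (g ∘ suc)))
    (interchange *-commutativeSemigroup _ _ _ _)

  ∏ᴺ-1 : ∀ n {f} → (∀ i → f i ≈ 1#) → ∏ᴺ n f ≈ 1#
  ∏ᴺ-1 zero    eq = refl
  ∏ᴺ-1 (suc n) eq = trans (*-cong (eq 0) (∏ᴺ-1 n (eq ∘ suc))) (*-identityˡ _)

  ∏ᴺ-support : ∀ m n {f} → (∀ i → m ℕ.≤ i → f i ≈ 1#) → (∀ i → n ℕ.≤ i → f i ≈ 1#) →
               ∏ᴺ m f ≈ ∏ᴺ n f
  ∏ᴺ-support zero    n       em en = sym (∏ᴺ-1 n (λ i → em i z≤n))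
  ∏ᴺ-support (suc m) zero    em en = ∏ᴺ-1 (suc m) (λ i → en i z≤n)
  ∏ᴺ-support (suc m) (suc n) em en =
    *-congˡ (∏ᴺ-support m n (λ i p → em (suc i) (s≤s p)) (λ i p → en (suc i) (s≤s p)))

  module Weights (n : ℕ) (W : ℕ → ℕ → ℕ → C) where

    weight : Shape → Fill → C
    weight μ U = ∏ᴺ n (λ i → segment (λ j → W (U i j) i j) 0 (μ i))

    skew : ℕ → Shape → Shape → C
    skew t μ ν = ∏ᴺ n (λ i → segment (W t i) (ν i) (μ i ∸ ν i))

    weight-ext : ∀ {t μ ν} U → (∀ i → ν i ℕ.≤ μ i) → weight μ (ext ν t U) ≈ skew t μ ν * weight ν U
    weight-ext {t} {μ} {ν} U ν≤μ = begin
      weight μ (ext ν t U)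
        ≈⟨ ∏ᴺ-cong n (λ {i} _ → begin
             segment (w i) 0 (μ i)
               ≈⟨ reflexive (≡.cong (segment (w i) 0) (≡.sym (ℕₚ.m+[n∸m]≡n (ν≤μ i)))) ⟩
             segment (w i) 0 (ν i ℕ.+ (μ i ∸ ν i))
               ≈⟨ segment-+ (w i) 0 (ν i) (μ i ∸ ν i) ⟩
             segment (w i) 0 (ν i) * segment (w i) (ν i) (μ i ∸ ν i)
               ≈⟨ *-cong
                    (segment-cong 0 (ν i) (λ j _ p → reflexive (≡.cong (λ l → W l i j) (ext-old {ν} {t} {U} p))))
                    (segment-cong (ν i) (μ i ∸ ν i) (λ j p _ → reflexive (≡.cong (λ l → W l i j) (ext-new {ν} {t} {U} p)))) ⟩
             segment (λ j → W (U i j) i j) 0 (ν i) * segment (W t i) (ν i) (μ i ∸ ν i)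
               ≈⟨ *-comm _ _ ⟩
             segment (W t i) (ν i) (μ i ∸ ν i) * segment (λ j → W (U i j) i j) 0 (ν i) ∎) ⟩
      ∏ᴺ n (λ i → segment (W t i) (ν i) (μ i ∸ ν i) * segment (λ j → W (U i j) i j) 0 (ν i))
        ≈⟨ ∏ᴺ-* n _ _ ⟩
      skew t μ ν * weight ν U ∎
      where
      w : ℕ → ℕ → C
      w i j = W (ext ν t U i j) i j

    ∑-layers : ∀ {t μ} N R → (∀ {ν} → ν ∈ N → ∀ i → ν i ℕ.≤ μ i) →
               ∑ˡ (weight μ) (layers N t R) ≈ ∑ˡ (λ ν → skew t μ ν * ∑ˡ (weight ν) (R ν)) N
    ∑-layers {t} {μ} N R N≤μ = trans (∑ˡ-concatMap (weight μ) (λ ν → map (ext ν t) (R ν)) N)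
      (∑ˡ-cong N λ {ν} ν∈ → begin
        ∑ˡ (weight μ) (map (ext ν t) (R ν))
          ≈⟨ reflexive (∑ˡ-map (weight μ) (ext ν t) (R ν)) ⟩
        ∑ˡ (λ U → weight μ (ext ν t U)) (R ν)
          ≈⟨ ∑ˡ-cong (R ν) (λ {U} _ → weight-ext U (N≤μ ν∈)) ⟩
        ∑ˡ (λ U → skew t μ ν * weight ν U) (R ν)
          ≈⟨ ∑ˡ-*ˡ (skew t μ ν) (weight ν) (R ν) ⟩
        skew t μ ν * ∑ˡ (weight ν) (R ν) ∎)

  -- In row `i` from the top, `skewWeight` has `e = k - 1 - i`. Its offset `2 + e` is therefore
  -- `suc k ∸ i`, and `p` is evaluated at the content `j - i` plus `k + 1`.
  ∏-skewWeight : ∀ k {V : ℕ → ℕ → C} {p} μ ν → (∀ {i} → i ℕ.< k → ∀ j → V i j ≈ p (j ℕ.+ (suc k ∸ i))) →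
                 ∏ᴺ k (λ i → segment (V i) (ν i) (μ i ∸ ν i)) ≈ skewWeight k p μ ν
  ∏-skewWeight zero    μ ν eq = refl
  ∏-skewWeight (suc k) μ ν eq = *-cong
    (segment-cong (ν 0) (μ 0 ∸ ν 0) (λ j _ _ → eq (s≤s z≤n) j))
    (∏-skewWeight k (μ ∘ suc) (ν ∘ suc) (λ p → eq (s≤s p)))

  ∏-stripWeight : ∀ k {V : ℕ → ℕ → C} {p} μ ν → ν k ≡ 0 →
                  (∀ {i} → i ℕ.≤ k → ∀ j → V i j ≈ p (j ℕ.+ (suc k ∸ i))) →
                  ∏ᴺ (suc k) (λ i → segment (V i) (ν i) (μ i ∸ ν i)) ≈ stripWeight k p μ ν
  ∏-stripWeight zero {V} {p} μ ν ν≡0 eq =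
    *-congʳ (trans (reflexive (≡.cong₂ (segment (V 0)) ν≡0 (≡.cong (μ 0 ∸_) ν≡0)))
                   (segment-cong 0 (μ 0) (λ j _ _ → eq z≤n j)))
  ∏-stripWeight (suc k) {V} {p} μ ν ν≡0 eq =
    trans (*-cong (segment-cong (ν 0) (μ 0 ∸ ν 0) (λ j _ _ → eq z≤n j))
                  (∏-stripWeight k (μ ∘ suc) (ν ∘ suc) ν≡0 (λ p → eq (s≤s p))))
      (solve 3 (λ a b c → a :* (b :* c) := b :* (a :* c)) refl _ _ _)

  module TableauWeights (rows : ℕ → ℕ) (rows-0 : rows 0 ≡ 0)
                        (rows-mono : ∀ t → rows t ℕ.≤ rows (suc t))
                        (rows-step : ∀ t → rows (suc t) ℕ.≤ suc (rows t))
                        (p : ℕ → ℕ → C) (n : ℕ) (W : ℕ → ℕ → ℕ → C) where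

    open Tableaux rows rows-0 rows-mono rows-step
    open Weights n W

    Agrees : (ℕ → C) → ℕ → Set ℓ
    Agrees q t = ∀ {i} → i ℕ.≤ rows t → ∀ j → W t i j ≈ q (j ℕ.+ (suc (rows t) ∸ i))

    ∑-tableaux : ∀ t → (∀ {s} → s ℕ.< t → Agrees (p s) s) → rows t ℕ.≤ n → ∀ {μ} → Anti μ → Rows (rows t) μ →
                 ∑ˡ (weight μ) (tableaux t μ) ≈ gtSum rows p t μ
    ∑-tableaux zero    eq r≤n {μ} anti rowsμ = trans (+-identityʳ _) (∏ᴺ-1 n λ i →
      reflexive (≡.cong (segment _ 0) (rowsμ i (≡.subst (ℕ._≤ i) (≡.sym rows-0) z≤n))))
    ∑-tableaux (suc t) eq r≤n {μ} anti rowsμ = trans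
      (∑-layers (strips (rows t) μ) (tableaux t) (λ ν∈ → strip-≤ (∈-strips⁻ (rows t) anti ν∈)))
      (∑ˡ-cong (strips (rows t) μ) λ {ν} ν∈ →
        let b = ∈-strips⁻ (rows t) anti ν∈ in
        *-cong (skew≈ b)
          (∑-tableaux t (λ s<t → eq (ℕₚ.m<n⇒m<1+n s<t)) (ℕₚ.≤-trans (rows-mono t) r≤n)
                      (strip-anti b) (InBox.empty b)))
      where
      empty-row : ∀ {ν i} → InBox (rows t) (μ ∘ suc) μ ν → μ i ≡ 0 →
                  segment (W t i) (ν i) (μ i ∸ ν i) ≈ 1#
      empty-row {ν} {i} b e = reflexive (≡.cong (segment (W t i) (ν i))
        (≡.trans (≡.cong (_∸ ν i) e) (ℕₚ.0∸n≡0 (ν i))))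
      skew≈ : ∀ {ν} → InBox (rows t) (μ ∘ suc) μ ν → skew t μ ν ≈ stripWeight (rows t) (p t) μ ν
      skew≈ {ν} b = trans
        -- Neither number of rows bounds the other: `suc (rows t)` is `n + 1` when `rows t` is `n`.
        -- Beyond either bound `μ` has no boxes.
        (∏ᴺ-support n (suc (rows t))
          (λ i n≤i → empty-row b (rowsμ i (ℕₚ.≤-trans r≤n n≤i)))
          (λ i r<i → empty-row b (rowsμ i (ℕₚ.≤-trans (rows-step t) r<i))))
        (∏-stripWeight (rows t) μ ν (InBox.empty b (rows t) ℕₚ.≤-refl) (eq ℕₚ.≤-refl))

    ∑-soTableaux : ∀ t {q} → (∀ {s} → s ℕ.< t → Agrees (p s) s) → Agrees q t → rows t ≡ n →
      ∀ {μ} → Anti μ →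
      ∑ˡ (weight μ) (soTableaux t μ) ≈
      ∑ˡ (λ ν → skewWeight n q μ ν * gtSum rows p t ν) (verticalStrips n μ)
    ∑-soTableaux t {q} eq eqt ≡.refl {μ} anti = trans
      (∑-layers (verticalStrips n μ) (tableaux t) (λ ν∈ → vertical-≤ (proj₁ (∈-vertical⁻ n ν∈))))
      (∑ˡ-cong (verticalStrips n μ) λ {ν} ν∈ →
        let b , antiν = ∈-vertical⁻ n ν∈ in
        *-cong (∏-skewWeight n μ ν (λ i<n → eqt (ℕₚ.<⇒≤ i<n)))
          (∑-tableaux t eq ℕₚ.≤-refl antiν (InBox.empty b)))

  -- Empty shapes

  boxes-empty : ∀ k {lo μ} → (∀ i → lo i ≡ 0) → (∀ i → μ i ≡ 0) →
                ∃ λ ν → boxes k lo μ ≡ [ ν ] × (∀ i → ν i ≡ 0)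
  boxes-empty zero    lo0 μ0 = (λ _ → 0) , ≡.refl , λ _ → ≡.refl
  boxes-empty (suc k) {lo} {μ} lo0 μ0 rewrite lo0 0 | μ0 0 =
    let ν , eq , ν0 = boxes-empty k (lo0 ∘ suc) (μ0 ∘ suc) in
    cons 0 ν , ≡.cong (λ νs → map (cons 0) νs ++ []) eq , λ { zero → ≡.refl ; (suc i) → ν0 i }

  skewWeight-empty : ∀ k p {μ} ν → (∀ i → μ i ≡ 0) → skewWeight k p μ ν ≈ 1#
  skewWeight-empty zero    p ν μ0 = refl
  skewWeight-empty (suc k) p {μ} ν μ0 =
    trans (*-cong (reflexive (≡.cong (segment _ (ν 0)) (≡.trans (≡.cong (_∸ ν 0) (μ0 0)) (ℕₚ.0∸n≡0 (ν 0)))))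
                  (skewWeight-empty k p (ν ∘ suc) (μ0 ∘ suc)))
          (*-identityˡ 1#)

  -- This value turns a formula for numerators into one for denominators.
  gtSum-empty : ∀ rows p t {μ} → (∀ i → μ i ≡ 0) → gtSum rows p t μ ≈ 1#
  gtSum-empty rows p zero    μ0 = refl
  gtSum-empty rows p (suc t) {μ} μ0 with boxes-empty (rows t) (μ0 ∘ suc) μ0
  ... | ν , eq , ν0 = begin
    ∑ˡ (λ ν → stripWeight (rows t) (p t) μ ν * gtSum rows p t ν) (strips (rows t) μ)
      ≈⟨ reflexive (≡.cong (∑ˡ _) eq) ⟩
    stripWeight (rows t) (p t) μ ν * gtSum rows p t ν + 0#
      ≈⟨ +-identityʳ _ ⟩
    stripWeight (rows t) (p t) μ ν * gtSum rows p t ν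
      ≈⟨ *-cong (*-cong (reflexive (≡.cong (segment _ 0) (μ0 (rows t)))) (skewWeight-empty (rows t) (p t) ν μ0))
                (gtSum-empty rows p t ν0) ⟩
    1# * 1# * 1#
      ≈⟨ trans (*-congʳ (*-identityˡ 1#)) (*-identityˡ 1#) ⟩
    1# ∎

  -- Factorial numerators

  fpower : (ℕ → C) → C → ℕ → C
  fpower a z zero    = 1#
  fpower a z (suc m) = fpower a z m * (z + a (suc m))

  ∑ˡ-factor : ∀ {A : Set} {r} {α β γ : A → C} xs → (∀ {x} → x ∈ xs → β x ≈ r * γ x) →
              ∑ˡ (λ x → α x * β x) xs ≈ r * ∑ˡ (λ x → α x * γ x) xs
  ∑ˡ-factor {r = r} {α} {β} {γ} xs eq = trans
    (∑ˡ-cong xs (λ {x} x∈ → trans (*-congˡ (eq x∈))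
      (solve 3 (λ a r g → a :* (r :* g) := r :* (a :* g)) refl (α x) r (γ x))))
    (∑ˡ-*ˡ r _ xs)

  -- Add and subtract `y * P`. The coefficient `y + c` becomes the weight of the letter being
  -- removed.
  shift-factor : ∀ X y c P → P * (X + c) ≈ (X - y) * P + (y + c) * P
  shift-factor X y c P = sym (begin
    (X - y) * P + (y + c) * P    ≈⟨ solve 5 (λ X y m c P → (X :+ m) :* P :+ (y :+ c) :* P := P :* (X :+ c) :+ P :* (m :+ y)) refl X y (- y) c P ⟩
    P * (X + c) + P * (- y + y)  ≈⟨ +-congˡ (trans (*-congˡ (-‿inverseˡ y)) (zeroʳ P)) ⟩
    P * (X + c) + 0#             ≈⟨ +-identityʳ _ ⟩
    P * (X + c)                  ∎)

  module SchurNumerator (x : ℕ → C) (a : ℕ → C) where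

    vandermonde : ℕ → C
    vandermonde zero    = 1#
    vandermonde (suc k) = ∏ᴺ k (λ i → x i - x k) * vandermonde k

    numerator : ℕ → Col
    numerator t i = fpower a (x i) t

    rows : ℕ → ℕ
    rows t = t

    p : ℕ → ℕ → C
    p t s = x t + a s

    numerator-gtSum : ∀ k {μ} → Anti μ →
      detᶜ (columns k numerator μ) ≈ vandermonde k * gtSum rows p k μ
    numerator-gtSum zero    anti = sym (*-identityˡ _)
    numerator-gtSum (suc k) {μ} anti = begin
      detᶜ (columns (suc k) numerator μ)
        ≈⟨ branch (p k) numerator numerator (λ i → x i - x k)
             (λ t i → shift-factor (x i) (x k) (a (suc t)) (numerator t i)) k anti (-‿inverseʳ (x k)) ⟩
      1# * Π * ∑ˡ (λ ν → stripWeight k (p k) μ ν * detᶜ (columns k numerator ν)) (strips k μ)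
        ≈⟨ *-cong (*-identityˡ _) (∑ˡ-factor (strips k μ) (λ ν∈ →
             numerator-gtSum k (strip-anti (∈-strips⁻ k anti ν∈)))) ⟩
      Π * (vandermonde k * gtSum rows p (suc k) μ)
        ≈⟨ *-assoc _ _ _ ⟨
      Π * vandermonde k * gtSum rows p (suc k) μ ∎
      where Π = ∏ᴺ k (λ i → x i - x k)

  -- Assembles data for unbarred and barred letters into one sequence indexed by rank.
  interleave : (ℕ → C) → (ℕ → C) → ℕ → C
  interleave f g zero          = f 0
  interleave f g (suc zero)    = g 0
  interleave f g (suc (suc t)) = interleave (f ∘ suc) (g ∘ suc) t

  interleave-even : ∀ f g k → interleave f g (double k) ≡ f k
  interleave-even f g zero    = ≡.refl
  interleave-even f g (suc k) = interleave-even (f ∘ suc) (g ∘ suc) k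

  interleave-odd : ∀ f g k → interleave f g (suc (double k)) ≡ g k
  interleave-odd f g zero    = ≡.refl
  interleave-odd f g (suc k) = interleave-odd (f ∘ suc) (g ∘ suc) k

  -- The weights of the letters k and k̄ use the sequence c k (k counted from 1);
  -- passing from k + 1 to k letters prepends a zero to it.
  module SymplecticNumerator (n : ℕ) (x x̄ : ℕ → C) (xx̄ : ∀ i → x i * x̄ i ≈ 1#)
    (c : ℕ → ℕ → C)
    (c-shift : ∀ k t → c k (suc (suc t)) ≈ c (suc k) (suc t))
    (c-1 : ∀ {k} → k ℕ.< n → c k 1 ≈ 0#) where

    -- The Weyl denominator of type C up to sign, one variable at a time: `x k - x̄ k` is the entry
    -- `Φ k 0 k` split off with the last row, and the product collects the factors `w` of the other
    -- rows.
    vandermonde : ℕ → C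
    vandermonde zero    = 1#
    vandermonde (suc k) = (x k - x̄ k) * ∏ᴺ k (λ i → (x i + x̄ i) - (x k + x̄ k)) * vandermonde k

    F : ℕ → ℕ → Col
    F k t i = fpower (c k) (x i) t - fpower (c k) (x̄ i) t

    -- Intermediate between F (suc k) and F k: removing k̄ leads to Φ, then k to F k.
    Φ : ℕ → ℕ → Col
    Φ k t i = (x i - x̄ k) * fpower (c (suc k)) (x i) t - (x̄ i - x̄ k) * fpower (c (suc k)) (x̄ i) t

    p : ℕ → ℕ → C
    p t s = interleave (λ k → x k + c (suc k) s) (λ k → x̄ k + c (suc k) s) t

    rows : ℕ → ℕ
    rows t = ℕ.⌈ t /2⌉

    -- The sequence `c k` is a zero followed by `c (suc k)`, so the first factor of the power is `z`
    -- itself.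
    fpower-shift : ∀ {k} → k ℕ.< n → ∀ z t → fpower (c k) z (suc t) ≈ z * fpower (c (suc k)) z t
    fpower-shift {k} k<n z zero    = begin
      1# * (z + c k 1)   ≈⟨ *-congˡ (+-congˡ (c-1 k<n)) ⟩
      1# * (z + 0#)      ≈⟨ solve 1 (λ z → con 1 :* (z :+ con 0) := z :* con 1) refl z ⟩
      z * 1#             ∎
    fpower-shift {k} k<n z (suc t) = begin
      fpower (c k) z (suc t) * (z + c k (suc (suc t)))
        ≈⟨ *-cong (fpower-shift k<n z t) (+-congˡ (c-shift k t)) ⟩
      z * fpower (c (suc k)) z t * (z + c (suc k) (suc t))
        ≈⟨ *-assoc _ _ _ ⟩
      _ ∎

    F-0 : ∀ k i → F k 0 i ≈ 0#
    F-0 k i = -‿inverseʳ 1#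

    F-rec : ∀ k t i → F (suc k) (suc t) i ≈ Φ k t i + (x̄ k + c (suc k) (suc t)) * F (suc k) t i
    F-rec k t i = trans
      (+-cong (shift-factor (x i) (x̄ k) _ _) (-‿cong (shift-factor (x̄ i) (x̄ k) _ _)))
      (-‿linear _ _ _ _ _)

    -- This is `shift-factor` at `y = x k`, multiplied by `X - x̄ k`; the constant terms `X * Y` and
    -- `x k * x̄ k` are both 1 and cancel. The row factor is symmetric in `X` and `Y`, so the two
    -- terms of `Φ` share it.
    quadratic : ∀ k {X Y} c P → X * Y ≈ 1# →
      (X - x̄ k) * (P * (X + c)) ≈
      ((X + Y) - (x k + x̄ k)) * (X * P) + (x k + c) * ((X - x̄ k) * P)
    quadratic k {X} {Y} c P XY≈1 = sym (begin
      ((X + Y) - (y + x̄ k)) * (X * P) + (y + c) * ((X + m) * P)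
        ≈⟨ +-congʳ (*-congʳ (+-congˡ (sym (-‿+-comm y (x̄ k))))) ⟩
      ((X + Y) + (l + m)) * (X * P) + (y + c) * ((X + m) * P)
        ≈⟨ solve 7 (λ X Y l m y c P →
             ((X :+ Y) :+ (l :+ m)) :* (X :* P) :+ (y :+ c) :* ((X :+ m) :* P) :=
             (X :+ m) :* (P :* (X :+ c)) :+ (P :* X :* (l :+ y) :+ P :* (X :* Y :+ y :* m)))
             refl X Y l m y c P ⟩
      (X + m) * (P * (X + c)) + (P * X * (l + y) + P * (X * Y + y * m))
        ≈⟨ +-congˡ (+-cong (*-congˡ (-‿inverseˡ y)) (*-congˡ (begin
             X * Y + y * m         ≈⟨ +-cong XY≈1 (sym (-‿distribʳ-* y (x̄ k))) ⟩
             1# - y * x̄ k          ≈⟨ +-congˡ (-‿cong (xx̄ k)) ⟩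
             1# - 1#               ≈⟨ -‿inverseʳ 1# ⟩
             0#                    ∎))) ⟩
      (X + m) * (P * (X + c)) + (P * X * 0# + P * 0#)
        ≈⟨ +-congˡ (trans (+-cong (zeroʳ _) (zeroʳ _)) (+-identityˡ 0#)) ⟩
      (X + m) * (P * (X + c)) + 0#
        ≈⟨ +-identityʳ _ ⟩
      (X + m) * (P * (X + c)) ∎)
      where
      y = x k
      l = - x k
      m = - x̄ k

    Φ-rec : ∀ {k} → k ℕ.< n → ∀ t i →
      Φ k (suc t) i ≈ ((x i + x̄ i) - (x k + x̄ k)) * F k (suc t) i + (x k + c (suc k) (suc t)) * Φ k t i
    Φ-rec {k} k<n t i = begin
      Φ k (suc t) i
        ≈⟨ +-cong (quadratic k _ P (xx̄ i)) (-‿cong (quadratic k _ Q (trans (*-comm _ _) (xx̄ i)))) ⟩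
      (w * (x i * P) + r * ((x i - x̄ k) * P)) - (((x̄ i + x i) - (x k + x̄ k)) * (x̄ i * Q) + r * ((x̄ i - x̄ k) * Q))
        ≈⟨ -‿linear _ _ r _ _ ⟩
      (w * (x i * P) - ((x̄ i + x i) - (x k + x̄ k)) * (x̄ i * Q)) + r * Φ k t i
        ≈⟨ +-congʳ (+-congˡ (-‿cong (*-congʳ (+-congʳ (+-comm _ _))))) ⟩
      (w * (x i * P) - w * (x̄ i * Q)) + r * Φ k t i
        ≈⟨ +-congʳ (trans (+-congˡ (-‿distribʳ-* _ _)) (sym (distribˡ w _ _))) ⟩
      w * (x i * P - x̄ i * Q) + r * Φ k t i
        ≈⟨ +-congʳ (*-congˡ (+-cong (fpower-shift k<n (x i) t) (-‿cong (fpower-shift k<n (x̄ i) t)))) ⟨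
      w * F k (suc t) i + r * Φ k t i ∎
      where
      P = fpower (c (suc k)) (x i) t
      Q = fpower (c (suc k)) (x̄ i) t
      w = (x i + x̄ i) - (x k + x̄ k)
      r = x k + c (suc k) (suc t)

    -- Each induction step removes two letters: k̄ by `branch₀`, which keeps all `suc k` rows, then
    -- k by `branch`, which splits off the last row and produces the new factor of `vandermonde`.
    numerator-gtSum : ∀ k → k ℕ.≤ n → ∀ {μ} → Anti μ → Rows k μ →
      detᶜ (columns k (F k ∘ suc) μ) ≈ vandermonde k * gtSum rows p (double k) μ
    numerator-gtSum zero    k≤n anti rowsμ = sym (*-identityˡ _)
    numerator-gtSum (suc k) k<n {μ} anti rowsμ = begin
      detᶜ (columns (suc k) (F (suc k) ∘ suc) μ)
        ≈⟨ Recurrence.branch₀ (λ s → x̄ k + c (suc k) s) (F (suc k)) (Φ k) (F-rec k)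
             (F-0 (suc k)) (suc k) anti (rowsμ (suc k) ℕₚ.≤-refl) ⟩
      ∑ˡ (λ ν → skewWeight (suc k) p₁ μ ν * detᶜ (columns (suc k) (Φ k) ν)) (strips (suc k) μ)
        ≈⟨ ∑ˡ-factor (strips (suc k) μ) (λ {ν} ν∈ → step (strip-anti (∈-strips⁻ (suc k) anti ν∈))) ⟩
      V * ∑ˡ (λ ν → skewWeight (suc k) p₁ μ ν * gtSum rows p (suc (double k)) ν) (strips (suc k) μ)
        -- The extra factor of `stripWeight` belongs to row `suc k`, which is empty here.
        ≈⟨ *-congˡ (∑ˡ-cong (strips (suc k) μ) (λ {ν} _ → *-congʳ (sym
             (trans (*-congʳ (reflexive (≡.cong (segment _ 0) (rowsμ (suc k) ℕₚ.≤-refl)))) (*-identityˡ _))))) ⟩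
      V * S (suc k) p₁
        ≈⟨ *-congˡ (trans
             (reflexive (≡.cong (λ r → S r p₁) (≡.sym (⌈1+double/2⌉ k))))
             (∑ˡ-cong (strips ℕ.⌈ suc (double k) /2⌉ μ) (λ {ν} _ →
               *-congʳ (stripWeight-cong ℕ.⌈ suc (double k) /2⌉ μ ν λ s →
                 reflexive (≡.sym (interleave-odd _ _ k)))))) ⟩
      V * gtSum rows p (double (suc k)) μ ∎
      where
      V = vandermonde (suc k)
      p₀ p₁ : ℕ → C
      p₀ s = x k + c (suc k) s
      p₁ s = x̄ k + c (suc k) s
      S : ℕ → (ℕ → C) → C
      S r q = ∑ˡ (λ ν → stripWeight r q μ ν * gtSum rows p (suc (double k)) ν) (strips r μ)
      Π = ∏ᴺ k (λ i → (x i + x̄ i) - (x k + x̄ k))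
      Φ-0 : Φ k 0 k ≈ x k - x̄ k
      Φ-0 = begin
        (x k - x̄ k) * 1# - (x̄ k - x̄ k) * 1#  ≈⟨ +-cong (*-identityʳ _) (-‿cong (trans (*-identityʳ _) (-‿inverseʳ _))) ⟩
        (x k - x̄ k) - 0#                     ≈⟨ x-0≈x _ ⟩
        x k - x̄ k                            ∎
      step : ∀ {ν} → Anti ν → detᶜ (columns (suc k) (Φ k) ν) ≈ V * gtSum rows p (suc (double k)) ν
      step {ν} antiν = begin
        detᶜ (columns (suc k) (Φ k) ν)
          ≈⟨ branch p₀ (Φ k) (F k ∘ suc) (λ i → (x i + x̄ i) - (x k + x̄ k)) (Φ-rec k<n) k antiν (-‿inverseʳ _) ⟩
        Φ k 0 k * Π * ∑ˡ (λ κ → stripWeight k p₀ ν κ * detᶜ (columns k (F k ∘ suc) κ)) (strips k ν)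
          ≈⟨ *-cong (*-congʳ Φ-0) (∑ˡ-factor (strips k ν) (λ κ∈ →
               let b = ∈-strips⁻ k antiν κ∈ in
               numerator-gtSum k (ℕₚ.<⇒≤ k<n) (strip-anti b) (InBox.empty b))) ⟩
        (x k - x̄ k) * Π * (vandermonde k * S′ k p₀)
          ≈⟨ *-assoc _ _ _ ⟨
        V * S′ k p₀
          ≈⟨ *-congˡ (trans
               (reflexive (≡.cong (λ r → S′ r p₀) (≡.sym (⌈double/2⌉ k))))
               (∑ˡ-cong (strips ℕ.⌈ double k /2⌉ ν) (λ {κ} _ →
                 *-congʳ (stripWeight-cong ℕ.⌈ double k /2⌉ ν κ λ s →
                   reflexive (≡.sym (interleave-even _ _ k)))))) ⟩
        V * gtSum rows p (suc (double k)) ν ∎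
        where
        S′ : ℕ → (ℕ → C) → C
        S′ r q = ∑ˡ (λ κ → stripWeight r q ν κ * gtSum rows p (double k) κ) (strips r ν)

    module Orthogonal (s s̄ : ℕ → C) (ss : ∀ i → s i * s i ≈ x i) (s̄s̄ : ∀ i → s̄ i * s̄ i ≈ x̄ i)
                      (ss̄ : ∀ i → s i * s̄ i ≈ 1#) where

      G : ℕ → Col
      G t i = s i * fpower (c n) (x i) t - s̄ i * fpower (c n) (x̄ i) t

      u : ℕ → C
      u i = s i + s̄ i

      q : ℕ → C
      q t = 1# - c n t

      -- (σ + τ) σ = X + 1 = (X + c) + (1 - c)
      half : ∀ {σ τ X} c P → σ * σ ≈ X → σ * τ ≈ 1# → (σ + τ) * (σ * P) ≈ P * (X + c) + (1# - c) * P
      half {σ} {τ} {X} c P σσ στ = sym (begin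
        P * (X + c) + (1# - c) * P
          ≈⟨ solve 4 (λ P X c m → P :* (X :+ c) :+ (con 1 :+ m) :* P := (X :+ con 1) :* P :+ P :* (c :+ m)) refl P X c (- c) ⟩
        (X + 1#) * P + P * (c - c)
          ≈⟨ +-cong (*-congʳ (+-cong (sym σσ) (sym στ))) (trans (*-congˡ (-‿inverseʳ c)) (zeroʳ P)) ⟩
        (σ * σ + σ * τ) * P + 0#
          ≈⟨ solve 3 (λ σ τ P → (σ :* σ :+ σ :* τ) :* P :+ con 0 := (σ :+ τ) :* (σ :* P)) refl σ τ P ⟩
        (σ + τ) * (σ * P) ∎)

      G-F : ∀ t i → u i * G t i ≈ F n (suc t) i + q (suc t) * F n t i
      G-F t i = begin
        u i * (s i * P - s̄ i * Q)
          ≈⟨ trans (distribˡ _ _ _) (+-congˡ (sym (-‿distribʳ-* _ _))) ⟩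
        u i * (s i * P) - u i * (s̄ i * Q)
          ≈⟨ +-cong (half _ P (ss i) (ss̄ i))
               (-‿cong (trans (*-congʳ (+-comm _ _)) (half _ Q (s̄s̄ i) (trans (*-comm _ _) (ss̄ i))))) ⟩
        (P * (x i + c n (suc t)) + q (suc t) * P) - (Q * (x̄ i + c n (suc t)) + q (suc t) * Q)
          ≈⟨ -‿linear _ _ _ _ _ ⟩
        F n (suc t) i + q (suc t) * F n t i ∎
        where
        P = fpower (c n) (x i) t
        Q = fpower (c n) (x̄ i) t

      -- The row factors `u` remain on the left; the denominator carries the same product, and it
      -- cancels in the quotient.
      orthogonal-gtSum : ∀ {μ} → Anti μ →
        ∏ᴺ n u * detᶜ (columns n G μ) ≈
        vandermonde n * ∑ˡ (λ ν → skewWeight n q μ ν * gtSum rows p (double n) ν) (verticalStrips n μ)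
      orthogonal-gtSum {μ} anti = trans (verticalBranch-strips (F n) q G u (F-0 n) G-F n anti)
        (∑ˡ-factor (verticalStrips n μ) (λ ν∈ →
          let b , antiν = ∈-vertical⁻ n ν∈ in numerator-gtSum n ℕₚ.≤-refl antiν (InBox.empty b)))

      orthogonal-empty : ∀ {μ} → (∀ i → μ i ≡ 0) → ∏ᴺ n u * detᶜ (columns n G μ) ≈ vandermonde n
      orthogonal-empty {μ} μ0 with boxes-empty n {pred ∘ μ} {μ} (λ i → ≡.cong pred (μ0 i)) μ0
      ... | ν , eq , ν0 = begin
        ∏ᴺ n u * detᶜ (columns n G μ)
          ≈⟨ verticalBranch (F n) q G u (F-0 n) G-F n (λ i → ≡.subst (ℕ._≤ μ i) (≡.sym (μ0 (suc i))) z≤n) ⟩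
        ∑ˡ (λ ν → skewWeight n q μ ν * detᶜ (columns n (F n ∘ suc) ν)) (boxes n (pred ∘ μ) μ)
          ≈⟨ reflexive (≡.cong (∑ˡ _) eq) ⟩
        skewWeight n q μ ν * detᶜ (columns n (F n ∘ suc) ν) + 0#
          ≈⟨ +-identityʳ _ ⟩
        skewWeight n q μ ν * detᶜ (columns n (F n ∘ suc) ν)
          ≈⟨ *-cong (skewWeight-empty n q ν μ0)
               (numerator-gtSum n ℕₚ.≤-refl (λ i → ≡.subst (ℕ._≤ ν i) (≡.sym (ν0 (suc i))) z≤n) (λ i _ → ν0 i)) ⟩
        1# * (vandermonde n * gtSum rows p (double n) ν)
          ≈⟨ trans (*-identityˡ _) (trans (*-congˡ (gtSum-empty rows p (double n) ν0)) (*-identityʳ _)) ⟩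
        vandermonde n ∎

-- Tableaux of letters compared with tableaux of ranks.

module LetterTableaux where

  open RankTableaux
  open import Data.Fin.Base as Fin using (Fin; zero; suc; toℕ; fromℕ<)
  open import Data.Fin.Properties using (∀-cons; toℕ<n; toℕ-injective; toℕ-fromℕ<)
  open import Data.List.Base using (List; []; _∷_; map; allFin)
  open import Data.List.Membership.Propositional using (_∈_)
  open import Data.List.Membership.Propositional.Properties using (∈-allFin; ∈-concatMap⁺; ∈-map⁺; ∈-++⁺ˡ; ∈-++⁺ʳ; ∈-map⁻)
  import Data.List.Membership.Setoid as Mem
  import Data.List.Membership.Setoid.Properties as Memₚ
  open import Data.List.Membership.Propositional using (lose)
  open import Data.List.Relation.Binary.Permutation.Setoid as Perm using ()
  import Data.List.Relation.Binary.Permutation.Setoid.Properties as Permₚ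
  open import Data.List.Relation.Unary.All as All using (All; []; _∷_)
  import Data.List.Relation.Unary.All.Properties as Allₚ
  open import Data.List.Relation.Unary.AllPairs as AllPairs using ([]; _∷_)
  import Data.List.Relation.Unary.AllPairs.Properties as AllPairsₚ
  open import Data.List.Relation.Unary.Any as Any using (here; there)
  open import Data.List.Relation.Unary.Unique.Propositional using (Unique)
  import Data.List.Relation.Unary.Unique.Propositional.Properties as UniqueP
  import Data.List.Relation.Unary.Unique.Setoid as Uniq
  import Data.List.Relation.Unary.Unique.Setoid.Properties as Uniqₚ
  open import Data.Nat.Base
  open import Data.Nat.Properties
  open import Data.Product.Base using (∃; _×_; _,_)
  open import Data.Sum.Base using (_⊎_; inj₁; inj₂)
  open import Function.Base using (_∘_; case_of_)
  open import Level using (0ℓ)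
  open import Relation.Binary.Bundles using (Setoid)
  open import Relation.Binary.Definitions using (tri<; tri≈; tri>)
  open import Relation.Binary.PropositionalEquality
    using (_≡_; _≢_; refl; sym; trans; cong; cong₂; subst; subst₂; setoid)
  open import Relation.Nullary using (¬_; contradiction)

  module _ {a ℓ} (S : Setoid a ℓ) where
    open Setoid S using (_≈_) renaming (sym to ≈-sym; trans to ≈-trans; refl to ≈-refl)
    open Mem S using () renaming (_∈_ to _∈ˢ_)
    open Perm S using (_↭_; ↭-refl; ↭-prep; ↭-swap; ↭-trans; ↭-sym)

    ∈⇒↭ : ∀ {x ys} (p : x ∈ˢ ys) → ys ↭ x ∷ (ys Any.─ p)
    ∈⇒↭ (here x≈y) = Perm.prep (≈-sym x≈y) ↭-refl
    ∈⇒↭ (there p)  = ↭-trans (↭-prep _ (∈⇒↭ p)) (↭-swap _ _ ↭-refl)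

    -- The head of `xs` is deleted where it occurs in `ys`; since neither list repeats it, the
    -- remaining lists again have the same elements.
    unique⇒↭ : ∀ {xs ys} → Uniq.Unique S xs → Uniq.Unique S ys →
               (∀ {z} → z ∈ˢ xs → z ∈ˢ ys) → (∀ {z} → z ∈ˢ ys → z ∈ˢ xs) → xs ↭ ys
    unique⇒↭ {[]}     {[]}     _  _  _ _ = ↭-refl
    unique⇒↭ {[]}     {y ∷ ys} _  _  _ g = contradiction (g (here ≈-refl)) λ ()
    unique⇒↭ {x ∷ xs} {ys} (x∉xs ∷ xs!) ys! f g =
      ↭-trans (↭-prep x (unique⇒↭ xs! (AllPairs.tail rest!) to from)) (↭-sym ys↭)
      where
      x∈ys = f (here ≈-refl)
      ys↭  = ∈⇒↭ x∈ys
      rest! = Permₚ.Unique-resp-↭ S ys↭ ys!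
      not-x : ∀ {z zs} → All (λ y → ¬ x ≈ y) zs → z ∈ˢ zs → ¬ z ≈ x
      not-x (x≉y ∷ _)  (here z≈y) z≈x = x≉y (≈-trans (≈-sym z≈x) z≈y)
      not-x (_ ∷ x∉ys) (there z∈) z≈x = not-x x∉ys z∈ z≈x
      to : ∀ {z} → z ∈ˢ xs → z ∈ˢ (ys Any.─ x∈ys)
      to z∈xs with Permₚ.∈-resp-↭ S ys↭ (f (there z∈xs))
      ... | here z≈x = contradiction z≈x (not-x x∉xs z∈xs)
      ... | there z∈ = z∈
      from : ∀ {z} → z ∈ˢ (ys Any.─ x∈ys) → z ∈ˢ xs
      from z∈ with g (Permₚ.∈-resp-↭ S (↭-sym ys↭) (there z∈))
      ... | here z≈x   = contradiction z≈x (not-x (AllPairs.head rest!) z∈)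
      ... | there z∈xs = z∈xs

  ΠSetoid : ∀ {n} → (Fin n → Setoid 0ℓ 0ℓ) → Setoid 0ℓ 0ℓ
  ΠSetoid S = record
    { Carrier       = ∀ i → Setoid.Carrier (S i)
    ; _≈_           = λ f g → ∀ i → Setoid._≈_ (S i) (f i) (g i)
    ; isEquivalence = record
      { refl  = λ i → Setoid.refl (S i)
      ; sym   = λ e i → Setoid.sym (S i) (e i)
      ; trans = λ e e′ i → Setoid.trans (S i) (e i) (e′ i)
      }
    }

  functions-unique : ∀ {n} (S : Fin n → Setoid 0ℓ 0ℓ) L → (∀ i → Uniq.Unique (S i) (L i)) →
                     Uniq.Unique (ΠSetoid S) (functions L)
  functions-unique {zero}  S L L! = [] ∷ []
  functions-unique {suc n} S L L! =
    Uniqₚ.cartesianProductWith⁺ (S zero) (ΠSetoid (S ∘ suc)) (ΠSetoid S) ∀-cons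
      (λ e → e zero , e ∘ suc) (L! zero) (functions-unique (S ∘ suc) (λ i → L (suc i)) (λ i → L! (suc i)))

  functions-complete : ∀ {n} (S : Fin n → Setoid 0ℓ 0ℓ) L f → (∀ i → Mem._∈_ (S i) (f i) (L i)) →
                       Mem._∈_ (ΠSetoid S) f (functions L)
  functions-complete {zero}  S L f f∈ = here λ ()
  functions-complete {suc n} S L f f∈ =
    Memₚ.∈-resp-≈ (ΠSetoid S) (λ { zero → Setoid.refl (S zero) ; (suc i) → Setoid.refl (S (suc i)) })
      (Memₚ.∈-cartesianProductWith⁺ (S zero) (ΠSetoid (S ∘ suc)) (ΠSetoid S)
        (λ e e′ → λ { zero → e ; (suc i) → e′ i })
        (f∈ zero) (functions-complete (S ∘ suc) (λ i → L (suc i)) (λ i → f (suc i)) (λ i → f∈ (suc i))))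

  fillingSetoid : ∀ {n} → (Fin n → ℕ) → Set → Setoid 0ℓ 0ℓ
  fillingSetoid μ A = ΠSetoid (λ i → ΠSetoid {μ i} (λ _ → setoid A))

  fillings-unique : ∀ {n} (μ : Fin n → ℕ) {A : Set} {L : List A} → Unique L →
                    Uniq.Unique (fillingSetoid μ A) (fillings μ L)
  fillings-unique μ {A} {L} L! = functions-unique (λ i → ΠSetoid {μ i} (λ _ → setoid A)) (λ i → functions (λ _ → L))
    (λ i → functions-unique (λ _ → setoid A) (λ _ → L) (λ _ → L!))

  fillings-complete : ∀ {n} (μ : Fin n → ℕ) {A : Set} {L : List A} → (∀ x → x ∈ L) →
                      ∀ T → Mem._∈_ (fillingSetoid μ A) T (fillings μ L)
  fillings-complete μ {A} {L} ∈L T = functions-complete (λ i → ΠSetoid {μ i} (λ _ → setoid A)) (λ i → functions (λ _ → L)) T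
    (λ i → functions-complete (λ _ → setoid A) (λ _ → L) (T i) (λ j → ∈L (T i j)))

  -- Finite families and fillings extended to all of ℕ.

  pad : ∀ {a} {A : Set a} {n} → A → (Fin n → A) → ℕ → A
  pad {n = zero}  d f i       = d
  pad {n = suc n} d f zero    = f zero
  pad {n = suc n} d f (suc i) = pad d (λ i → f (suc i)) i

  pad-toℕ : ∀ {a} {A : Set a} {n} (d : A) (f : Fin n → A) i → pad d f (toℕ i) ≡ f i
  pad-toℕ d f zero    = refl
  pad-toℕ d f (suc i) = pad-toℕ d (λ i → f (suc i)) i

  pad-outside : ∀ {a} {A : Set a} {n} (d : A) (f : Fin n → A) i → n ≤ i → pad d f i ≡ d
  pad-outside {n = zero}  d f i       _       = refl
  pad-outside {n = suc n} d f (suc i) (s≤s p) = pad-outside d (λ i → f (suc i)) i p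

  pad-zip : ∀ {a b r} {A : Set a} {B : Set b} (R : A → B → Set r) {n d e} {f : Fin n → A} {g : Fin n → B} →
            R d e → (∀ i → R (f i) (g i)) → ∀ i → R (pad d f i) (pad e g i)
  pad-zip R {zero}  r rs i       = r
  pad-zip R {suc n} r rs zero    = rs zero
  pad-zip R {suc n} r rs (suc i) = pad-zip R r (λ i → rs (suc i)) i

  shape : ∀ {n} → (Fin n → ℕ) → Shape
  shape = pad 0

  shape-anti : ∀ {n} (μ : Fin n → ℕ) → IsPartition μ → Anti (shape μ)
  shape-anti {zero}        μ part i       = z≤n
  shape-anti {suc zero}    μ part zero    = z≤n
  shape-anti {suc (suc n)} μ part zero    = part zero (suc zero) z≤n
  shape-anti {suc n}       μ part (suc i) = shape-anti (λ i → μ (suc i)) (λ i j p → part (suc i) (suc j) (s≤s p)) i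

  embed : ∀ {n} {μ : Fin n → ℕ} → Filling μ ℕ → Fill
  embed T = pad (λ _ → 0) (λ i → pad 0 (T i))

  restrict : ∀ {n} (μ : Fin n → ℕ) → Fill → Filling μ ℕ
  restrict μ U i j = U (toℕ i) (toℕ j)

  module _ {n : ℕ} {μ : Fin n → ℕ} where

    embed-toℕ : (T : Filling μ ℕ) → ∀ i j → embed T (toℕ i) (toℕ j) ≡ T i j
    embed-toℕ T i j =
      trans (cong (λ f → f (toℕ j)) (pad-toℕ (λ _ → 0) (λ i → pad 0 (T i)) i)) (pad-toℕ 0 (T i) j)

    box-< : ∀ i (j : Fin (μ i)) → toℕ j < shape μ (toℕ i)
    box-< i j = subst (toℕ j <_) (sym (pad-toℕ 0 μ i)) (toℕ<n j)

    box-row : ∀ {i j} → j < shape μ i → ∃ λ i′ → toℕ i′ ≡ i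
    box-row p = fromℕ< q , toℕ-fromℕ< q
      where q = rows-< (pad-outside 0 μ) p

    box-column : ∀ {i j} → j < shape μ (toℕ i) → ∃ λ (j′ : Fin (μ i)) → toℕ j′ ≡ j
    box-column {i} p = fromℕ< q , toℕ-fromℕ< q
      where q = subst (_ <_) (pad-toℕ 0 μ i) p

    module _ (rows : ℕ → ℕ) (rows-0 : rows 0 ≡ 0)
             (rows-mono : ∀ t → rows t ≤ rows (suc t))
             (rows-step : ∀ t → rows (suc t) ≤ suc (rows t)) where

      open Tableaux rows rows-0 rows-mono rows-step

      embed-tab : ∀ {t} (T : Filling μ ℕ) →
        (∀ i j → T i j < t) →
        (∀ i j j′ → j Fin.≤ j′ → T i j ≤ T i j′) →
        (∀ i i′ j j′ → toℕ j ≡ toℕ j′ → i Fin.< i′ → T i j < T i′ j′) →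
        (∀ i j → toℕ i < rows (suc (T i j))) →
        IsPartition μ → Tab t (shape μ) (embed T)
      embed-tab {t} T bnd wk st fl part = tab
        (λ p → case box-row p of λ { (i , refl) → case box-column {i} p of λ { (j , refl) →
          subst (_< t) (sym (embed-toℕ T i j)) (bnd i j) } })
        (λ p q → case box-row q of λ { (i , refl) →
          case box-column {i} (≤-<-trans p q) of λ { (j , refl) → case box-column {i} q of λ { (j′ , refl) →
          subst₂ _≤_ (sym (embed-toℕ T i j)) (sym (embed-toℕ T i j′)) (wk i j j′ p) } } })
        -- The box in the lower row lies in the diagram, hence by the partition condition so does
        -- the box above it in row `i`.
        (λ p q → case box-row (<-≤-trans q (anti-≤ (shape-anti μ part) (<⇒≤ p))) of λ { (i , refl) →
          case box-row q of λ { (i′ , refl) →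
          case box-column {i} (<-≤-trans q (anti-≤ (shape-anti μ part) (<⇒≤ p))) of λ { (j , refl) →
          case box-column {i′} q of λ { (j′ , e) →
          subst₂ _<_ (sym (embed-toℕ T i j))
            (trans (sym (embed-toℕ T i′ j′)) (cong (embed T (toℕ i′)) e)) (st i i′ j j′ (sym e) p) } } } })
        (λ p → case box-row p of λ { (i , refl) → case box-column {i} p of λ { (j , refl) →
          subst (λ e → toℕ i < rows (suc e)) (sym (embed-toℕ T i j)) (fl i j) } })

      embed-soTab : ∀ {t} (T : Filling μ ℕ) →
        (∀ i j → T i j ≤ t) →
        (∀ i j j′ → j Fin.≤ j′ → T i j ≤ T i j′) →
        (∀ i i′ j j′ → toℕ j ≡ toℕ j′ → i Fin.< i′ → T i j < T i′ j′ ⊎ (T i j ≡ t × T i′ j′ ≡ t)) →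
        (∀ i j j′ → T i j ≡ t → T i j′ ≡ t → j ≡ j′) →
        (∀ i j → T i j < t → toℕ i < rows (suc (T i j))) →
        IsPartition μ → SoTab t (shape μ) (embed T)
      embed-soTab {t} T bnd wk st sg fl part = soTab
        (λ p → case box-row p of λ { (i , refl) → case box-column {i} p of λ { (j , refl) →
          subst (_≤ t) (sym (embed-toℕ T i j)) (bnd i j) } })
        (λ p q → case box-row q of λ { (i , refl) →
          case box-column {i} (≤-<-trans p q) of λ { (j , refl) → case box-column {i} q of λ { (j′ , refl) →
          subst₂ _≤_ (sym (embed-toℕ T i j)) (sym (embed-toℕ T i j′)) (wk i j j′ p) } } })
        (λ p q → case box-row (<-≤-trans q (anti-≤ (shape-anti μ part) (<⇒≤ p))) of λ { (i , refl) →
          case box-row q of λ { (i′ , refl) →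
          case box-column {i} (<-≤-trans q (anti-≤ (shape-anti μ part) (<⇒≤ p))) of λ { (j , refl) →
          case box-column {i′} q of λ { (j′ , e) →
          subst₂ (λ l m → l < m ⊎ (l ≡ t × m ≡ t)) (sym (embed-toℕ T i j))
            (trans (sym (embed-toℕ T i′ j′)) (cong (embed T (toℕ i′)) e)) (st i i′ j j′ (sym e) p) } } } })
        (λ p q e e′ → case box-row p of λ { (i , refl) →
          case box-column {i} p of λ { (j , refl) → case box-column {i} q of λ { (j′ , refl) →
          cong toℕ (sg i j j′ (trans (sym (embed-toℕ T i j)) e) (trans (sym (embed-toℕ T i j′)) e′)) } } })
        (λ p q → case box-row p of λ { (i , refl) → case box-column {i} p of λ { (j , refl) →
          subst (λ e → toℕ i < rows (suc e)) (sym (embed-toℕ T i j)) (fl i j (subst (_< t) (embed-toℕ T i j) q)) } })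

  -- Letters

  2*≡double : ∀ k → 2 * k ≡ double k
  2*≡double zero    = refl
  2*≡double (suc k) = cong suc (trans (+-suc k (k + 0)) (cong suc (2*≡double k)))

  double-injective : ∀ {k l} → double k ≡ double l → k ≡ l
  double-injective {zero}  {zero}  _ = refl
  double-injective {suc k} {suc l} e = cong suc (double-injective (suc-injective (suc-injective e)))

  double≢1+double : ∀ k l → double k ≢ suc (double l)
  double≢1+double (suc k) (suc l) e = double≢1+double k l (suc-injective (suc-injective e))

  double-cancel-< : ∀ {k l} → double k < double l → k < l
  double-cancel-< {zero}  {suc l} _ = z<s
  double-cancel-< {suc k} {suc l} (s≤s (s≤s p)) = s≤s (double-cancel-< p)

  1+double-< : ∀ {k l} → k < l → suc (double k) < double l
  1+double-< {zero}  {suc l} _       = s≤s (s≤s z≤n)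
  1+double-< {suc k} {suc l} (s≤s p) = s≤s (s≤s (1+double-< p))

  halve : ∀ t → ∃ λ k → t ≡ double k ⊎ t ≡ suc (double k)
  halve zero          = 0 , inj₁ refl
  halve (suc zero)    = 0 , inj₂ refl
  halve (suc (suc t)) with halve t
  ... | k , inj₁ e = suc k , inj₁ (cong (λ t → suc (suc t)) e)
  ... | k , inj₂ e = suc k , inj₂ (cong (λ t → suc (suc t)) e)

  rank-num : ∀ {n} (k : Fin n) → rank (Letter.num k) ≡ double (toℕ k)
  rank-num k = 2*≡double (toℕ k)

  rank-bar : ∀ {n} (k : Fin n) → rank (Letter.bar k) ≡ suc (double (toℕ k))
  rank-bar k = cong suc (2*≡double (toℕ k))

  spRank : ∀ {n} → SpLetter n → ℕ
  spRank ℓ = rank ⌊ ℓ ⌋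

  spRank-< : ∀ {n} (ℓ : SpLetter n) → spRank ℓ < double n
  spRank-< {n} (num k) = subst (_< double n) (sym (rank-num k)) (<-trans (n<1+n _) (1+double-< (toℕ<n k)))
  spRank-< {n} (bar k) = subst (_< double n) (sym (rank-bar k)) (1+double-< (toℕ<n k))

  spRank-injective : ∀ {n} {ℓ ℓ′ : SpLetter n} → spRank ℓ ≡ spRank ℓ′ → ℓ ≡ ℓ′
  spRank-injective {ℓ = num k} {num l} e =
    cong num (toℕ-injective (double-injective (trans (sym (rank-num k)) (trans e (rank-num l)))))
  spRank-injective {ℓ = num k} {bar l} e =
    contradiction (trans (sym (rank-num k)) (trans e (rank-bar l))) (double≢1+double (toℕ k) (toℕ l))
  spRank-injective {ℓ = bar k} {num l} e =
    contradiction (trans (sym (rank-num l)) (trans (sym e) (rank-bar k))) (double≢1+double (toℕ l) (toℕ k))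
  spRank-injective {ℓ = bar k} {bar l} e =
    cong bar (toℕ-injective (double-injective (suc-injective (trans (sym (rank-bar k)) (trans e (rank-bar l))))))

  spRank-surjective : ∀ {n t} → t < double n → ∃ λ (ℓ : SpLetter n) → spRank ℓ ≡ t
  spRank-surjective {n} {t} p with halve t
  ... | k , inj₁ refl = num (fromℕ< k<n) , trans (rank-num (fromℕ< k<n)) (cong double (toℕ-fromℕ< k<n))
    where k<n = double-cancel-< {k} {n} p
  ... | k , inj₂ refl = bar (fromℕ< k<n) , trans (rank-bar (fromℕ< k<n)) (cong (suc ∘ double) (toℕ-fromℕ< k<n))
    where k<n = double-cancel-< {k} {n} (<-trans (n<1+n _) p)

  rank-𝟎 : ∀ {n} → rank {n} 𝟎 ≡ double n
  rank-𝟎 {n} = 2*≡double n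

  data LetterView {n} : Letter n → Set where
    nonzero : (ℓ : SpLetter n) → LetterView ⌊ ℓ ⌋
    zero    : LetterView 𝟎

  letterView : ∀ {n} (ℓ : Letter n) → LetterView ℓ
  letterView (num k) = nonzero (num k)
  letterView (bar k) = nonzero (bar k)
  letterView 𝟎       = zero

  ⌊⌋≢𝟎 : ∀ {n} (ℓ : SpLetter n) → ⌊ ℓ ⌋ ≢ 𝟎
  ⌊⌋≢𝟎 (num _) ()
  ⌊⌋≢𝟎 (bar _) ()

  rank-≤ : ∀ {n} (ℓ : Letter n) → rank ℓ ≤ double n
  rank-≤ ℓ with letterView ℓ
  ... | nonzero ℓ′ = <⇒≤ (spRank-< ℓ′)
  ... | zero  = ≤-reflexive rank-𝟎

  rank-max⇒𝟎 : ∀ {n} {ℓ : Letter n} → rank ℓ ≡ double n → ℓ ≡ 𝟎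
  rank-max⇒𝟎 {ℓ = ℓ} e with letterView ℓ
  ... | nonzero ℓ′ = contradiction e (<⇒≢ (spRank-< ℓ′))
  ... | zero  = refl

  rank-injective : ∀ {n} {ℓ ℓ′ : Letter n} → rank ℓ ≡ rank ℓ′ → ℓ ≡ ℓ′
  rank-injective {ℓ = ℓ} {ℓ′} e with letterView ℓ | letterView ℓ′
  ... | nonzero m | nonzero m′ = cong ⌊_⌋ (spRank-injective e)
  ... | nonzero m | zero  = rank-max⇒𝟎 (trans e rank-𝟎)
  ... | zero | _     = sym (rank-max⇒𝟎 {ℓ = ℓ′} (trans (sym e) rank-𝟎))

  rank-surjective : ∀ {n t} → t ≤ double n → ∃ λ (ℓ : Letter n) → rank ℓ ≡ t
  rank-surjective p with m≤n⇒m<n∨m≡n p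
  ... | inj₁ q    = let ℓ , e = spRank-surjective q in ⌊ ℓ ⌋ , e
  ... | inj₂ refl = 𝟎 , rank-𝟎

  spLetters-complete : ∀ {n} (ℓ : SpLetter n) → ℓ ∈ spLetters n
  spLetters-complete (num k) = ∈-concatMap⁺ _ (lose (∈-allFin k) (here refl))
  spLetters-complete (bar k) = ∈-concatMap⁺ _ (lose (∈-allFin k) (there (here refl)))

  spLetters-unique : ∀ n → Unique (spLetters n)
  spLetters-unique n = UniqueP.concat⁺
    (Allₚ.map⁺ (All.universal (λ k → ((λ ()) ∷ []) ∷ [] ∷ []) (allFin n)))
    (AllPairsₚ.map⁺ (AllPairs.map
      (λ { k≢l (here refl , here refl) → k≢l refl
         ; k≢l (here refl , there (here ()))
         ; k≢l (there (here refl) , here ())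
         ; k≢l (there (here refl) , there (here refl)) → k≢l refl })
      (UniqueP.allFin⁺ n)))

  ⌊⌋-injective : ∀ {n} {ℓ ℓ′ : SpLetter n} → ⌊ ℓ ⌋ ≡ ⌊ ℓ′ ⌋ → ℓ ≡ ℓ′
  ⌊⌋-injective e = spRank-injective (cong rank e)

  soLetters-complete : ∀ {n} (ℓ : Letter n) → ℓ ∈ soLetters n
  soLetters-complete ℓ with letterView ℓ
  ... | nonzero ℓ′ = ∈-++⁺ˡ (∈-map⁺ ⌊_⌋ (spLetters-complete ℓ′))
  ... | zero  = ∈-++⁺ʳ _ (here refl)

  soLetters-unique : ∀ n → Unique (soLetters n)
  soLetters-unique n = UniqueP.++⁺ (UniqueP.map⁺ ⌊⌋-injective (spLetters-unique n)) ([] ∷ [])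
    λ { (ℓ∈ , here refl) → case ∈-map⁻ ⌊_⌋ ℓ∈ of λ { (ℓ , _ , e) → ⌊⌋≢𝟎 ℓ (sym e) } }

  spRows : ℕ → ℕ
  spRows t = ⌈ t /2⌉

  spRows-mono : ∀ t → spRows t ≤ spRows (suc t)
  spRows-mono t = ⌈n/2⌉-mono (n≤1+n t)

  spRows-step : ∀ t → spRows (suc t) ≤ suc (spRows t)
  spRows-step t = s≤s (⌊n/2⌋≤⌈n/2⌉ t)

  spIndex : ∀ {n} → SpLetter n → Fin n
  spIndex (num k) = k
  spIndex (bar k) = k

  -- This identifies `flag` with (T4): k and k̄ are both confined to the first k rows.
  spRows-rank : ∀ {n} (ℓ : SpLetter n) → spRows (suc (spRank ℓ)) ≡ suc (toℕ (spIndex ℓ))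
  spRows-rank (num k) rewrite 2*≡double (toℕ k) = ⌈1+double/2⌉ (toℕ k)
  spRows-rank (bar k) rewrite 2*≡double (toℕ k) = cong suc (⌈double/2⌉ (toℕ k))

  -- Tableaux as fillings by ranks

  module Schur {n : ℕ} (μ : Fin n → ℕ) (part : IsPartition μ) where

    open Tableaux (λ t → t) refl n≤1+n (λ t → ≤-refl)

    ranks : Filling μ (Fin n) → Filling μ ℕ
    ranks T i j = toℕ (T i j)

    toTableau : ∀ {T} → IsTableau μ T → ∃ λ U → U ∈ tableaux n (shape μ) ×
                ∀ i j → ranks T i j ≡ restrict μ U i j
    toTableau {T} (t1 , t2 , t3) =
      let U , U∈ , e = tableaux-complete n (shape-anti μ part) t
      in U , U∈ , λ i j → trans (sym (embed-toℕ (ranks T) i j)) (e (toℕ i) (toℕ j) (box-< i j))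
      where
      strictly : ∀ i i′ j j′ → toℕ j ≡ toℕ j′ → i Fin.< i′ → toℕ (T i j) < toℕ (T i′ j′)
      strictly i i′ j j′ e p = ≤∧≢⇒< (*-cancelˡ-≤ 2 (t2 i i′ j j′ e (<⇒≤ p)))
        λ e′ → case t3 i i′ j j′ e (λ i≡i′ → <⇒≢ p (cong toℕ i≡i′)) (cong num (toℕ-injective e′)) of λ ()
      -- Strictly increasing columns force the entries of row i to be at least i.
      row-≤ : ∀ m i → toℕ i ≡ m → ∀ j → m ≤ toℕ (T i j)
      row-≤ zero    i e j = z≤n
      row-≤ (suc m) i e j = ≤-<-trans
        (row-≤ m i′ ei′ j′) (strictly i′ i j′ j ej′ (≤-reflexive (trans (cong suc ei′) (sym e))))
        where
        m<n = <-trans (n<1+n m) (subst (_< n) e (toℕ<n i))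
        i′  = fromℕ< m<n
        ei′ = toℕ-fromℕ< m<n
        i′≤i : i′ Fin.≤ i
        i′≤i = subst₂ _≤_ (sym ei′) (sym e) (n≤1+n m)
        j<  = <-≤-trans (toℕ<n j) (part i′ i i′≤i)
        j′  = fromℕ< j<
        ej′ = toℕ-fromℕ< j<
      t : Tab n (shape μ) (embed (ranks T))
      t = embed-tab (λ t → t) refl n≤1+n (λ t → ≤-refl) (ranks T)
        (λ i j → toℕ<n (T i j))
        (λ i j j′ p → *-cancelˡ-≤ 2 (t1 i j j′ p))
        strictly
        (λ i j → s≤s (row-≤ (toℕ i) i refl j))
        part

    module _ {U : Fill} (U∈ : U ∈ tableaux n (shape μ)) where

      private
        t : Tab n (shape μ) U
        t = tableaux-sound n (shape-anti μ part) (pad-outside 0 μ) U∈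

      entries : ∀ i j → ∃ λ k → toℕ k ≡ restrict μ U i j
      entries i j = fromℕ< (bound t (box-< i j)) , toℕ-fromℕ< (bound t (box-< i j))

      flagged : ∀ i j → toℕ i < suc (restrict μ U i j)
      flagged i j = flag t (box-< i j)

      isTableau : ∀ {T} → (∀ i j → ranks T i j ≡ restrict μ U i j) → IsTableau μ T
      isTableau {T} e =
        (λ i j j′ p → *-monoʳ-≤ 2 (subst₂ _≤_ (sym (e i j)) (sym (e i j′)) (weak t p (box-< i j′)))) ,
        (λ i i′ j j′ ej p → *-monoʳ-≤ 2 (case m≤n⇒m<n∨m≡n p of λ
          { (inj₁ q)   → <⇒≤ (column i i′ j j′ ej q)
          ; (inj₂ i≡i′) → ≤-reflexive (trans (e i j) (trans (cong₂ U i≡i′ ej) (sym (e i′ j′)))) })) ,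
        (λ i i′ j j′ ej i≢i′ eT → contradiction (cong rank eT) (case <-cmp (toℕ i) (toℕ i′) of λ
          { (tri< q _ _) → <⇒≢ (*-monoʳ-< 2 (column i i′ j j′ ej q))
          ; (tri≈ _ q _) → contradiction (toℕ-injective q) i≢i′
          ; (tri> _ _ q) → <⇒≢ (*-monoʳ-< 2 (column i′ i j′ j (sym ej) q)) ∘ sym }))
        where
        column : ∀ i i′ j j′ → toℕ j ≡ toℕ j′ → i Fin.< i′ → toℕ (T i j) < toℕ (T i′ j′)
        column i i′ j j′ ej q = subst₂ _<_
          (trans (cong (U (toℕ i)) (sym ej)) (sym (e i j))) (sym (e i′ j′)) (strict t q (box-< i′ j′))

  module Symplectic {n : ℕ} (μ : Fin n → ℕ) (part : IsPartition μ) where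

    open Tableaux spRows refl spRows-mono spRows-step

    ranks : Filling μ (SpLetter n) → Filling μ ℕ
    ranks T i j = spRank (T i j)

    toTableau : ∀ {T} → IsSpTableau μ T → ∃ λ U → U ∈ tableaux (double n) (shape μ) ×
                ∀ i j → ranks T i j ≡ restrict μ U i j
    toTableau {T} (t1 , t2 , t3 , t4) =
      let U , U∈ , e = tableaux-complete (double n) (shape-anti μ part) t
      in U , U∈ , λ i j → trans (sym (embed-toℕ (ranks T) i j)) (e (toℕ i) (toℕ j) (box-< i j))
      where
      flagged : ∀ i j ℓ → T i j ≡ ℓ → toℕ i ≤ toℕ (spIndex ℓ)
      flagged i j (num k) e = t4 k i j (inj₁ (cong ⌊_⌋ e))
      flagged i j (bar k) e = t4 k i j (inj₂ (cong ⌊_⌋ e))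
      t : Tab (double n) (shape μ) (embed (ranks T))
      t = embed-tab spRows refl spRows-mono spRows-step (ranks T)
        (λ i j → spRank-< (T i j))
        t1
        (λ i i′ j j′ e p → ≤∧≢⇒< (t2 i i′ j j′ e (<⇒≤ p))
          λ e′ → ⌊⌋≢𝟎 (T i j) (t3 i i′ j j′ e (λ i≡i′ → <⇒≢ p (cong toℕ i≡i′)) (rank-injective e′)))
        (λ i j → subst (toℕ i <_) (sym (spRows-rank (T i j))) (s≤s (flagged i j (T i j) refl)))
        part

    module _ {U : Fill} (U∈ : U ∈ tableaux (double n) (shape μ)) where

      private
        t : Tab (double n) (shape μ) U
        t = tableaux-sound (double n) (shape-anti μ part)
              (subst (λ m → Rows m (shape μ)) (sym (⌈double/2⌉ n)) (pad-outside 0 μ)) U∈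

      entries : ∀ i j → ∃ λ ℓ → spRank ℓ ≡ restrict μ U i j
      entries i j = spRank-surjective (bound t (box-< i j))

      flagged : ∀ i j → toℕ i < spRows (suc (restrict μ U i j))
      flagged i j = flag t (box-< i j)

      isTableau : ∀ {T} → (∀ i j → ranks T i j ≡ restrict μ U i j) → IsSpTableau μ T
      isTableau {T} e =
        (λ i j j′ p → subst₂ _≤_ (sym (e i j)) (sym (e i j′)) (weak t p (box-< i j′))) ,
        (λ i i′ j j′ ej p → case m≤n⇒m<n∨m≡n p of λ
          { (inj₁ q)   → <⇒≤ (column i i′ j j′ ej q)
          ; (inj₂ i≡i′) → ≤-reflexive (trans (e i j) (trans (cong₂ U i≡i′ ej) (sym (e i′ j′)))) }) ,
        (λ i i′ j j′ ej i≢i′ eT → contradiction (cong rank eT) (case <-cmp (toℕ i) (toℕ i′) of λ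
          { (tri< q _ _) → <⇒≢ (column i i′ j j′ ej q)
          ; (tri≈ _ q _) → contradiction (toℕ-injective q) i≢i′
          ; (tri> _ _ q) → <⇒≢ (column i′ i j′ j (sym ej) q) ∘ sym })) ,
        (λ { k i j (inj₁ q) → flagged′ i j (num k) q ; k i j (inj₂ q) → flagged′ i j (bar k) q })
        where
        column : ∀ i i′ j j′ → toℕ j ≡ toℕ j′ → i Fin.< i′ → spRank (T i j) < spRank (T i′ j′)
        column i i′ j j′ ej q = subst₂ _<_
          (trans (cong (U (toℕ i)) (sym ej)) (sym (e i j))) (sym (e i′ j′)) (strict t q (box-< i′ j′))
        flagged′ : ∀ i j ℓ → ⌊ T i j ⌋ ≡ ⌊ ℓ ⌋ → toℕ i ≤ toℕ (spIndex ℓ)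
        flagged′ i j ℓ q = s≤s⁻¹ (subst (toℕ i <_)
          (trans (cong (λ r → spRows (suc r)) (trans (sym (e i j)) (cong rank q))) (spRows-rank ℓ)) (flagged i j))

  module OrthogonalTableaux {n : ℕ} (μ : Fin n → ℕ) (part : IsPartition μ) where

    open Tableaux spRows refl spRows-mono spRows-step

    ranks : Filling μ (Letter n) → Filling μ ℕ
    ranks T i j = rank (T i j)

    rowsμ : Rows (spRows (double n)) (shape μ)
    rowsμ = subst (λ m → Rows m (shape μ)) (sym (⌈double/2⌉ n)) (pad-outside 0 μ)

    toTableau : ∀ {T} → IsSoTableau μ T → ∃ λ U → U ∈ soTableaux (double n) (shape μ) ×
                ∀ i j → ranks T i j ≡ restrict μ U i j
    toTableau {T} (t1 , t2 , t3 , t4 , t5) =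
      let U , U∈ , e = soTableaux-complete (double n) (shape-anti μ part) rowsμ t
      in U , U∈ , λ i j → trans (sym (embed-toℕ (ranks T) i j)) (e (toℕ i) (toℕ j) (box-< i j))
      where
      flagged : ∀ i j ℓ → T i j ≡ ℓ → rank ℓ < double n → toℕ i < spRows (suc (rank ℓ))
      flagged i j (num k) e _ = subst (toℕ i <_) (sym (spRows-rank (num k))) (s≤s (t4 k i j (inj₁ e)))
      flagged i j (bar k) e _ = subst (toℕ i <_) (sym (spRows-rank (bar k))) (s≤s (t4 k i j (inj₂ e)))
      flagged i j 𝟎       e p = contradiction rank-𝟎 (<⇒≢ p)
      t : SoTab (double n) (shape μ) (embed (ranks T))
      t = embed-soTab spRows refl spRows-mono spRows-step (ranks T)
        (λ i j → rank-≤ (T i j))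
        t1
        -- By (T3) two equal entries in a column are both 0, whose rank is the bound `double n`.
        (λ i i′ j j′ e p → case m≤n⇒m<n∨m≡n (t2 i i′ j j′ e (<⇒≤ p)) of λ
          { (inj₁ q) → inj₁ q
          ; (inj₂ q) →
            let z = trans (cong rank (t3 i i′ j j′ e (λ i≡i′ → <⇒≢ p (cong toℕ i≡i′)) (rank-injective q))) rank-𝟎
            in inj₂ (z , trans (sym q) z) })
        (λ i j j′ e e′ → t5 i j j′ (rank-max⇒𝟎 e) (rank-max⇒𝟎 e′))
        (λ i j → flagged i j (T i j) refl)
        part

    module _ {U : Fill} (U∈ : U ∈ soTableaux (double n) (shape μ)) where

      private
        t : SoTab (double n) (shape μ) U
        t = soTableaux-sound (double n) rowsμ U∈

      entries : ∀ i j → ∃ λ ℓ → rank ℓ ≡ restrict μ U i j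
      entries i j = rank-surjective (So.bound t (box-< i j))

      flagged : ∀ i j → restrict μ U i j < double n → toℕ i < spRows (suc (restrict μ U i j))
      flagged i j = So.flag t (box-< i j)

      isTableau : ∀ {T} → (∀ i j → ranks T i j ≡ restrict μ U i j) → IsSoTableau μ T
      isTableau {T} e =
        (λ i j j′ p → subst₂ _≤_ (sym (e i j)) (sym (e i j′)) (So.weak t p (box-< i j′))) ,
        (λ i i′ j j′ ej p → case m≤n⇒m<n∨m≡n p of λ
          { (inj₁ q)   → case column i i′ j j′ ej q of λ
            { (inj₁ r) → <⇒≤ r ; (inj₂ (r , r′)) → ≤-reflexive (trans r (sym r′)) }
          ; (inj₂ i≡i′) → ≤-reflexive (trans (e i j) (trans (cong₂ U i≡i′ ej) (sym (e i′ j′)))) }) ,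
        (λ i i′ j j′ ej i≢i′ eT → case <-cmp (toℕ i) (toℕ i′) of λ
          { (tri< q _ _) → case column i i′ j j′ ej q of λ
            { (inj₁ r)       → contradiction (cong rank eT) (<⇒≢ r)
            ; (inj₂ (r , _)) → rank-max⇒𝟎 r }
          ; (tri≈ _ q _) → contradiction (toℕ-injective q) i≢i′
          ; (tri> _ _ q) → case column i′ i j′ j (sym ej) q of λ
            { (inj₁ r)       → contradiction (cong rank (sym eT)) (<⇒≢ r)
            ; (inj₂ (_ , r)) → rank-max⇒𝟎 r } }) ,
        (λ { k i j (inj₁ q) → flagged′ i j (num k) q ; k i j (inj₂ q) → flagged′ i j (bar k) q }) ,
        (λ i j j′ q q′ → toℕ-injective (So.single t (box-< i j) (box-< i j′)
          (trans (sym (e i j)) (trans (cong rank q) rank-𝟎)) (trans (sym (e i j′)) (trans (cong rank q′) rank-𝟎))))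
        where
        column : ∀ i i′ j j′ → toℕ j ≡ toℕ j′ → i Fin.< i′ →
                rank (T i j) < rank (T i′ j′) ⊎ (rank (T i j) ≡ double n × rank (T i′ j′) ≡ double n)
        column i i′ j j′ ej q = subst₂ (λ l m → l < m ⊎ (l ≡ double n × m ≡ double n))
          (trans (cong (U (toℕ i)) (sym ej)) (sym (e i j))) (sym (e i′ j′)) (So.strict t q (box-< i′ j′))
        flagged′ : ∀ i j ℓ → T i j ≡ ⌊ ℓ ⌋ → toℕ i ≤ toℕ (spIndex ℓ)
        flagged′ i j ℓ q = s≤s⁻¹ (subst (toℕ i <_)
          (trans (cong (λ r → spRows (suc r)) U≡) (spRows-rank ℓ))
          (flagged i j (subst (_< double n) (sym U≡) (spRank-< ℓ))))
          where
          U≡ : restrict μ U i j ≡ spRank ℓ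
          U≡ = trans (sym (e i j)) (cong rank q)

-- The characters as quotients in a field.

module Characters {c ℓ} (K : Field c ℓ) where

  open RankTableaux
  open LetterTableaux
  open import Data.Fin.Base using (Fin; zero; suc; toℕ; punchIn; fromℕ<)
  open import Data.Fin.Properties using (toℕ<n; toℕ-injective; toℕ-fromℕ<)
  open import Data.Integer.Base as ℤ using (ℤ; +_; _⊖_)
  import Data.Integer.Properties as ℤₚ
  open import Data.Integer.Tactic.RingSolver using (solve-∀)
  open import Data.List.Base using (List; []; _∷_; map; filter)
  open import Data.List.Membership.Propositional using (_∈_; find; lose)
  import Data.List.Membership.Setoid as Mem
  import Data.List.Membership.Setoid.Properties as Memₚ
  open import Data.List.Membership.Propositional.Properties using (∈-allFin; ∈-filter⁻)
  open import Data.List.Relation.Unary.All using ([]; _∷_)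
  open import Data.List.Relation.Unary.AllPairs using ([]; _∷_)
  open import Data.List.Relation.Unary.Any as Any using ()
  import Data.List.Relation.Unary.Any.Properties as Anyₚ
  import Data.List.Relation.Binary.Permutation.Setoid.Properties as Permₚ
  open import Data.List.Relation.Unary.Unique.Propositional using (Unique)
  import Data.List.Relation.Unary.Unique.Propositional.Properties as UniqueP
  import Data.List.Relation.Unary.Unique.Setoid as Uniq
  import Data.List.Relation.Unary.Unique.Setoid.Properties as Uniqₚ
  open import Data.Nat.Base as ℕ using (ℕ; zero; suc; z≤n; s≤s; _∸_)
  import Data.Nat.Properties as ℕₚ
  open import Data.Product.Base using (∃; _,_; proj₁; proj₂)
  open import Data.Vec.Base as Vec using (Vec; []; _∷_; lookup)
  import Data.Vec.Properties as Vecₚ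
  open import Function.Base using (_∘_; case_of_)
  open import Level using (0ℓ)
  open import Relation.Binary.Bundles using (Setoid)
  open import Relation.Binary.PropositionalEquality as ≡ using (_≡_; _≢_)
  open import Relation.Nullary using (¬_; yes; no; contradiction)
  open import Relation.Unary using (Decidable)

  open Field K hiding (zero)
  open FactorialCharacters K
  open Branching commutativeRing
  open import Algebra.Properties.Ring ring using (-‿distribˡ-*; -‿distribʳ-*; -‿involutive; -‿+-comm; x∙y⁻¹≈ε⇒x≈y)
  open import Algebra.Properties.Monoid.Sum +-monoid using () renaming (sum-cong-≋ to ∑-cong)
  open import Algebra.Properties.Monoid.Sum *-monoid using () renaming (sum-cong-≋ to ∏-cong)
  open import Algebra.Properties.Semiring.Sum semiring using (*-distribˡ-sum)
  open import Algebra.Solver.Ring.NaturalCoefficients.Default commutativeSemiring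
    using (solve; _:+_; _:*_; _:=_; con)
  open import Relation.Binary.Reasoning.Setoid setoid

  -- Laplace expansion along the first row

  -- The sign of the term at position `j` arises from the `j` nested subtractions in `laplace`.
  laplace-tabulate : ∀ {k} (Ψ : Vec Col k → Carrier) (D : Fin (suc k) → Col) →
    ∑ (λ j → (- 1#) ^ toℕ j * D j 0 * Ψ (Vec.tabulate (λ s → D (punchIn j s)))) ≈ laplace Ψ (Vec.tabulate D)
  laplace-tabulate {zero}  Ψ D = trans (+-identityʳ _) (*-congʳ (*-identityˡ _))
  laplace-tabulate {suc k} Ψ D = +-cong (*-congʳ (*-identityˡ _)) (begin
    ∑ (λ j → - 1# * (- 1#) ^ toℕ j * D (suc j) 0 * Ψ (D zero ∷ T j))
      ≈⟨ ∑-cong (λ j → solve 4 (λ m a d p → m :* a :* d :* p := m :* (a :* d :* p)) refl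
           (- 1#) ((- 1#) ^ toℕ j) (D (suc j) 0) (Ψ (D zero ∷ T j))) ⟩
    ∑ (λ j → - 1# * ((- 1#) ^ toℕ j * D (suc j) 0 * Ψ (D zero ∷ T j)))
      ≈⟨ *-distribˡ-sum (- 1#) (λ j → (- 1#) ^ toℕ j * D (suc j) 0 * Ψ (D zero ∷ T j)) ⟨
    - 1# * ∑ (λ j → (- 1#) ^ toℕ j * D (suc j) 0 * Ψ (D zero ∷ T j))
      ≈⟨ *-congˡ (laplace-tabulate (λ E → Ψ (D zero ∷ E)) (λ j → D (suc j))) ⟩
    - 1# * L
      ≈⟨ trans (sym (-‿distribˡ-* 1# L)) (-‿cong (*-identityˡ L)) ⟩
    - L ∎)
    where
    T : Fin (suc k) → Vec Col k
    T j = Vec.tabulate (λ s → D (suc (punchIn j s)))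
    L = laplace (λ E → Ψ (D zero ∷ E)) (Vec.tabulate (λ j → D (suc j)))

  det≈detᶜ : ∀ {n} {M : Fin n → Fin n → Carrier} (D : Fin n → Col) →
             (∀ i j → M i j ≈ D j (toℕ i)) → det M ≈ detᶜ (Vec.tabulate D)
  det≈detᶜ {zero}  D eq = refl
  det≈detᶜ {suc n} {M} D eq = begin
    ∑ (λ j → (- 1#) ^ toℕ j * M zero j * det (λ r s → M (suc r) (punchIn j s)))
      ≈⟨ ∑-cong (λ j → *-cong (*-congˡ {x = (- 1#) ^ toℕ j} (eq zero j)) (trans
           (det≈detᶜ (λ s → tailCol (D (punchIn j s))) (λ r s → eq (suc r) (punchIn j s)))
           (reflexive (≡.cong detᶜ (Vecₚ.tabulate-∘ tailCol (λ s → D (punchIn j s))))))) ⟩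
    ∑ (λ j → (- 1#) ^ toℕ j * D j 0 * detᶜ (Vec.map tailCol (Vec.tabulate (λ s → D (punchIn j s)))))
      ≈⟨ laplace-tabulate (λ E → detᶜ (Vec.map tailCol E)) D ⟩
    detᶜ (Vec.tabulate D) ∎

  columns-tabulate : ∀ n (f : ℕ → Col) μ →
    Vec.tabulate {n = n} (λ j → f (μ (toℕ j) ℕ.+ δ j)) ≡ columns n f μ
  columns-tabulate zero    f μ = ≡.refl
  columns-tabulate (suc n) f μ = ≡.cong (_ ∷_) (columns-tabulate n f (μ ∘ suc))

  det-columns : ∀ {n} (g : ℕ → Fin n → Carrier) (f : ℕ → Col) → (∀ t i → g t i ≈ f t (toℕ i)) →
                (μ : Fin n → ℕ) → det (λ i j → g (μ j ℕ.+ δ j) i) ≈ detᶜ (columns n f (shape μ))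
  det-columns {n} g f eq μ = trans
    (det≈detᶜ (λ j → f (shape μ (toℕ j) ℕ.+ δ j)) (λ i j →
      trans (eq _ i) (reflexive (≡.cong (λ m → f (m ℕ.+ δ j) (toℕ i)) (≡.sym (pad-toℕ 0 μ j))))))
    (reflexive (≡.cong detᶜ (columns-tabulate n f (shape μ))))

  -- Sums over the lists of tableaux

  ∑ˡ-unique : ∀ (S : Setoid 0ℓ 0ℓ) (f : Setoid.Carrier S → Carrier) →
    (∀ {x y} → Setoid._≈_ S x y → f x ≈ f y) → ∀ {xs ys} →
    Uniq.Unique S xs → Uniq.Unique S ys →
    (∀ {z} → Mem._∈_ S z xs → Mem._∈_ S z ys) → (∀ {z} → Mem._∈_ S z ys → Mem._∈_ S z xs) →
    ∑ˡ f xs ≈ ∑ˡ f ys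
  ∑ˡ-unique S f f-cong xs! ys! to from =
    Permₚ.foldr-commMonoid setoid +-isCommutativeMonoid (Permₚ.map⁺ S setoid f-cong (unique⇒↭ S xs! ys! to from))

  ∏ᴺ-toℕ : ∀ n (f : ℕ → Carrier) → ∏ (λ (i : Fin n) → f (toℕ i)) ≡ ∏ᴺ n f
  ∏ᴺ-toℕ zero    f = ≡.refl
  ∏ᴺ-toℕ (suc n) f = ≡.cong (f 0 *_) (∏ᴺ-toℕ n (f ∘ suc))

  segment-suc : ∀ (q : ℕ → Carrier) v d → segment (q ∘ suc) v d ≡ segment q (suc v) d
  segment-suc q v zero    = ≡.refl
  segment-suc q v (suc d) = ≡.cong (q (suc v) *_) (segment-suc q (suc v) d)

  segment-∏ : ∀ (q : ℕ → Carrier) d → segment q 0 d ≡ ∏ (λ (j : Fin d) → q (toℕ j))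
  segment-∏ q zero    = ≡.refl
  segment-∏ q (suc d) = ≡.cong (q 0 *_) (≡.trans (≡.sym (segment-suc q 0 d)) (segment-∏ (q ∘ suc) d))

  module _ {n : ℕ} (μ : Fin n → ℕ) {A : Set} (ρ : A → ℕ) (ρ-injective : ∀ {x y} → ρ x ≡ ρ y → x ≡ y)
           {letters : List A} (letters! : Unique letters) (∈letters : ∀ x → x ∈ letters)
           {P : Filling μ A → Set} (P? : Decidable P)
           (W : ℕ → ℕ → ℕ → Carrier) (w : A → ℤ → Carrier)
           {Us : List Fill} (Us! : Uniq.Unique (fillSetoid (shape μ)) Us)
           (to : ∀ {T} → P T → ∃ λ U → U ∈ Us × ∀ i j → ρ (T i j) ≡ restrict μ U i j)
           (entry : ∀ {U} → U ∈ Us → ∀ i j → ∃ λ x → ρ x ≡ restrict μ U i j)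
           (from : ∀ {U} → U ∈ Us → ∀ {T} → (∀ i j → ρ (T i j) ≡ restrict μ U i j) → P T)
           (w≈W : ∀ {U} → U ∈ Us → ∀ i j x → ρ x ≡ restrict μ U i j →
                  w x (content i j) ≈ W (ρ x) (toℕ i) (toℕ j)) where

    open Weights n W

    private
      S  = fillingSetoid μ ℕ
      SA = fillingSetoid μ A
      ρ* : Filling μ A → Filling μ ℕ
      ρ* T i j = ρ (T i j)
      G : Filling μ ℕ → Carrier
      G T = ∏ λ i → ∏ λ j → W (T i j) (toℕ i) (toℕ j)
      xs = filter P? (fillings μ letters)

    -- Both lists are mapped into `Filling μ ℕ`. There they are free of repetitions and have the
    -- same elements up to pointwise equality, so one is a permutation of the other.
    tableauSum≈ : tableauSum μ xs w ≈ ∑ˡ (weight (shape μ)) Us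
    tableauSum≈ = begin
      tableauSum μ xs w
        ≈⟨ ∑ˡ-cong xs (λ {T} T∈ →
             let U , U∈ , e = to (proj₂ (∈-filter⁻ P? {xs = fillings μ letters} T∈)) in
             ∏-cong λ i → ∏-cong λ j → w≈W U∈ i j (T i j) (e i j)) ⟩
      ∑ˡ (G ∘ ρ*) xs
        ≈⟨ reflexive (∑ˡ-map G ρ* xs) ⟨
      ∑ˡ G (map ρ* xs)
        ≈⟨ ∑ˡ-unique S G (λ e → ∏-cong λ i → ∏-cong λ j → reflexive (≡.cong (λ t → W t (toℕ i) (toℕ j)) (e i j)))
             (Uniqₚ.map⁺ SA S (λ e i j → ρ-injective (e i j)) (Uniqₚ.filter⁺ SA P? (fillings-unique μ letters!)))
             (Uniqₚ.map⁺ (fillSetoid (shape μ)) S restrict-injective Us!)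
             xs⊆ ⊆xs ⟩
      ∑ˡ G (map (restrict μ) Us)
        ≈⟨ reflexive (∑ˡ-map G (restrict μ) Us) ⟩
      ∑ˡ (G ∘ restrict μ) Us
        ≈⟨ ∑ˡ-cong Us (λ {U} _ → trans
             (∏-cong λ i → reflexive (≡.trans (≡.sym (segment-∏ (λ j → W (U (toℕ i) j) (toℕ i) j) (μ i)))
               (≡.cong (segment _ 0) (≡.sym (pad-toℕ 0 μ i)))))
             (reflexive (∏ᴺ-toℕ n (λ i → segment (λ j → W (U i j) i j) 0 (shape μ i))))) ⟩
      ∑ˡ (weight (shape μ)) Us ∎
      where
      restrict-injective : ∀ {U U′} → (∀ i j → restrict μ U i j ≡ restrict μ U′ i j) → U ≐[ shape μ ] U′
      restrict-injective e i j p = case box-row {μ = μ} p of λ { (i′ , ≡.refl) →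
        case box-column {μ = μ} {i = i′} p of λ { (j′ , ≡.refl) → e i′ j′ } }
      xs⊆ : ∀ {Z} → Mem._∈_ S Z (map ρ* xs) → Mem._∈_ S Z (map (restrict μ) Us)
      xs⊆ Z∈ =
        let T , T∈ , Z≈  = find (Anyₚ.map⁻ Z∈)
            U , U∈ , e   = to (proj₂ (∈-filter⁻ P? {xs = fillings μ letters} T∈))
        in Anyₚ.map⁺ (lose U∈ (λ i j → ≡.trans (Z≈ i j) (e i j)))
      ⊆xs : ∀ {Z} → Mem._∈_ S Z (map (restrict μ) Us) → Mem._∈_ S Z (map ρ* xs)
      ⊆xs Z∈ =
        let U , U∈ , Z≈ = find (Anyₚ.map⁻ Z∈)
            T : Filling μ A
            T i j = proj₁ (entry U∈ i j)
            e : ∀ i j → ρ (T i j) ≡ restrict μ U i j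
            e i j = proj₂ (entry U∈ i j)
            T∈ = Memₚ.∈-filter⁺ SA P? resp (fillings-complete μ ∈letters T) (from U∈ e)
        in Anyₚ.map⁺ (Any.map (λ T≈ i j → ≡.trans (Z≈ i j) (≡.trans (≡.sym (e i j)) (≡.cong ρ (T≈ i j)))) T∈)
        where
        -- By `to` and `from`, `P` depends only on the ranks of the entries, so it respects
        -- pointwise equality.
        resp : ∀ {T T′} → Setoid._≈_ SA T T′ → P T → P T′
        resp T≈ PT = let U , U∈ , e = to PT in
          from U∈ λ i j → ≡.trans (≡.cong ρ (≡.sym (T≈ i j))) (e i j)

  -- Arithmetic in the field

  *-cancelˡ-≉0 : ∀ {r x y} → r ≉ 0# → r * x ≈ r * y → x ≈ y
  *-cancelˡ-≉0 {r} {x} {y} r≉0 e = begin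
    x                ≈⟨ lem x ⟩
    r ⁻¹ * (r * x)   ≈⟨ *-congˡ e ⟩
    r ⁻¹ * (r * y)   ≈⟨ lem y ⟨
    y                ∎
    where
    lem : ∀ z → z ≈ r ⁻¹ * (r * z)
    lem z = begin
      z               ≈⟨ *-identityˡ z ⟨
      1# * z          ≈⟨ *-congʳ (inverseʳ r r≉0) ⟨
      r * r ⁻¹ * z    ≈⟨ solve 3 (λ r s z → r :* s :* z := s :* (r :* z)) refl r (r ⁻¹) z ⟩
      r ⁻¹ * (r * z)  ∎

  *-≉0 : ∀ {x y} → x ≉ 0# → y ≉ 0# → x * y ≉ 0#
  *-≉0 x≉0 y≉0 e = y≉0 (*-cancelˡ-≉0 x≉0 (trans e (sym (zeroʳ _))))

  ∏ᴺ-≉0 : ∀ k {f} → (∀ {i} → i ℕ.< k → f i ≉ 0#) → ∏ᴺ k f ≉ 0#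
  ∏ᴺ-≉0 zero    f≉0 = 1≉0
  ∏ᴺ-≉0 (suc k) f≉0 = *-≉0 (f≉0 (s≤s z≤n)) (∏ᴺ-≉0 k (λ p → f≉0 (s≤s p)))

  inverse-unique : ∀ {x y} → x * y ≈ 1# → x ⁻¹ ≈ y
  inverse-unique {x} {y} e = *-cancelˡ-≉0 x≉0 (trans (inverseʳ x x≉0) (sym e))
    where
    x≉0 : x ≉ 0#
    x≉0 x≈0 = 1≉0 (trans (sym e) (trans (*-congʳ x≈0) (zeroˡ y)))

  -- Both `u` and `D` are nonzero because their product `V` is. All questions about denominators are
  -- thereby reduced to the explicit product `V`.
  quotient : ∀ {u V N D S} → V ≉ 0# → u * N ≈ V * S → u * D ≈ V → N / D ≈ S
  quotient {u} {V} {N} {D} {S} V≉0 e e′ = begin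
    N * D ⁻¹      ≈⟨ *-congʳ (*-cancelˡ-≉0 u≉0 (trans e (trans (*-congʳ (sym e′)) (*-assoc _ _ _)))) ⟩
    D * S * D ⁻¹    ≈⟨ solve 3 (λ d s i → d :* s :* i := s :* (d :* i)) refl D S (D ⁻¹) ⟩
    S * (D * D ⁻¹)  ≈⟨ *-congˡ (inverseʳ D D≉0) ⟩
    S * 1#              ≈⟨ *-identityʳ S ⟩
    S                   ∎
    where
    u≉0 : u ≉ 0#
    u≉0 u≈0 = V≉0 (trans (sym e′) (trans (*-congʳ u≈0) (zeroˡ D)))
    D≉0 : D ≉ 0#
    D≉0 d≈0 = V≉0 (trans (sym e′) (trans (*-congˡ d≈0) (zeroʳ u)))

  x-y≈0⇒x≈y : ∀ {x y} → x - y ≈ 0# → x ≈ y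
  x-y≈0⇒x≈y {x} {y} = x∙y⁻¹≈ε⇒x≈y x y

  -- Monomials

  unit : ∀ {n} → Fin n → Fin n → ℕ
  unit zero    zero    = 1
  unit zero    (suc _) = 0
  unit (suc _) zero    = 0
  unit (suc i) (suc j) = unit i j

  unit-diagonal : ∀ {n} (i : Fin n) → unit i i ≡ 1
  unit-diagonal zero    = ≡.refl
  unit-diagonal (suc i) = unit-diagonal i

  unit-off : ∀ {n} (i j : Fin n) → i ≢ j → unit i j ≡ 0
  unit-off zero    zero    i≢j = contradiction ≡.refl i≢j
  unit-off zero    (suc j) i≢j = ≡.refl
  unit-off (suc i) zero    i≢j = ≡.refl
  unit-off (suc i) (suc j) i≢j = unit-off i j (i≢j ∘ ≡.cong suc)

  open import Algebra.Properties.Semiring.Exp semiring using (^-homo-*)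
  open import Algebra.Properties.CommutativeMonoid.Sum *-commutativeMonoid using () renaming (∑-distrib-+ to ∏-distrib-*)

  monomial : ∀ {n} → (Fin n → Carrier) → (Fin n → ℕ) → Carrier
  monomial x e = ∏ (λ i → x i ^ e i)

  monomial-0 : ∀ {n} (x : Fin n → Carrier) → monomial x (λ _ → 0) ≈ 1#
  monomial-0 {zero}  x = refl
  monomial-0 {suc n} x = trans (*-identityˡ _) (monomial-0 (λ i → x (suc i)))

  monomial-unit : ∀ {n} (x : Fin n → Carrier) i → monomial x (unit i) ≈ x i
  monomial-unit {suc n} x zero    =
    trans (*-cong (*-identityʳ _) (monomial-0 (λ i → x (suc i)))) (*-identityʳ _)
  monomial-unit {suc n} x (suc i) = trans (*-identityˡ _) (monomial-unit (λ i → x (suc i)) i)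

  monomial-+ : ∀ {n} (x : Fin n → Carrier) e e′ → monomial x (λ i → e i ℕ.+ e′ i) ≈ monomial x e * monomial x e′
  monomial-+ x e e′ = trans (∏-cong (λ i → ^-homo-* (x i) (e i) (e′ i)))
    (∏-distrib-* (λ i → x i ^ e i) (λ i → x i ^ e′ i))

  module Independence {c′ ℓ′} (k : CommutativeRing c′ ℓ′) (ι : CommutativeRing.Carrier k → Carrier)
    (ι-hom : IsRingHomomorphism (CommutativeRing.rawRing k) rawRing ι)
    {n : ℕ} (x : Fin n → Carrier) (indep : AlgebraicallyIndependent k K ι x) where

    private
      module k = CommutativeRing k
    open IsRingHomomorphism ι-hom using (⟦⟧-cong; 0#-homo; 1#-homo; -‿homo)

    k-nontrivial : ¬ k.1# k.≈ k.0#
    k-nontrivial e = 1≉0 (trans (sym 1#-homo) (trans (⟦⟧-cong e) 0#-homo))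

    lookup-tabulate : ∀ e → monomial x e ≈ ∏ (λ i → x i ^ lookup (Vec.tabulate e) i)
    lookup-tabulate e = ∏-cong (λ i → reflexive (≡.cong (x i ^_) (≡.sym (Vecₚ.lookup∘tabulate e i))))

    monomial-≉0 : ∀ e → monomial x e ≉ 0#
    monomial-≉0 e z with indep ((k.1# , Vec.tabulate e) ∷ []) ([] ∷ []) (begin
      ι k.1# * ∏ (λ i → x i ^ lookup (Vec.tabulate e) i) + 0#  ≈⟨ +-identityʳ _ ⟩
      ι k.1# * ∏ (λ i → x i ^ lookup (Vec.tabulate e) i)       ≈⟨ *-congˡ (trans (sym (lookup-tabulate e)) z) ⟩
      ι k.1# * 0#                                              ≈⟨ zeroʳ _ ⟩
      0#                                                       ∎)
    ... | 1≈0 ∷ [] = k-nontrivial 1≈0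

    -- Equality would be a relation with coefficients 1 and -1; the index `i` witnesses that its
    -- exponent vectors are distinct.
    monomial-≉ : ∀ e e′ i → e i ≢ e′ i → monomial x e ≉ monomial x e′
    monomial-≉ e e′ i ei≢ z with indep ((k.1# , Vec.tabulate e) ∷ (k.- k.1# , Vec.tabulate e′) ∷ [])
      (((λ v≡ → ei≢ (≡.trans (≡.sym (Vecₚ.lookup∘tabulate e i))
          (≡.trans (≡.cong (λ v → lookup v i) v≡) (Vecₚ.lookup∘tabulate e′ i)))) ∷ []) ∷ [] ∷ [])
      (begin
        ι k.1# * ∏ (λ i → x i ^ lookup (Vec.tabulate e) i) + (ι (k.- k.1#) * ∏ (λ i → x i ^ lookup (Vec.tabulate e′) i) + 0#)
          ≈⟨ +-cong (*-cong 1#-homo (trans (sym (lookup-tabulate e)) z))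
                    (trans (+-identityʳ _) (*-cong (trans (-‿homo k.1#) (-‿cong 1#-homo)) (sym (lookup-tabulate e′)))) ⟩
        1# * m + - 1# * m
          ≈⟨ distribʳ m 1# (- 1#) ⟨
        (1# - 1#) * m
          ≈⟨ trans (*-congʳ (-‿inverseʳ 1#)) (zeroˡ m) ⟩
        0# ∎)
      where m = monomial x e′
    ... | 1≈0 ∷ _ = k-nontrivial 1≈0

    x≉0 : ∀ i → x i ≉ 0#
    x≉0 i e = monomial-≉0 (unit i) (trans (monomial-unit x i) e)

    x≉x : ∀ {i j} → i ≢ j → x i ≉ x j
    x≉x {i} {j} i≢j e = monomial-≉ (unit i) (unit j) i
      (λ u → contradiction (≡.trans (≡.sym (unit-diagonal i)) (≡.trans u (unit-off j i (i≢j ∘ ≡.sym)))) λ ())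
      (trans (monomial-unit x i) (trans e (sym (monomial-unit x j))))

    -- The product is a nonconstant monomial, whether or not `i` and `j` coincide; the case `i = j`
    -- separates `x i` from its inverse.
    xx≉1 : ∀ i j → x i * x j ≉ 1#
    xx≉1 i j e = monomial-≉ (λ s → unit i s ℕ.+ unit j s) (λ _ → 0) i
      (λ u → contradiction (≡.trans (≡.cong (ℕ._+ unit j i) (≡.sym (unit-diagonal i))) u) λ ())
      (trans (monomial-+ x (unit i) (unit j))
        (trans (*-cong (monomial-unit x i) (monomial-unit x j)) (trans e (sym (monomial-0 x)))))

  -- Indices of the parameters

  -- The bound `i ≤ r` makes the truncated subtraction exact; for entries of tableaux it comes from
  -- `flag`.
  index : ∀ {r i} → i ℕ.≤ r → ∀ j s m →
          (j ℕ.+ (r ∸ i) ℕ.+ s) ⊖ m ≡ (+ j ℤ.+ (+ r ℤ.- + i) ℤ.+ + s) ℤ.- + m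
  index {r} {i} i≤r j s m = ≡.trans (≡.sym (ℤₚ.m-n≡m⊖n _ m))
    (≡.cong (λ z → (+ j ℤ.+ z ℤ.+ + s) ℤ.- + m) (≡.trans (≡.sym (ℤₚ.⊖-≥ i≤r)) (≡.sym (ℤₚ.m-n≡m⊖n r i))))

  extend-≤ : ∀ a {m n} → m ℕ.≤ n → extend a (m ⊖ n) ≡ 0#
  extend-≤ a {m} {n} m≤n = ≡.trans (≡.cong (extend a) (ℤₚ.⊖-≤ m≤n)) (neg (n ∸ m))
    where
    neg : ∀ d → extend a (ℤ.- (+ d)) ≡ 0#
    neg zero    = ≡.refl
    neg (suc _) = ≡.refl

  fpow≡fpower : ∀ {a b} → (∀ m → a (suc m) ≡ b (suc m)) → ∀ z m → fpow z a m ≡ fpower b z m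
  fpow≡fpower e z zero    = ≡.refl
  fpow≡fpower e z (suc m) = ≡.cong₂ (λ p q → p * (z + q)) (fpow≡fpower e z m) (e m)

  -- The three characters, with the nonvanishing of their denominators.

  module Main {n : ℕ} (x x½ : Fin n → Carrier) (a : ℕ → Carrier) (μ : Fin n → ℕ) (part : IsPartition μ)
              (x≉0 : ∀ i → x i ≉ 0#) (x≉x : ∀ {i j} → i ≢ j → x i ≉ x j) (xx≉1 : ∀ i j → x i * x j ≉ 1#)
              (x½² : ∀ i → x½ i * x½ i ≈ x i) where

    -- Padding by 1 keeps the relations between these sequences valid at every index.
    X X̄ X½ X̄½ : ℕ → Carrier
    X  = pad 1# x
    X̄  = pad 1# (x̄ x x½ a)
    X½ = pad 1# x½
    X̄½ = pad 1# (x̄½ x x½ a)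

    anti : Anti (shape μ)
    anti = shape-anti μ part

    anti-0 : Anti (shape {n} (λ _ → 0))
    anti-0 = shape-anti {n} (λ _ → 0) (λ _ _ _ → z≤n)

    shape-0 : ∀ i → shape {n} (λ _ → 0) i ≡ 0
    shape-0 = pad-zip (λ m _ → m ≡ 0) {n} {0} {0} {λ _ → 0} {λ _ → 0} ≡.refl (λ _ → ≡.refl)

    inside : ∀ {i} → i ℕ.< n → ∃ λ (i′ : Fin n) → toℕ i′ ≡ i
    inside p = fromℕ< p , toℕ-fromℕ< p

    X≉X : ∀ {i j} → i ℕ.< j → j ℕ.< n → X i ≉ X j
    X≉X i<j j<n e = case inside (ℕₚ.<-trans i<j j<n) of λ { (i , ≡.refl) → case inside j<n of λ { (j , ≡.refl) →
      x≉x (λ i≡j → ℕₚ.<⇒≢ i<j (≡.cong toℕ i≡j))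
        (trans (reflexive (≡.sym (pad-toℕ 1# x i))) (trans e (reflexive (pad-toℕ 1# x j)))) } }

    XX≉1 : ∀ {i j} → i ℕ.< n → j ℕ.< n → X i * X j ≉ 1#
    XX≉1 i<n j<n e = case inside i<n of λ { (i , ≡.refl) → case inside j<n of λ { (j , ≡.refl) →
      xx≉1 i j (trans (sym (*-cong (reflexive (pad-toℕ 1# x i)) (reflexive (pad-toℕ 1# x j)))) e) } }

    XX̄ : ∀ i → X i * X̄ i ≈ 1#
    XX̄ = pad-zip (λ y z → y * z ≈ 1#) (*-identityˡ 1#) (λ i → inverseʳ (x i) (x≉0 i))

    x½≉0 : ∀ i → x½ i ≉ 0#
    x½≉0 i e = x≉0 i (trans (sym (x½² i)) (trans (*-congʳ e) (zeroˡ _)))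

    X½² : ∀ i → X½ i * X½ i ≈ X i
    X½² = pad-zip (λ y z → y * y ≈ z) (*-identityˡ 1#) x½²

    X½X̄½ : ∀ i → X½ i * X̄½ i ≈ 1#
    X½X̄½ = pad-zip (λ y z → y * z ≈ 1#) (*-identityˡ 1#) (λ i → inverseʳ (x½ i) (x½≉0 i))

    X̄½² : ∀ i → X̄½ i * X̄½ i ≈ X̄ i
    X̄½² = pad-zip (λ y z → y * y ≈ z) (*-identityˡ 1#) λ i → sym (inverse-unique (begin
      x i * (x½ i ⁻¹ * x½ i ⁻¹)              ≈⟨ *-congʳ (x½² i) ⟨
      x½ i * x½ i * (x½ i ⁻¹ * x½ i ⁻¹)      ≈⟨ solve 2 (λ y z → y :* y :* (z :* z) := (y :* z) :* (y :* z)) refl (x½ i) (x½ i ⁻¹) ⟩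
      (x½ i * x½ i ⁻¹) * (x½ i * x½ i ⁻¹)    ≈⟨ *-cong (inverseʳ _ (x½≉0 i)) (inverseʳ _ (x½≉0 i)) ⟩
      1# * 1#                                ≈⟨ *-identityˡ 1# ⟩
      1#                                     ∎))

    module SchurCase where
      open SchurNumerator X (λ m → extend a (+ m))
      open Schur μ part

      numerator≈ : ∀ ν → det (λ i j → fpow (x i) a (ν j ℕ.+ δ j)) ≈ detᶜ (columns n numerator (shape ν))
      numerator≈ = det-columns (λ t i → fpow (x i) a t) numerator λ t i → reflexive
        (≡.trans (fpow≡fpower (λ _ → ≡.refl) (x i) t) (≡.cong (λ z → fpower _ z t) (≡.sym (pad-toℕ 1# x i))))

      vandermonde-≉0 : ∀ k → k ℕ.≤ n → vandermonde k ≉ 0#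
      vandermonde-≉0 zero    _   = 1≉0
      vandermonde-≉0 (suc k) k<n = *-≉0
        (∏ᴺ-≉0 k (λ i<k e → X≉X i<k k<n (x-y≈0⇒x≈y e)))
        (vandermonde-≉0 k (ℕₚ.<⇒≤ k<n))

      s≈gtSum : s x x½ a μ ≈ gtSum rows p n (shape μ)
      s≈gtSum = quotient {u = 1#} (vandermonde-≉0 n ℕₚ.≤-refl)
        (trans (*-identityˡ _) (trans (numerator≈ μ) (numerator-gtSum n anti)))
        (trans (*-identityˡ _) (trans (numerator≈ (λ _ → 0)) (trans (numerator-gtSum n anti-0)
          (trans (*-congˡ (gtSum-empty rows p n shape-0)) (*-identityʳ _)))))

      open Tableaux (λ t → t) ≡.refl ℕₚ.n≤1+n (λ t → ℕₚ.≤-refl)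

      W : ℕ → ℕ → ℕ → Carrier
      W t i j = p t (j ℕ.+ (suc t ∸ i))

      wgt≈W : ∀ {U} → U ∈ tableaux n (shape μ) → ∀ i (j : Fin (μ i)) k → toℕ k ≡ restrict μ U i j →
              wgt x x½ a k (content i j) ≈ W (toℕ k) (toℕ i) (toℕ j)
      wgt≈W U∈ i j k e = +-cong (reflexive (≡.sym (pad-toℕ 1# x k))) (reflexive (≡.cong (extend a)
        (≡.trans (identity (+ suc (toℕ k)) (+ toℕ j) (+ toℕ i))
          (≡.trans (≡.sym (index i≤ (toℕ j) 0 0)) (≡.cong +_ (ℕₚ.+-identityʳ _))))))
        where
        i≤ : toℕ i ℕ.≤ suc (toℕ k)
        i≤ = ≡.subst (λ t → toℕ i ℕ.≤ suc t) (≡.sym e) (ℕₚ.<⇒≤ (flagged U∈ i j))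
        identity : ∀ k j i → k ℤ.+ (j ℤ.- i) ≡ (j ℤ.+ (k ℤ.- i) ℤ.+ + 0) ℤ.- + 0
        identity = solve-∀

      s≈ : s x x½ a μ ≈ tableauSum μ (𝒯 μ) (wgt x x½ a)
      s≈ = trans s≈gtSum (sym (trans
        (tableauSum≈ μ toℕ toℕ-injective (UniqueP.allFin⁺ n) ∈-allFin (isTableau? μ) W (wgt x x½ a)
          (tableaux-unique n anti (pad-outside 0 μ)) toTableau entries isTableau wgt≈W)
        (TableauWeights.∑-tableaux (λ t → t) ≡.refl ℕₚ.n≤1+n (λ t → ℕₚ.≤-refl) p n W n
          (λ _ _ _ → refl) ℕₚ.≤-refl anti (pad-outside 0 μ))))

    -- m = n + 1 gives the indices of the symplectic weights, m = n those of the
    -- orthogonal ones.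
    module Pairs (m : ℕ) where

      -- From argument 1 on, this is the parameter sequence preceded by `m - k` zeros when `k ≤ m`.
      shifted : ℕ → ℕ → Carrier
      shifted k t = extend a ((t ℕ.+ k) ⊖ m)

      c-shift : ∀ k t → shifted k (suc (suc t)) ≈ shifted (suc k) (suc t)
      c-shift k t = reflexive (≡.cong (λ s → extend a (suc s ⊖ m)) (≡.sym (ℕₚ.+-suc t k)))

      open SymplecticNumerator m X X̄ XX̄ shifted c-shift (λ k<m → reflexive (extend-≤ a k<m)) public

      c-top : ∀ t → extend a (+ t) ≡ shifted m t
      c-top t = ≡.cong (extend a) (≡.sym (≡.trans (ℤₚ.⊖-≥ (ℕₚ.m≤n+m m t)) (≡.cong +_ (ℕₚ.m+n∸n≡m t m))))

      -- The difference factors as `(X i - X k) * (1# - X̄ i * X̄ k)`, and the second factor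
      -- vanishes only if `X i * X k` is 1.
      difference-≉0 : ∀ {i k} → i ℕ.< k → k ℕ.< n → (X i + X̄ i) - (X k + X̄ k) ≉ 0#
      difference-≉0 {i} {k} i<k k<n e = *-≉0
        (λ e′ → X≉X i<k k<n (x-y≈0⇒x≈y e′))
        (λ e′ → XX≉1 (ℕₚ.<-trans i<k k<n) k<n (begin
          X i * X k                      ≈⟨ *-identityʳ _ ⟨
          X i * X k * 1#                 ≈⟨ *-congˡ (x-y≈0⇒x≈y e′) ⟩
          X i * X k * (X̄ i * X̄ k)        ≈⟨ solve 4 (λ a b c d → a :* b :* (c :* d) := (a :* c) :* (b :* d)) refl (X i) (X k) (X̄ i) (X̄ k) ⟩
          (X i * X̄ i) * (X k * X̄ k)      ≈⟨ *-cong (XX̄ i) (XX̄ k) ⟩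
          1# * 1#                        ≈⟨ *-identityˡ 1# ⟩
          1#                             ∎))
        (trans factor e)
        where
        factor : (X i - X k) * (1# - X̄ i * X̄ k) ≈ (X i + X̄ i) - (X k + X̄ k)
        factor = begin
          (X i - X k) * (1# - X̄ i * X̄ k)
            ≈⟨ *-congˡ (+-congˡ (-‿distribʳ-* (X̄ i) (X̄ k))) ⟩
          (X i - X k) * (1# + X̄ i * - X̄ k)
            ≈⟨ solve 4 (λ a l ā k̄ → (a :+ l) :* (con 1 :+ ā :* k̄) := (a :+ ā :* (l :* k̄)) :+ (l :+ (a :* ā) :* k̄))
                 refl (X i) (- X k) (X̄ i) (- X̄ k) ⟩
          (X i + X̄ i * (- X k * - X̄ k)) + (- X k + (X i * X̄ i) * - X̄ k)
            ≈⟨ +-cong (+-congˡ (trans (*-congˡ neg²) (*-identityʳ _))) (+-congˡ (trans (*-congʳ (XX̄ i)) (*-identityˡ _))) ⟩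
          (X i + X̄ i) + (- X k + - X̄ k)
            ≈⟨ +-congˡ (-‿+-comm (X k) (X̄ k)) ⟩
          (X i + X̄ i) - (X k + X̄ k) ∎
          where
          neg² : - X k * - X̄ k ≈ 1#
          neg² = begin
            - X k * - X̄ k      ≈⟨ -‿distribʳ-* _ _ ⟨
            - (- X k * X̄ k)    ≈⟨ -‿cong (-‿distribˡ-* _ _) ⟨
            - - (X k * X̄ k)    ≈⟨ -‿involutive _ ⟩
            X k * X̄ k          ≈⟨ XX̄ k ⟩
            1#                 ∎

      vandermonde-≉0 : ∀ k → k ℕ.≤ n → vandermonde k ≉ 0#
      vandermonde-≉0 zero    _   = 1≉0
      vandermonde-≉0 (suc k) k<n = *-≉0
        -- If `X k` equalled its inverse, its square would be 1.
        (*-≉0 (λ e → XX≉1 k<n k<n (trans (*-congˡ (x-y≈0⇒x≈y e)) (XX̄ k)))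
              (∏ᴺ-≉0 k (λ i<k → difference-≉0 i<k k<n)))
        (vandermonde-≉0 k (ℕₚ.<⇒≤ k<n))

      p-num : ∀ k s → p (spRank {n} (num k)) s ≡ x k + shifted (suc (toℕ k)) s
      p-num k s = ≡.trans (≡.cong (λ t → p t s) (rank-num k))
        (≡.trans (interleave-even (λ k → X k + shifted (suc k) s) (λ k → X̄ k + shifted (suc k) s) (toℕ k))
          (≡.cong (_+ shifted (suc (toℕ k)) s) (pad-toℕ 1# x k)))

      p-bar : ∀ k s → p (spRank {n} (bar k)) s ≡ x k ⁻¹ + shifted (suc (toℕ k)) s
      p-bar k s = ≡.trans (≡.cong (λ t → p t s) (rank-bar k))
        (≡.trans (interleave-odd (λ k → X k + shifted (suc k) s) (λ k → X̄ k + shifted (suc k) s) (toℕ k))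
          (≡.cong (_+ shifted (suc (toℕ k)) s) (pad-toℕ 1# (x̄ x x½ a) k)))

      spRows-num : ∀ k → spRows (spRank {n} (num k)) ≡ toℕ k
      spRows-num k = ≡.trans (≡.cong spRows (rank-num k)) (⌈double/2⌉ (toℕ k))

      spRows-bar : ∀ k → spRows (spRank {n} (bar k)) ≡ suc (toℕ k)
      spRows-bar k = ≡.trans (≡.cong spRows (rank-bar k)) (⌈1+double/2⌉ (toℕ k))

      W : ℕ → ℕ → ℕ → Carrier
      W t i j = p t (j ℕ.+ (suc (spRows t) ∸ i))

      W-num : ∀ k {i} j {z} → i ℕ.≤ suc (toℕ k) →
              z ≡ (+ j ℤ.+ (+ suc (toℕ k) ℤ.- + i) ℤ.+ + suc (toℕ k)) ℤ.- + m →
              x k + extend a z ≈ W (spRank {n} (num k)) i j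
      W-num k {i} j i≤ e = reflexive (≡.sym (≡.trans (p-num k _) (≡.cong (λ z → x k + extend a z)
        (≡.trans (≡.cong (λ r → (j ℕ.+ (suc r ∸ i) ℕ.+ suc (toℕ k)) ⊖ m) (spRows-num k))
          (≡.trans (index i≤ j (suc (toℕ k)) m) (≡.sym e))))))

      W-bar : ∀ k {i} j {z} → i ℕ.≤ suc (suc (toℕ k)) →
              z ≡ (+ j ℤ.+ (+ suc (suc (toℕ k)) ℤ.- + i) ℤ.+ + suc (toℕ k)) ℤ.- + m →
              x k ⁻¹ + extend a z ≈ W (spRank {n} (bar k)) i j
      W-bar k {i} j i≤ e = reflexive (≡.sym (≡.trans (p-bar k _) (≡.cong (λ z → x k ⁻¹ + extend a z)
        (≡.trans (≡.cong (λ r → (j ℕ.+ (suc r ∸ i) ℕ.+ suc (toℕ k)) ⊖ m) (spRows-bar k))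
          (≡.trans (index i≤ j (suc (toℕ k)) m) (≡.sym e))))))

      below-flag : ∀ ℓ {i} → i ℕ.< spRows (suc (spRank {n} ℓ)) → i ℕ.≤ suc (toℕ (spIndex ℓ))
      below-flag ℓ {i} i< = ℕₚ.<⇒≤ (≡.subst (i ℕ.<_) (spRows-rank ℓ) i<)

    module SymplecticCase where
      open Pairs (suc n)
      open Symplectic μ part

      -- As `m` is `n + 1`, the sequence `shifted n` is `a` with one zero in front. This zero
      -- accounts for the bare factors `x i` and `x i ⁻¹` in the entries.
      numerator≈ : ∀ ν → det (λ i j → x i * fpow (x i) a (ν j ℕ.+ δ j) - x i ⁻¹ * fpow (x i ⁻¹) a (ν j ℕ.+ δ j)) ≈
                   detᶜ (columns n (F n ∘ suc) (shape ν))
      numerator≈ = det-columns (λ t i → x i * fpow (x i) a t - x i ⁻¹ * fpow (x i ⁻¹) a t) (F n ∘ suc) λ t i →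
        +-cong (entry (x i) (pad-toℕ 1# x i) t) (-‿cong (entry (x i ⁻¹) (pad-toℕ 1# (x̄ x x½ a) i) t))
        where
        entry : ∀ z {y} → y ≡ z → ∀ t → z * fpow z a t ≈ fpower (shifted n) y (suc t)
        entry z ≡.refl t = trans (*-congˡ (reflexive (fpow≡fpower (c-top ∘ suc) z t)))
          (sym (fpower-shift ℕₚ.≤-refl z t))

      rows-n : Rows n (shape μ)
      rows-n = pad-outside 0 μ

      sp≈gtSum : sp x x½ a μ ≈ gtSum rows p (double n) (shape μ)
      sp≈gtSum = quotient {u = 1#} (vandermonde-≉0 n ℕₚ.≤-refl)
        (trans (*-identityˡ _) (trans (numerator≈ μ) (numerator-gtSum n (ℕₚ.n≤1+n n) anti rows-n)))
        (trans (*-identityˡ _) (trans (numerator≈ (λ _ → 0))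
          (trans (numerator-gtSum n (ℕₚ.n≤1+n n) anti-0 (λ i _ → shape-0 i))
            (trans (*-congˡ (gtSum-empty rows p (double n) shape-0)) (*-identityʳ _)))))

      open Tableaux spRows ≡.refl spRows-mono spRows-step

      weights : ∀ ℓ i j → i ℕ.≤ suc (toℕ (spIndex ℓ)) →
                wgtˢᵖ x x½ a ℓ (+ j ℤ.- + i) ≈ W (spRank ℓ) i j
      weights (num k) i j i≤ = W-num k j i≤ (identity (+ suc (toℕ k)) (+ n) (+ j) (+ i))
        where
        identity : ∀ k n j i → + 2 ℤ.* k ℤ.- + 1 ℤ.- n ℤ.+ (j ℤ.- i) ≡ (j ℤ.+ (k ℤ.- i) ℤ.+ k) ℤ.- (+ 1 ℤ.+ n)
        identity = solve-∀
      weights (bar k) i j i≤ = W-bar k j (ℕₚ.m≤n⇒m≤1+n i≤) (identity (+ suc (toℕ k)) (+ n) (+ j) (+ i))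
        where
        identity : ∀ k n j i → + 2 ℤ.* k ℤ.- n ℤ.+ (j ℤ.- i) ≡ (j ℤ.+ ((+ 1 ℤ.+ k) ℤ.- i) ℤ.+ k) ℤ.- (+ 1 ℤ.+ n)
        identity = solve-∀

      rows-2n : Rows (spRows (double n)) (shape μ)
      rows-2n = ≡.subst (λ r → Rows r (shape μ)) (≡.sym (⌈double/2⌉ n)) rows-n

      sp≈ : sp x x½ a μ ≈ tableauSum μ (𝒯ˢᵖ μ) (wgtˢᵖ x x½ a)
      sp≈ = trans sp≈gtSum (sym (trans
        (tableauSum≈ μ spRank spRank-injective (spLetters-unique n) spLetters-complete (isSpTableau? μ) W (wgtˢᵖ x x½ a)
          (tableaux-unique (double n) anti rows-2n) toTableau entries isTableau
          (λ U∈ i j ℓ e → weights ℓ (toℕ i) (toℕ j)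
            (below-flag ℓ (≡.subst (λ t → toℕ i ℕ.< spRows (suc t)) (≡.sym e) (flagged U∈ i j)))))
        (TableauWeights.∑-tableaux spRows ≡.refl spRows-mono spRows-step p n W (double n)
          (λ _ _ _ → refl) (ℕₚ.≤-reflexive (⌈double/2⌉ n)) anti rows-2n)))

    module OrthogonalCase where
      open Pairs n
      open Orthogonal X½ X̄½ X½² X̄½² X½X̄½
      open OrthogonalTableaux μ part

      numerator≈ : ∀ ν → det (λ i j → x½ i * fpow (x i) a (ν j ℕ.+ δ j) - x½ i ⁻¹ * fpow (x i ⁻¹) a (ν j ℕ.+ δ j)) ≈
                   detᶜ (columns n G (shape ν))
      numerator≈ = det-columns (λ t i → x½ i * fpow (x i) a t - x½ i ⁻¹ * fpow (x i ⁻¹) a t) G λ t i →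
        +-cong (*-cong (reflexive (≡.sym (pad-toℕ 1# x½ i))) (entry (pad-toℕ 1# x i) t))
          (-‿cong (*-cong (reflexive (≡.sym (pad-toℕ 1# (x̄½ x x½ a) i))) (entry (pad-toℕ 1# (x̄ x x½ a) i) t)))
        where
        entry : ∀ {y z} → y ≡ z → ∀ t → fpow z a t ≈ fpower (shifted n) y t
        entry {z = z} ≡.refl t = reflexive (fpow≡fpower (c-top ∘ suc) z t)

      so≈gtSum : so x x½ a μ ≈
                 ∑ˡ (λ ν → skewWeight n q (shape μ) ν * gtSum rows p (double n) ν) (verticalStrips n (shape μ))
      so≈gtSum = quotient {u = ∏ᴺ n u} (vandermonde-≉0 n ℕₚ.≤-refl)
        (trans (*-congˡ (numerator≈ μ)) (orthogonal-gtSum anti))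
        (trans (*-congˡ (numerator≈ (λ _ → 0))) (orthogonal-empty shape-0))

      open Tableaux spRows ≡.refl spRows-mono spRows-step

      -- The letter 0 has rank 2n.
      W₀ : ℕ → ℕ → ℕ → Carrier
      W₀ t i j with t ℕₚ.≟ double n
      ... | yes _ = q (j ℕ.+ (suc (spRows t) ∸ i))
      ... | no  _ = W t i j

      W₀-< : ∀ {t} → t ℕ.< double n → ∀ i j → W₀ t i j ≡ W t i j
      W₀-< {t} t< i j with t ℕₚ.≟ double n
      ... | yes e = contradiction e (ℕₚ.<⇒≢ t<)
      ... | no  _ = ≡.refl

      W₀-2n : ∀ i j → W₀ (double n) i j ≡ q (j ℕ.+ (suc (spRows (double n)) ∸ i))
      W₀-2n i j with double n ℕₚ.≟ double n
      ... | yes _ = ≡.refl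
      ... | no ¬e = contradiction ≡.refl ¬e

      weights : ∀ (ℓ : SpLetter n) i j → i ℕ.≤ suc (toℕ (spIndex ℓ)) →
                wgtˢᵒ x x½ a ⌊ ℓ ⌋ (+ j ℤ.- + i) ≈ W₀ (spRank ℓ) i j
      weights ℓ i j i≤ = trans (pairs ℓ i≤) (reflexive (≡.sym (W₀-< (spRank-< ℓ) i j)))
        where
        identity₁ : ∀ k n j i → + 2 ℤ.* k ℤ.- n ℤ.+ (j ℤ.- i) ≡ (j ℤ.+ (k ℤ.- i) ℤ.+ k) ℤ.- n
        identity₁ = solve-∀
        identity₂ : ∀ k n j i → + 2 ℤ.* k ℤ.+ + 1 ℤ.- n ℤ.+ (j ℤ.- i) ≡ (j ℤ.+ ((+ 1 ℤ.+ k) ℤ.- i) ℤ.+ k) ℤ.- n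
        identity₂ = solve-∀
        pairs : ∀ ℓ → i ℕ.≤ suc (toℕ (spIndex ℓ)) → wgtˢᵒ x x½ a ⌊ ℓ ⌋ (+ j ℤ.- + i) ≈ W (spRank ℓ) i j
        pairs (num k) i≤ = W-num k j i≤ (identity₁ (+ suc (toℕ k)) (+ n) (+ j) (+ i))
        pairs (bar k) i≤ = W-bar k j (ℕₚ.m≤n⇒m≤1+n i≤) (identity₂ (+ suc (toℕ k)) (+ n) (+ j) (+ i))

      -- All `n` rows stay available after the removal of 0, hence the offset `n + 1`; and
      -- `shifted n` adds no zeros, as `m` is `n`.
      weight-𝟎 : ∀ i j → i ℕ.≤ suc n → wgtˢᵒ x x½ a 𝟎 (+ j ℤ.- + i) ≈ W₀ (rank {n} 𝟎) i j
      weight-𝟎 i j i≤ = reflexive (≡.sym (≡.trans (≡.cong (λ t → W₀ t i j) (rank-𝟎 {n})) (≡.trans (W₀-2n i j)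
        (≡.cong (λ z → 1# - extend a z)
          (≡.trans (≡.cong (λ r → (j ℕ.+ (suc r ∸ i) ℕ.+ n) ⊖ n) (⌈double/2⌉ n))
            (≡.trans (index i≤ j n n) (identity (+ n) (+ j) (+ i))))))))
        where
        identity : ∀ n j i → (j ℤ.+ ((+ 1 ℤ.+ n) ℤ.- i) ℤ.+ n) ℤ.- n ≡ n ℤ.+ + 1 ℤ.+ (j ℤ.- i)
        identity = solve-∀

      wgt≈W₀ : ∀ {U} → U ∈ soTableaux (double n) (shape μ) → ∀ i (j : Fin (μ i)) ℓ → rank ℓ ≡ restrict μ U i j →
               wgtˢᵒ x x½ a ℓ (content i j) ≈ W₀ (rank ℓ) (toℕ i) (toℕ j)
      wgt≈W₀ U∈ i j ℓ e with letterView ℓ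
      ... | nonzero ℓ′ = weights ℓ′ (toℕ i) (toℕ j) (below-flag ℓ′ (≡.subst (λ t → toℕ i ℕ.< spRows (suc t)) (≡.sym e)
                      (flagged U∈ i j (≡.subst (ℕ._< double n) e (spRank-< ℓ′)))))
      ... | zero  = weight-𝟎 (toℕ i) (toℕ j) (ℕₚ.m≤n⇒m≤1+n (ℕₚ.<⇒≤ (toℕ<n i)))

      so≈ : so x x½ a μ ≈ tableauSum μ (𝒯ˢᵒ μ) (wgtˢᵒ x x½ a)
      so≈ = trans so≈gtSum (sym (trans
        (tableauSum≈ μ rank rank-injective (soLetters-unique n) soLetters-complete (isSoTableau? μ) W₀ (wgtˢᵒ x x½ a)
          (soTableaux-unique (double n) (shape μ)) toTableau entries isTableau wgt≈W₀)
        (TableauWeights.∑-soTableaux spRows ≡.refl spRows-mono spRows-step p n W₀ (double n) {q}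
          (λ s< _ j → reflexive (W₀-< s< _ j)) (λ _ j → reflexive (W₀-2n _ j)) (⌈double/2⌉ n) anti)))

theorem4p4 : ∀ {c ℓ c′ ℓ′} (k : CommutativeRing c′ ℓ′) (K : Field c ℓ) →
    let module k = CommutativeRing k
        module K = Field K
        open FactorialCharacters K
    in
    (ι : k.Carrier → K.Carrier) → IsRingHomomorphism k.rawRing K.rawRing ι →
    (n : ℕ) → 1 ≤ n →
    (x x½ : Fin n → K.Carrier) →
    AlgebraicallyIndependent k K ι x →
    (∀ i → x½ i K.* x½ i K.≈ x i) →
    (μ : Fin n → ℕ) → IsPartition μ →
    (a : ℕ → k.Carrier) →
    let ιa : ℕ → K.Carrier
        ιa m = ι (a m)
    in
    (s x x½ ιa μ K.≈ tableauSum μ (𝒯 μ) (wgt x x½ ιa)) ×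
    (sp x x½ ιa μ K.≈ tableauSum μ (𝒯ˢᵖ μ) (wgtˢᵖ x x½ ιa)) ×
    (so x x½ ιa μ K.≈ tableauSum μ (𝒯ˢᵒ μ) (wgtˢᵒ x x½ ιa))
theorem4p4 k K ι ι-hom n _ x x½ indep x½² μ part a = SchurCase.s≈ , SymplecticCase.sp≈ , OrthogonalCase.so≈
  where
  open Characters K
  open Independence k ι ι-hom x indep
  open Main x x½ (λ m → ι (a m)) μ part x≉0 x≉x xx≉1 x½²
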